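{- For all non-negative integers $r_0, r_1$, not both zero, and each real $R> 0$, the following holds. Suppose that $\mathcal{H}$ is a non-empty $(r_0, r_1)$-bounded hypergraph on $V=V_0\cup V_1$ (with $V_0,V_1$ disjoint finite sets), and $b,m,q$ are positive integers with $b\leq \min\{m,|V_1|\}$, satisfying \[\Delta_{(\ell_0,\ell_1)}(\mathcal{H})\leq R \frac{b^{\ell_0+\ell_1-1}}{m^{\ell_0}|V_1|^{\ell_1}}e(\mathcal{H})\left(\frac{m}{q}\right)^{{1}[\ell_0>0]}\] for every pair $(\ell_0,\ell_1)\in \{0,1,\ldots,r_0\}\times\{0,1,\ldots,r_1\}\setminus \{(0,0)\}$. Then there exist a family $\mathcal{S}\subset \binom{V_0}{\leq r_0b}\times\binom{V_1}{\leq r_1b}$ and functions $f\colon \mathcal{S}\to 2^{V_0}\times 2^{V_1}$ and $g\colon \mathcal{F}_{\leq m}(\mathcal{H})\to \mathcal{S}$ such that, letting $\delta=2^{ -(r_0+r_1+1)(r_0+r_1)}R^{ -1}$: (i) if $(I,J)\in\mathcal{F}_{\leq m}(\mathcal{H})$ and $f(g(I,J))=(A,B)$, then $A\subset I$ and $J\subset B$; (ii) for every $(A,B)\in f(\mathcal{S})$, either $|A|\geq \delta q$ or $|B|\leq (1-\delta)|V_1|$; (iii) if $g(I,J)=(S_0,S_1)$ and $f(g(I,J))=(A,B)$, then $S_0\subset V_0\setminus I$ and $S_1\subset J$, and $|S_0|>0$ only if $|A|\geq \delta q$.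
   Context: Given disjoint finite sets $V_0,V_1$, an $(r_0,r_1)$-bounded hypergraph $\mathcal{H}$ on $V=V_0\cup V_1$ is a set of edges $E(\mathcal{H})\subset \binom{V_0}{\leq r_0}\times \binom{V_1}{\leq r_1}$; $e(\mathcal{H})=|E(\mathcal{H})|$. A pair $(W_0,W_1)\in 2^{V_0}\times 2^{V_1}$ violates an edge $(e_0,e_1)$ if $e_0\subset V_0\setminus W_0$ and $e_1\subset W_1$; it is independent if it violates no edge. $\mathcal{F}_{\leq m}(\mathcal{H})$ is the family of independent pairs $(W_0,W_1)$ with $|W_0|\leq m$. For $L_0\subset V_0$, $L_1\subset V_1$, the codegree $d_{(L_0,L_1)}(\mathcal{H})$ is the number of edges $(e_0,e_1)$ with $L_0\subset e_0$ and $L_1\subset e_1$, and $\Delta_{(\ell_0,\ell_1)}(\mathcal{H})=\max\{d_{(L_0,L_1)}(\mathcal{H}): |L_0|=\ell_0,|L_1|=\ell_1\}$. $1[\ell_0>0]$ is $1$ if $\ell_0>0$ and $0$ otherwise. $\binom{X}{\le k}$ denotes the family of subsets of $X$ of size at most $k$. -}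

module Defs where

open import Data.Bool.Base using (Bool; T; if_then_else_)
open import Data.Bool.Properties using (T?)
open import Data.Fin.Subset using (Subset; inside; outside; _⊆_; ∁; ∣_∣)
open import Data.Fin.Subset.Properties using (_⊆?_)
open import Data.Integer.Base using (+_)
open import Data.List.Base using (List; []; _∷_; _++_; map; filter; length; cartesianProduct)
open import Data.List.Extrema.Nat using (max)
open import Data.Nat.Base as ℕ using (ℕ; zero; suc)
import Data.Nat.Properties as ℕ
open import Data.Product.Base using (Σ-syntax; ∃-syntax; _×_; _,_; proj₁; proj₂)
open import Data.Rational.Base as ℚ using (ℚ; 0ℚ; 1ℚ; ½; Positive; NonNegative; positive; nonNegative)
import Data.Rational.Properties as ℚ
open import Data.Rational.Solver using (module +-*-Solver)
open import Data.Vec.Base using ([]; _∷_)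
open import Relation.Binary.PropositionalEquality using (_≡_; refl; sym; trans; cong; cong₂; subst; subst₂)
open import Relation.Nullary using (¬_)
open import Relation.Nullary.Decidable using (_×-dec_; does)
import Algebra.Definitions.RawSemiring ℚ.+-*-rawSemiring as ℚ-Power

infixl 7 _÷_
infixr 8 _^ℚ_

-- Total division; every denominator it is used with (powers of 2, q, and
-- products of powers of m and |V₁|) is positive, so the value at 0 is immaterial.
_÷_ : ℕ → ℕ → ℚ
n ÷ zero  = 0ℚ
n ÷ suc d = + n ℚ./ suc d

_^ℚ_ : ℚ → ℕ → ℚ
_^ℚ_ = ℚ-Power._^_

-- Real numbers: Cauchy sequences of rationals. The relations below do
-- not depend on the representative; no quotient is taken.

Cauchy : (ℕ → ℚ) → Set
Cauchy s = ∀ ε → 0ℚ ℚ.< ε →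
  ∃[ N ] (∀ i j → N ℕ.≤ i → N ℕ.≤ j → ℚ.∣ s i ℚ.- s j ∣ ℚ.< ε)

record ℝ : Set where
  constructor mkℝ
  field
    seq    : ℕ → ℚ
    cauchy : Cauchy seq

open ℝ public

infix 4 _≤ᴿ_ _<ᴿ_

_≤ᴿ_ : ℝ → ℝ → Set
x ≤ᴿ y = ∀ ε → 0ℚ ℚ.< ε →
  ∃[ N ] (∀ i → N ℕ.≤ i → seq x i ℚ.≤ seq y i ℚ.+ ε)

_<ᴿ_ : ℝ → ℝ → Set
x <ᴿ y = Σ[ ε ∈ ℚ ] 0ℚ ℚ.< ε ×
  ∃[ N ] (∀ i → N ℕ.≤ i → seq x i ℚ.+ ε ℚ.≤ seq y i)

fromℚ : ℚ → ℝ
fromℚ p = mkℝ (λ _ → p) λ ε 0<ε → 0 , λ _ _ _ _ →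
  subst (ℚ._< ε) (sym (cong ℚ.∣_∣ (ℚ.+-inverseʳ p))) 0<ε

fromℕ : ℕ → ℝ
fromℕ n = fromℚ (+ n ℚ./ 1)

0ᴿ 1ᴿ : ℝ
0ᴿ = fromℚ 0ℚ
1ᴿ = fromℚ 1ℚ

private
  open +-*-Solver using (solve; _:+_; _:*_; _:-_; :-_; _:=_; con)

  halves : ∀ ε → ½ ℚ.* ε ℚ.+ ½ ℚ.* ε ≡ ε
  halves ε = trans (sym (ℚ.*-distribʳ-+ ε ½ ½)) (ℚ.*-identityˡ ε)

  *-pos : ∀ {p q} → 0ℚ ℚ.< p → 0ℚ ℚ.< q → 0ℚ ℚ.< p ℚ.* q
  *-pos {p} {q} 0<p 0<q =
    ℚ.positive⁻¹ (p ℚ.* q) {{ℚ.pos*pos⇒pos p {{positive 0<p}} q {{positive 0<q}}}}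

  half-pos : ∀ {ε} → 0ℚ ℚ.< ε → 0ℚ ℚ.< ½ ℚ.* ε
  half-pos = *-pos (ℚ.positive⁻¹ ½)

  *-mono-≤ : ∀ {a b c d} → 0ℚ ℚ.≤ b → 0ℚ ℚ.≤ c →
             a ℚ.≤ b → c ℚ.≤ d → a ℚ.* c ℚ.≤ b ℚ.* d
  *-mono-≤ {b = b} {c} 0≤b 0≤c a≤b c≤d = ℚ.≤-trans
    (ℚ.*-monoʳ-≤-nonNeg c {{nonNegative 0≤c}} a≤b)
    (ℚ.*-monoˡ-≤-nonNeg b {{nonNegative 0≤b}} c≤d)

  eventually-bounded : ∀ s → Cauchy s → Σ[ K ∈ ℚ ] 0ℚ ℚ.< K ×
                       ∃[ N ] (∀ i → N ℕ.≤ i → ℚ.∣ s i ∣ ℚ.≤ K)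
  eventually-bounded s c with c 1ℚ (ℚ.positive⁻¹ 1ℚ)
  ... | N , near = K , 0<K , N , bd
    where
    K = 1ℚ ℚ.+ ℚ.∣ s N ∣
    0<K : 0ℚ ℚ.< K
    0<K = ℚ.+-mono-<-≤ (ℚ.positive⁻¹ 1ℚ) (ℚ.0≤∣p∣ (s N))
    bd : ∀ i → N ℕ.≤ i → ℚ.∣ s i ∣ ℚ.≤ K
    bd i N≤i = ℚ.≤-trans
      (ℚ.≤-reflexive (cong ℚ.∣_∣ (solve 2 (λ a b → a := (a :- b) :+ b) refl (s i) (s N))))
      (ℚ.≤-trans (ℚ.∣p+q∣≤∣p∣+∣q∣ (s i ℚ.- s N) (s N))
        (ℚ.+-monoˡ-≤ ℚ.∣ s N ∣ (ℚ.<⇒≤ (near i N N≤i ℕ.≤-refl))))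

infixl 6 _+ᴿ_ _-ᴿ_
infixl 7 _*ᴿ_

_+ᴿ_ : ℝ → ℝ → ℝ
x +ᴿ y = mkℝ (λ i → seq x i ℚ.+ seq y i) λ ε 0<ε →
  let (M , p) = cauchy x (½ ℚ.* ε) (half-pos 0<ε)
      (N , q) = cauchy y (½ ℚ.* ε) (half-pos 0<ε)
  in M ℕ.⊔ N , λ i j i≥ j≥ →
    let a = seq x i ; b = seq y i ; c = seq x j ; d = seq y j in
    ℚ.≤-<-trans
      (ℚ.≤-trans
        (ℚ.≤-reflexive (cong ℚ.∣_∣
          (solve 4 (λ a b c d → (a :+ b) :- (c :+ d) := (a :- c) :+ (b :- d)) refl a b c d)))
        (ℚ.∣p+q∣≤∣p∣+∣q∣ (a ℚ.- c) (b ℚ.- d)))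
      (subst (_ ℚ.<_) (halves ε)
        (ℚ.+-mono-<
          (p i j (ℕ.m⊔n≤o⇒m≤o M N i≥) (ℕ.m⊔n≤o⇒m≤o M N j≥))
          (q i j (ℕ.m⊔n≤o⇒n≤o M N i≥) (ℕ.m⊔n≤o⇒n≤o M N j≥))))

-ᴿ_ : ℝ → ℝ
-ᴿ x = mkℝ (λ i → ℚ.- seq x i) λ ε 0<ε →
  let (N , p) = cauchy x ε 0<ε
  in N , λ i j i≥ j≥ → subst (ℚ._< ε)
    (trans (sym (ℚ.∣-p∣≡∣p∣ (seq x i ℚ.- seq x j))) (cong ℚ.∣_∣
      (solve 2 (λ a b → :- (a :- b) := (:- a) :- (:- b)) refl (seq x i) (seq x j))))
    (p i j i≥ j≥)

_-ᴿ_ : ℝ → ℝ → ℝ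
x -ᴿ y = x +ᴿ (-ᴿ y)

private
  share : ∀ K → 0ℚ ℚ.< K → ∀ ε → 0ℚ ℚ.< ε →
          Σ[ η ∈ ℚ ] 0ℚ ℚ.< η × K ℚ.* η ≡ ε
  share K 0<K ε 0<ε = K⁻¹ ℚ.* ε ,
    *-pos (ℚ.positive⁻¹ K⁻¹ {{ℚ.1/pos⇒pos K {{positive 0<K}}}}) 0<ε ,
    trans (sym (ℚ.*-assoc K K⁻¹ ε))
      (trans (cong (ℚ._* ε) (ℚ.*-inverseʳ K {{ℚ.>-nonZero 0<K}})) (ℚ.*-identityˡ ε))
    where K⁻¹ = (ℚ.1/ K) {{ℚ.>-nonZero 0<K}}

  bound-* : ∀ {K η a b} → 0ℚ ℚ.< K → ℚ.∣ a ∣ ℚ.≤ K → ℚ.∣ b ∣ ℚ.< η →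
            ℚ.∣ a ℚ.* b ∣ ℚ.< K ℚ.* η
  bound-* {K} {η} {a} {b} 0<K a≤K b<η = ℚ.≤-<-trans
    (ℚ.≤-trans (ℚ.≤-reflexive (ℚ.∣p*q∣≡∣p∣*∣q∣ a b))
      (*-mono-≤ (ℚ.<⇒≤ 0<K) (ℚ.0≤∣p∣ b) a≤K ℚ.≤-refl))
    (ℚ.*-monoʳ-<-pos K {{positive 0<K}} b<η)

_*ᴿ_ : ℝ → ℝ → ℝ
x *ᴿ y = mkℝ (λ i → seq x i ℚ.* seq y i) λ ε 0<ε →
  let (K , 0<K , M₁ , x≤K) = eventually-bounded (seq x) (cauchy x)
      (L , 0<L , M₂ , y≤L) = eventually-bounded (seq y) (cauchy y)
      (η , 0<η , Kη) = share K 0<K (½ ℚ.* ε) (half-pos 0<ε)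
      (θ , 0<θ , Lθ) = share L 0<L (½ ℚ.* ε) (half-pos 0<ε)
      (N₁ , x-near) = cauchy x θ 0<θ
      (N₂ , y-near) = cauchy y η 0<η
      M = M₁ ℕ.⊔ M₂
      N = N₁ ℕ.⊔ N₂
  in M ℕ.⊔ N , λ i j i≥ j≥ →
    let a = seq x i ; b = seq y i ; c = seq x j ; d = seq y j
        i≥M = ℕ.m⊔n≤o⇒m≤o M N i≥ ; i≥N = ℕ.m⊔n≤o⇒n≤o M N i≥
        j≥M = ℕ.m⊔n≤o⇒m≤o M N j≥ ; j≥N = ℕ.m⊔n≤o⇒n≤o M N j≥
    in ℚ.≤-<-trans
      (ℚ.≤-trans
        (ℚ.≤-reflexive (cong ℚ.∣_∣
          (solve 4 (λ a b c d → (a :* b) :- (c :* d) := (a :* (b :- d)) :+ (d :* (a :- c)))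
            refl a b c d)))
        (ℚ.∣p+q∣≤∣p∣+∣q∣ (a ℚ.* (b ℚ.- d)) (d ℚ.* (a ℚ.- c))))
      (subst (_ ℚ.<_) (trans (cong₂ ℚ._+_ Kη Lθ) (halves ε))
        (ℚ.+-mono-<
          (bound-* {a = a} 0<K (x≤K i (ℕ.m⊔n≤o⇒m≤o M₁ M₂ i≥M))
            (y-near i j (ℕ.m⊔n≤o⇒n≤o N₁ N₂ i≥N) (ℕ.m⊔n≤o⇒n≤o N₁ N₂ j≥N)))
          (bound-* {a = d} 0<L (y≤L j (ℕ.m⊔n≤o⇒n≤o M₁ M₂ j≥M))
            (x-near i j (ℕ.m⊔n≤o⇒m≤o N₁ N₂ i≥N) (ℕ.m⊔n≤o⇒m≤o N₁ N₂ j≥N)))))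

-- The inverse of a positive real. Terms before the index from which the
-- sequence is bounded away from 0 are dropped.
inv : (x : ℝ) → 0ᴿ <ᴿ x → ℝ
inv x (c , 0<c , N , c≤x) = mkℝ s λ ε 0<ε →
  let (η , 0<η , c⁻¹c⁻¹η) = share (c⁻¹ ℚ.* c⁻¹) (*-pos 0<c⁻¹ 0<c⁻¹) ε 0<ε
      (M , near) = cauchy x η 0<η
  in M , λ i j i≥ j≥ →
    subst₂ ℚ._<_
      (cong ℚ.∣_∣ (difference (t i) (t j) (s i) (s j) (st i) (st j)))
      c⁻¹c⁻¹η
      (bound-* {a = s i ℚ.* s j} (*-pos 0<c⁻¹ 0<c⁻¹) (ss≤ i j)
        (near (N ℕ.+ j) (N ℕ.+ i) (ℕ.≤-trans j≥ (ℕ.m≤n+m j N)) (ℕ.≤-trans i≥ (ℕ.m≤n+m i N))))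
  where
  t : ℕ → ℚ
  t i = seq x (N ℕ.+ i)

  c≤t : ∀ i → c ℚ.≤ t i
  c≤t i = subst (ℚ._≤ t i) (ℚ.+-identityˡ c) (c≤x (N ℕ.+ i) (ℕ.m≤m+n N i))

  0<t : ∀ i → 0ℚ ℚ.< t i
  0<t i = ℚ.<-≤-trans 0<c (c≤t i)

  c⁻¹ : ℚ
  c⁻¹ = (ℚ.1/ c) {{ℚ.>-nonZero 0<c}}

  0<c⁻¹ : 0ℚ ℚ.< c⁻¹
  0<c⁻¹ = ℚ.positive⁻¹ c⁻¹ {{ℚ.1/pos⇒pos c {{positive 0<c}}}}

  s : ℕ → ℚ
  s i = (ℚ.1/ t i) {{ℚ.>-nonZero (0<t i)}}

  0<s : ∀ i → 0ℚ ℚ.< s i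
  0<s i = ℚ.positive⁻¹ (s i) {{ℚ.1/pos⇒pos (t i) {{positive (0<t i)}}}}

  st : ∀ i → s i ℚ.* t i ≡ 1ℚ
  st i = ℚ.*-inverseˡ (t i) {{ℚ.>-nonZero (0<t i)}}

  s≤c⁻¹ : ∀ i → s i ℚ.≤ c⁻¹
  s≤c⁻¹ i = subst₂ ℚ._≤_
    (trans (cong (s i ℚ.*_) (ℚ.*-inverseʳ c {{ℚ.>-nonZero 0<c}})) (ℚ.*-identityʳ (s i)))
    (trans (sym (ℚ.*-assoc (s i) (t i) c⁻¹))
      (trans (cong (ℚ._* c⁻¹) (st i)) (ℚ.*-identityˡ c⁻¹)))
    (ℚ.*-monoˡ-≤-nonNeg (s i) {{nonNegative (ℚ.<⇒≤ (0<s i))}}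
      (ℚ.*-monoʳ-≤-nonNeg c⁻¹ {{nonNegative (ℚ.<⇒≤ 0<c⁻¹)}} (c≤t i)))

  ss≤ : ∀ i j → ℚ.∣ s i ℚ.* s j ∣ ℚ.≤ c⁻¹ ℚ.* c⁻¹
  ss≤ i j = ℚ.≤-trans
    (ℚ.≤-reflexive (ℚ.0≤p⇒∣p∣≡p (ℚ.<⇒≤ (*-pos (0<s i) (0<s j)))))
    (*-mono-≤ (ℚ.<⇒≤ 0<c⁻¹) (ℚ.<⇒≤ (0<s j)) (s≤c⁻¹ i) (s≤c⁻¹ j))

  difference : ∀ a b a' b' → a' ℚ.* a ≡ 1ℚ → b' ℚ.* b ≡ 1ℚ →
               (a' ℚ.* b') ℚ.* (b ℚ.- a) ≡ a' ℚ.- b'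
  difference a b a' b' p q = trans
    (solve 4 (λ a b a' b' → (a' :* b') :* (b :- a) := (a' :* (b' :* b)) :- (b' :* (a' :* a)))
      refl a b a' b')
    (cong₂ ℚ._-_
      (trans (cong (a' ℚ.*_) q) (ℚ.*-identityʳ a'))
      (trans (cong (b' ℚ.*_) p) (ℚ.*-identityʳ b')))

-- Hypergraphs. The disjoint vertex classes V₀ and V₁ are Fin n₀ and
-- Fin n₁; a pair stands for an element of 2^V₀ × 2^V₁.

Pair : ℕ → ℕ → Set
Pair n₀ n₁ = Subset n₀ × Subset n₁

-- A set of pairs, given by its characteristic function.
Family : ℕ → ℕ → Set
Family n₀ n₁ = Pair n₀ n₁ → Bool

infix 4 _∈ᶠ_

_∈ᶠ_ : ∀ {n₀ n₁} → Pair n₀ n₁ → Family n₀ n₁ → Set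
e ∈ᶠ F = T (F e)

-- F ⊂ binom(V₀, ≤ k₀) × binom(V₁, ≤ k₁)
Bounded : ∀ {n₀ n₁} → ℕ → ℕ → Family n₀ n₁ → Set
Bounded k₀ k₁ F = ∀ e₀ e₁ → (e₀ , e₁) ∈ᶠ F → ∣ e₀ ∣ ℕ.≤ k₀ × ∣ e₁ ∣ ℕ.≤ k₁

record Hypergraph (r₀ r₁ n₀ n₁ : ℕ) : Set where
  field
    E       : Family n₀ n₁
    E-bound : Bounded r₀ r₁ E

open Hypergraph public

allSubsets : ∀ n → List (Subset n)
allSubsets zero    = [] ∷ []
allSubsets (suc n) = map (outside ∷_) (allSubsets n) ++ map (inside ∷_) (allSubsets n)

allPairs : ∀ n₀ n₁ → List (Pair n₀ n₁)
allPairs n₀ n₁ = cartesianProduct (allSubsets n₀) (allSubsets n₁)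

Violates : ∀ {n₀ n₁} → Pair n₀ n₁ → Pair n₀ n₁ → Set
Violates (W₀ , W₁) (e₀ , e₁) = e₀ ⊆ ∁ W₀ × e₁ ⊆ W₁

module _ {r₀ r₁ n₀ n₁ : ℕ} (H : Hypergraph r₀ r₁ n₀ n₁) where

  NonEmpty : Set
  NonEmpty = ∃[ e ] e ∈ᶠ E H

  edges : List (Pair n₀ n₁)
  edges = filter (λ e → T? (E H e)) (allPairs n₀ n₁)

  #e : ℕ
  #e = length edges

  codegree : Pair n₀ n₁ → ℕ
  codegree (L₀ , L₁) =
    length (filter (λ e → (L₀ ⊆? proj₁ e) ×-dec (L₁ ⊆? proj₂ e)) edges)

  -- The maximum over the empty set (ℓ₀ > n₀ or ℓ₁ > n₁) is 0.
  Δ : ℕ → ℕ → ℕ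
  Δ ℓ₀ ℓ₁ = max 0 (map codegree
    (filter (λ L → (∣ proj₁ L ∣ ℕ.≟ ℓ₀) ×-dec (∣ proj₂ L ∣ ℕ.≟ ℓ₁)) (allPairs n₀ n₁)))

  Independent : Pair n₀ n₁ → Set
  Independent W = ∀ e → e ∈ᶠ E H → ¬ Violates W e

  𝓕≤ : ℕ → Pair n₀ n₁ → Set
  𝓕≤ m W = Independent W × ∣ proj₁ W ∣ ℕ.≤ m

𝟙[0<_] : ℕ → ℕ
𝟙[0< ℓ ] = if does (0 ℕ.<? ℓ) then 1 else 0

{-# OPTIONS --safe #-}

-- Write Z = (V₀ ∖ I, J), so that (I, J) violates an edge exactly when the edge
-- lies in Z. An algorithm asks, for vertices v, whether v ∈ Z; the accepted
-- vertices form the fingerprint (S₀, S₁), and the rejected ones, which the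
-- fingerprint determines, give A and V₁ ∖ B. One stage turns a hypergraph G
-- into the multiset G* of the links of at most b accepted vertices of maximum
-- degree, dropping edges that contain a set whose codegree in G* is already
-- high. If few vertices are rejected, then the ratio of maximum codegrees to
-- the number of edges grows by at most 2^(k+2), where k bounds the size of the
-- edges, and the edges lose a vertex. Hence after at most r₀ + r₁ stages,
-- those in V₁ first, many vertices were rejected: otherwise an empty edge,
-- contained in Z, would remain. Restricting at the start to edges with a fixed
-- number of vertices in V₁ costs a factor 2^(r₀+r₁-1).
--
-- The algorithm must not compare real numbers. It uses, instead of R, the
-- least rational number for which the codegree hypothesis holds.
module Submission where

open import Defs
open import Algebra.Properties.CommutativeSemigroup using (interchange; x∙yz≈y∙xz)
open import Data.Bool.Base using (false)
open import Data.Bool.Properties using (T?)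
open import Data.Empty using (⊥-elim; ⊥-elim-irr)
open import Data.Fin.Base using (Fin; zero; suc)
import Data.Fin.Properties as Fin
open import Data.Fin.Subset using (Subset; inside; outside; _∈_; _∉_; _⊆_; ∁; ∣_∣; ⊥)
open import Data.Fin.Subset.Properties using (_∈?_; _⊆?_; ∉⊥; ∣⊥∣≡0; ∣p∣≤n; ∣∁p∣≡n∸∣p∣; p⊆q⇒∣p∣≤∣q∣; x∉p⇒x∈∁p; x∈∁p⇒x∉p; x∉∁p⇒x∈p)
import Data.Integer.Base as ℤ
import Data.Integer.Properties as ℤ
open import Data.Irrelevant using ([_])
open import Data.List.Base using (List; []; _∷_; _++_; map; filter; length; cartesianProduct; allFin; upTo)
open import Data.List.Extrema.Nat using (v≤max⁺)
open import Data.List.Membership.Propositional using (lose; find) renaming (_∈_ to _∈ˡ_)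
open import Data.List.Membership.Propositional.Properties using (∈-filter⁻; ∈-filter⁺; ∈-map⁺; ∈-map⁻; ∈-++⁺ˡ; ∈-++⁺ʳ; ∈-++⁻; ∈-allFin; ∈-upTo⁺; ∈-upTo⁻; ∈-cartesianProduct⁺; ∈-cartesianProduct⁻; ∈-length)
import Data.List.Properties as List
open import Data.List.Relation.Unary.Any using (Any; here; there; any?) renaming (map to Any-map)
open import Data.Nat.Base
open import Data.Nat.Properties
open import Data.Nat.Tactic.RingSolver using (solve-∀)
open import Data.Product.Base using (Σ-syntax; ∃-syntax; _×_; _,_; proj₁; proj₂)
open import Data.Rational.Base as ℚ using (ℚ; 0ℚ; 1ℚ; toℚᵘ) renaming (_*_ to _*ℚ_)
import Data.Rational.Properties as ℚ
open import Data.Rational.Solver using (module +-*-Solver)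
open import Data.Rational.Unnormalised.Base as ℚᵘ using (mkℚᵘ; *≤*)
import Data.Rational.Unnormalised.Properties as ℚᵘ
open import Data.Refinement.Base using (Refinement-syntax; value) renaming (_,_ to _,ᵣ_)
open import Data.Sum.Base using (_⊎_; inj₁; inj₂; [_,_]′)
open import Data.Vec.Base using ([]; _∷_; here; there; _[_]≔_)
open import Data.Vec.Properties using ([]≔-updates; []≔-minimal)
open import Function.Base using (_∘_; id; it)
open import Relation.Binary.PropositionalEquality using (_≡_; _≢_; refl; sym; trans; cong; cong₂; subst; subst₂; module ≡-Reasoning)
open import Relation.Nullary using (¬_; yes; no; contradiction; Dec)
open import Relation.Nullary.Decidable using (_×-dec_; _⊎-dec_; ¬?; ⌊_⌋; toWitness; fromWitness; recompute; decidable-stable)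
open import Relation.Unary using (Decidable)

-- Counting in lists

-- Edges left over at the end of a stage have low degrees, so there are few of them if few vertices
-- meet them all. In `V₁` all `n₁` vertices serve. In `V₀` the set `I`, of at most `m` vertices, has
-- to serve, and an edge not contained in `Z` is sure to meet `I` only if it has no vertex in `V₁`.
-- Hence the order of the phases; a fixed number of vertices in `V₁` lets all edges leave `V₁` at
-- the same time. If `V₁` yields enough rejected vertices, no vertex of `V₀` is queried and `S₀` is
-- empty, which gives the last part of (iii). The permitted codegree changes by `b/n₁` or `b/m` when
-- a vertex is added, exactly the scale on which the links of a stage live. The factor `m/q` appears
-- with the first vertex of `V₀`, so the second phase controls only sets that meet `V₀`. With
-- `r = r₀ + r₁`, the exponent `(r + 1) * r` in `δ` has to cover the restriction (`r - 1`), the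
-- stages before the last (`k + 2` for `k` from `r` down to `2`), and one more factor 2, so that the
-- rejected vertices meet at most half of the edges. Equality holds for `r = 2` and `r = 3`.

module _ {A : Set} where

  count : {P : A → Set} → Decidable P → List A → ℕ
  count P? xs = length (filter P? xs)

  module _ {P Q : A → Set} (P? : Decidable P) (Q? : Decidable Q) where

    count-mono : ∀ xs → (∀ {x} → x ∈ˡ xs → P x → Q x) → count P? xs ≤ count Q? xs
    count-mono []       _   = z≤n
    count-mono (x ∷ xs) P⇒Q with P? x | Q? x
    ... | yes _  | yes _  = s≤s (count-mono xs (P⇒Q ∘ there))
    ... | yes p  | no ¬q  = contradiction (P⇒Q (here refl) p) ¬q
    ... | no  _  | yes _  = m≤n⇒m≤1+n (count-mono xs (P⇒Q ∘ there))
    ... | no  _  | no _   = count-mono xs (P⇒Q ∘ there)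

    count-mono-< : ∀ {x xs} → (∀ {y} → P y → Q y) → x ∈ˡ xs → ¬ P x → Q x →
                   count P? xs < count Q? xs
    count-mono-< {x} {xs = _ ∷ xs} P⇒Q (here refl) ¬p q with P? x | Q? x
    ... | yes p  | _      = contradiction p ¬p
    ... | no _   | no ¬q  = contradiction q ¬q
    ... | no _   | yes _  = s≤s (count-mono xs (λ _ → P⇒Q))
    count-mono-< {xs = y ∷ xs} P⇒Q (there x∈) ¬p q with P? y | Q? y
    ... | yes _  | yes _  = s≤s (count-mono-< P⇒Q x∈ ¬p q)
    ... | yes p  | no ¬q  = contradiction (P⇒Q p) ¬q
    ... | no  _  | yes _  = m≤n⇒m≤1+n (count-mono-< P⇒Q x∈ ¬p q)
    ... | no  _  | no _   = count-mono-< P⇒Q x∈ ¬p q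

    count-split : ∀ xs → count Q? xs ≡ count Q? (filter P? xs) + count Q? (filter (¬? ∘ P?) xs)
    count-split []       = refl
    count-split (x ∷ xs) with P? x
    ... | yes _ with Q? x
    ...   | yes _ = cong suc (count-split xs)
    ...   | no  _ = count-split xs
    count-split (x ∷ xs) | no _ with Q? x
    ...   | yes _ = trans (cong suc (count-split xs)) (sym (+-suc _ _))
    ...   | no  _ = count-split xs

    count-filter-≤ : ∀ xs → count P? (filter Q? xs) ≤ count P? xs
    count-filter-≤ []       = z≤n
    count-filter-≤ (x ∷ xs) with Q? x
    ... | yes _ with P? x
    ...   | yes _ = s≤s (count-filter-≤ xs)
    ...   | no  _ = count-filter-≤ xs
    count-filter-≤ (x ∷ xs) | no _ with P? x
    ...   | yes _ = m≤n⇒m≤1+n (count-filter-≤ xs)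
    ...   | no  _ = count-filter-≤ xs

  module _ {P : A → Set} (P? : Decidable P) where

    length-split : ∀ xs → length xs ≡ count P? xs + count (¬? ∘ P?) xs
    length-split []       = refl
    length-split (x ∷ xs) with P? x
    ... | yes _ = cong suc (length-split xs)
    ... | no  _ = trans (cong suc (length-split xs)) (sym (+-suc _ _))

    count-all : ∀ xs → (∀ {x} → x ∈ˡ xs → P x) → count P? xs ≡ length xs
    count-all []       _   = refl
    count-all (x ∷ xs) all with P? x
    ... | yes _  = cong suc (count-all xs (all ∘ there))
    ... | no ¬p  = contradiction (all (here refl)) ¬p

    count-none : ∀ xs → (∀ {x} → x ∈ˡ xs → ¬ P x) → count P? xs ≡ 0
    count-none []       _    = refl
    count-none (x ∷ xs) none with P? x
    ... | yes p  = contradiction p (none (here refl))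
    ... | no _   = count-none xs (none ∘ there)

    count-++ : ∀ xs ys → count P? (xs ++ ys) ≡ count P? xs + count P? ys
    count-++ xs ys = trans (cong length (List.filter-++ P? xs ys)) (List.length-++ (filter P? xs))

  count-≗ : ∀ {P Q : A → Set} (P? : Decidable P) (Q? : Decidable Q) →
            (∀ {x} → P x → Q x) → (∀ {x} → Q x → P x) → ∀ xs → count P? xs ≡ count Q? xs
  count-≗ P? Q? P⇒Q Q⇒P xs =
    ≤-antisym (count-mono P? Q? xs (λ _ → P⇒Q)) (count-mono Q? P? xs (λ _ → Q⇒P))

  sum-of : (A → ℕ) → List A → ℕ
  sum-of f []       = 0
  sum-of f (x ∷ xs) = f x + sum-of f xs

  sum-of-mono : ∀ f g xs → (∀ {x} → x ∈ˡ xs → f x ≤ g x) → sum-of f xs ≤ sum-of g xs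
  sum-of-mono f g []       _   = z≤n
  sum-of-mono f g (x ∷ xs) f≤g = +-mono-≤ (f≤g (here refl)) (sum-of-mono f g xs (f≤g ∘ there))

  sum-of-*ˡ : ∀ c f xs → sum-of (λ x → c * f x) xs ≡ c * sum-of f xs
  sum-of-*ˡ c f []       = sym (*-zeroʳ c)
  sum-of-*ˡ c f (x ∷ xs) = trans (cong (c * f x +_) (sum-of-*ˡ c f xs)) (sym (*-distribˡ-+ c (f x) _))

  sum-of-const : ∀ c xs → sum-of (λ _ → c) xs ≡ length xs * c
  sum-of-const c []       = refl
  sum-of-const c (x ∷ xs) = cong (c +_) (sum-of-const c xs)

  sum-of-+ : ∀ f g xs → sum-of (λ x → f x + g x) xs ≡ sum-of f xs + sum-of g xs
  sum-of-+ f g []       = refl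
  sum-of-+ f g (x ∷ xs) = trans (cong (f x + g x +_) (sum-of-+ f g xs)) (interchange +-commutativeSemigroup (f x) (g x) _ _)

  sum-of-1 : ∀ xs → sum-of (λ _ → 1) xs ≡ length xs
  sum-of-1 xs = trans (sum-of-const 1 xs) (*-identityʳ _)

count-map : ∀ {A B : Set} {P : A → Set} (P? : Decidable P) (f : B → A) xs →
            count P? (map f xs) ≡ count (P? ∘ f) xs
count-map P? f []       = refl
count-map P? f (x ∷ xs) with P? (f x)
... | yes _ = cong suc (count-map P? f xs)
... | no  _ = count-map P? f xs

module _ {A B : Set} {_~_ : A → B → Set} (_~?_ : ∀ a b → Dec (a ~ b)) where

  count-cons : ∀ b bs a → count (a ~?_) (b ∷ bs) ≡ count (_~? b) (a ∷ []) + count (a ~?_) bs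
  count-cons b bs a with a ~? b
  ... | yes _ = refl
  ... | no  _ = refl

  count-singletons : ∀ b as → sum-of (λ a → count (_~? b) (a ∷ [])) as ≡ count (_~? b) as
  count-singletons b []       = refl
  count-singletons b (a ∷ as) with a ~? b
  ... | yes _ = cong suc (count-singletons b as)
  ... | no  _ = count-singletons b as

  double-count : ∀ as bs → sum-of (λ a → count (a ~?_) bs) as ≡ sum-of (λ b → count (_~? b) as) bs
  double-count as []       = trans (sum-of-const 0 as) (*-zeroʳ (length as))
  double-count as (b ∷ bs) = begin
    sum-of (λ a → count (a ~?_) (b ∷ bs)) as
      ≡⟨ ≤-antisym (sum-of-mono _ _ as (λ {a} _ → ≤-reflexive (count-cons b bs a)))
                   (sum-of-mono _ _ as (λ {a} _ → ≤-reflexive (sym (count-cons b bs a)))) ⟩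
    sum-of (λ a → count (_~? b) (a ∷ []) + count (a ~?_) bs) as
      ≡⟨ sum-of-+ _ _ as ⟩
    sum-of (λ a → count (_~? b) (a ∷ [])) as + sum-of (λ a → count (a ~?_) bs) as
      ≡⟨ cong₂ _+_ (count-singletons b as) (double-count as bs) ⟩
    count (_~? b) as + sum-of (λ b → count (_~? b) as) bs ∎
    where open ≡-Reasoning

  union-bound : ∀ as bs → count (λ b → any? (_~? b) as) bs ≤ sum-of (λ a → count (a ~?_) bs) as
  union-bound as bs = ≤-trans (go bs) (≤-reflexive (sym (double-count as bs)))
    where
    hit-pos : ∀ b as → Any (_~ b) as → 1 ≤ count (_~? b) as
    hit-pos b (a ∷ as) h with a ~? b
    ... | yes _ = s≤s z≤n
    hit-pos b (a ∷ as) (here p)  | no ¬p = contradiction p ¬p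
    hit-pos b (a ∷ as) (there h) | no _  = hit-pos b as h
    go : ∀ bs → count (λ b → any? (_~? b) as) bs ≤ sum-of (λ b → count (_~? b) as) bs
    go []       = z≤n
    go (b ∷ bs) with any? (_~? b) as
    ... | yes h = +-mono-≤ (hit-pos b as h) (go bs)
    ... | no _  = m≤n⇒m≤o+n _ (go bs)

-- Vertices and pairs

module _ {n : ℕ} where

  ∈-insert⁺ : ∀ {p : Subset n} {x} y → x ∈ p → x ∈ p [ y ]≔ inside
  ∈-insert⁺ {p} {x} y x∈p with x Fin.≟ y
  ... | yes refl = []≔-updates p x
  ... | no  x≢y  = []≔-minimal p x y x≢y x∈p

∈-update⁻ : ∀ {n} {p : Subset n} {x} y {s} → x ∈ p [ y ]≔ s → x ≢ y → x ∈ p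
∈-update⁻ {p = _ ∷ _} zero    here       x≢y = contradiction refl x≢y
∈-update⁻ {p = _ ∷ _} zero    (there x∈) x≢y = there x∈
∈-update⁻ {p = _ ∷ _} (suc y) here       x≢y = here
∈-update⁻ {p = _ ∷ _} (suc y) (there x∈) x≢y = there (∈-update⁻ y x∈ (x≢y ∘ cong suc))

∉-delete : ∀ {n} (p : Subset n) x → x ∉ p [ x ]≔ outside
∉-delete (_ ∷ p) zero    ()
∉-delete (_ ∷ p) (suc x) (there x∈) = ∉-delete p x x∈

∣delete∣ : ∀ {n} {p : Subset n} {x} → x ∈ p → suc ∣ p [ x ]≔ outside ∣ ≡ ∣ p ∣
∣delete∣                    here       = refl
∣delete∣ {p = inside  ∷ _} (there x∈) = cong suc (∣delete∣ x∈)
∣delete∣ {p = outside ∷ _} (there x∈) = ∣delete∣ x∈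

∣insert∣ : ∀ {n} (p : Subset n) x → x ∉ p → ∣ p [ x ]≔ inside ∣ ≡ suc ∣ p ∣
∣insert∣ (inside  ∷ p) zero    x∉ = contradiction here x∉
∣insert∣ (outside ∷ p) zero    x∉ = refl
∣insert∣ (inside  ∷ p) (suc x) x∉ = cong suc (∣insert∣ p x (x∉ ∘ there))
∣insert∣ (outside ∷ p) (suc x) x∉ = ∣insert∣ p x (x∉ ∘ there)

∣insert∣≤ : ∀ {n} (p : Subset n) x → ∣ p [ x ]≔ inside ∣ ≤ suc ∣ p ∣
∣insert∣≤ (inside  ∷ p) zero    = n≤1+n _
∣insert∣≤ (outside ∷ p) zero    = ≤-refl
∣insert∣≤ (inside  ∷ p) (suc x) = s≤s (∣insert∣≤ p x)
∣insert∣≤ (outside ∷ p) (suc x) = ∣insert∣≤ p x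

elements : ∀ {n} → Subset n → List (Fin n)
elements []            = []
elements (inside  ∷ p) = zero ∷ map suc (elements p)
elements (outside ∷ p) = map suc (elements p)

length-elements : ∀ {n} (p : Subset n) → length (elements p) ≡ ∣ p ∣
length-elements []            = refl
length-elements (inside  ∷ p) = cong suc (trans (List.length-map suc (elements p)) (length-elements p))
length-elements (outside ∷ p) = trans (List.length-map suc (elements p)) (length-elements p)

∈-elements : ∀ {n} {p : Subset n} {x} → x ∈ p → x ∈ˡ elements p
∈-elements here = here refl
∈-elements {p = inside  ∷ _} (there x∈) = there (∈-map⁺ suc (∈-elements x∈))
∈-elements {p = outside ∷ _} (there x∈) = ∈-map⁺ suc (∈-elements x∈)

∣p∣>0⇒∃ : ∀ {n} (p : Subset n) → 0 < ∣ p ∣ → ∃[ x ] x ∈ p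
∣p∣>0⇒∃ (inside  ∷ p) _  = zero , here
∣p∣>0⇒∃ (outside ∷ p) 0< with x , x∈ ← ∣p∣>0⇒∃ p 0< = suc x , there x∈

∣p∣≡0⇒∉ : ∀ {n} {p : Subset n} {x} → ∣ p ∣ ≡ 0 → x ∉ p
∣p∣≡0⇒∉ {p = outside ∷ _} eq (there x∈) = ∣p∣≡0⇒∉ eq x∈
∣p∣≡0⇒∉ {p = inside ∷ _}  () (there x∈)

allSubsets-complete : ∀ {n} (p : Subset n) → p ∈ˡ allSubsets n
allSubsets-complete []            = here refl
allSubsets-complete (outside ∷ p) = ∈-++⁺ˡ (∈-map⁺ _ (allSubsets-complete p))
allSubsets-complete {suc n} (inside ∷ p) =
  ∈-++⁺ʳ (map (outside ∷_) (allSubsets n)) (∈-map⁺ _ (allSubsets-complete p))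

allPairs-complete : ∀ {n₀ n₁} (e : Pair n₀ n₁) → e ∈ˡ allPairs n₀ n₁
allPairs-complete (e₀ , e₁) = ∈-cartesianProduct⁺ (allSubsets-complete e₀) (allSubsets-complete e₁)

count-⊆ : ∀ {n} (p : Subset n) → count (_⊆? p) (allSubsets n) ≡ 2 ^ ∣ p ∣
count-⊆ {zero}  []      = refl
count-⊆ {suc n} (s ∷ p) = begin
  count (_⊆? s ∷ p) (map (outside ∷_) (allSubsets n) ++ map (inside ∷_) (allSubsets n))
    ≡⟨ count-++ (_⊆? s ∷ p) (map (outside ∷_) (allSubsets n)) _ ⟩
  count (_⊆? s ∷ p) (map (outside ∷_) (allSubsets n)) + count (_⊆? s ∷ p) (map (inside ∷_) (allSubsets n))
    ≡⟨ cong₂ _+_ (count-map (_⊆? s ∷ p) (outside ∷_) (allSubsets n)) (count-map (_⊆? s ∷ p) (inside ∷_) (allSubsets n)) ⟩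
  count (λ q → outside ∷ q ⊆? s ∷ p) (allSubsets n) + count (λ q → inside ∷ q ⊆? s ∷ p) (allSubsets n)
    ≡⟨ cong (_+ count (λ q → inside ∷ q ⊆? s ∷ p) (allSubsets n)) (trans (count-≗ (λ q → outside ∷ q ⊆? s ∷ p) (_⊆? p) out⇒ out⇐ (allSubsets n)) (count-⊆ p)) ⟩
  2 ^ ∣ p ∣ + count (λ q → inside ∷ q ⊆? s ∷ p) (allSubsets n)
    ≡⟨ ins s ⟩
  2 ^ ∣ s ∷ p ∣ ∎
  where
  open ≡-Reasoning
  out⇒ : ∀ {t} {q : Subset n} → t ∷ q ⊆ s ∷ p → q ⊆ p
  out⇒ h x∈ with there y ← h (there x∈) = y
  out⇐ : ∀ {q : Subset n} → q ⊆ p → outside ∷ q ⊆ s ∷ p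
  out⇐ h (there x∈) = there (h x∈)
  ins : ∀ s → 2 ^ ∣ p ∣ + count (λ q → inside ∷ q ⊆? s ∷ p) (allSubsets n) ≡ 2 ^ ∣ s ∷ p ∣
  ins outside = trans (cong (2 ^ ∣ p ∣ +_) (count-none (λ q → inside ∷ q ⊆? outside ∷ p) (allSubsets n)
                  (λ _ h → case-∉ (h here)))) (+-identityʳ _)
    where
    case-∉ : zero ∉ outside ∷ p
    case-∉ ()
  ins inside = cong (2 ^ ∣ p ∣ +_) (trans
    (trans (count-≗ (λ q → inside ∷ q ⊆? inside ∷ p) (_⊆? p)
      (λ h x∈ → tl (h (there x∈))) (λ { h here → here ; h (there x∈) → there (h x∈) }) (allSubsets n)) (count-⊆ p))
    (sym (+-identityʳ _)))
    where
    tl : ∀ {t x} → suc x ∈ t ∷ p → x ∈ p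
    tl (there x∈) = x∈

module _ {n₀ n₁ : ℕ} where

  Vertex : Set
  Vertex = Fin n₀ ⊎ Fin n₁

  infix 4 _∈ᵥ_ _∉ᵥ_ _∈ᵥ?_ _⊑_ _⊑?_

  _∈ᵥ_ _∉ᵥ_ : Vertex → Pair n₀ n₁ → Set
  inj₁ u ∈ᵥ (e₀ , _) = u ∈ e₀
  inj₂ u ∈ᵥ (_ , e₁) = u ∈ e₁
  v ∉ᵥ e = ¬ (v ∈ᵥ e)

  _∈ᵥ?_ : ∀ v e → Dec (v ∈ᵥ e)
  inj₁ u ∈ᵥ? (e₀ , _) = u ∈? e₀
  inj₂ u ∈ᵥ? (_ , e₁) = u ∈? e₁

  _⊑_ : Pair n₀ n₁ → Pair n₀ n₁ → Set
  L ⊑ e = proj₁ L ⊆ proj₁ e × proj₂ L ⊆ proj₂ e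

  _⊑?_ : ∀ L e → Dec (L ⊑ e)
  L ⊑? e = (proj₁ L ⊆? proj₁ e) ×-dec (proj₂ L ⊆? proj₂ e)

  ⊑⇒ : ∀ {L e} → L ⊑ e → ∀ v → v ∈ᵥ L → v ∈ᵥ e
  ⊑⇒ (h₀ , _) (inj₁ u) = h₀
  ⊑⇒ (_ , h₁) (inj₂ u) = h₁

  ⇒⊑ : ∀ {L e} → (∀ v → v ∈ᵥ L → v ∈ᵥ e) → L ⊑ e
  ⇒⊑ h = (λ {u} → h (inj₁ u)) , (λ {u} → h (inj₂ u))

  ∅ : Pair n₀ n₁
  ∅ = ⊥ , ⊥

  size : Pair n₀ n₁ → ℕ
  size (e₀ , e₁) = ∣ e₀ ∣ + ∣ e₁ ∣

  insert delete : Vertex → Pair n₀ n₁ → Pair n₀ n₁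
  insert (inj₁ u) (e₀ , e₁) = e₀ [ u ]≔ inside , e₁
  insert (inj₂ u) (e₀ , e₁) = e₀ , e₁ [ u ]≔ inside
  delete (inj₁ u) (e₀ , e₁) = e₀ [ u ]≔ outside , e₁
  delete (inj₂ u) (e₀ , e₁) = e₀ , e₁ [ u ]≔ outside

  -- Turns codegrees in a link into codegrees of a pair that is larger by one vertex, for which a
  -- bound is already known.
  ⊑-delete : ∀ v {L e} → v ∈ᵥ e → L ⊑ delete v e → v ∉ᵥ L × insert v L ⊑ e
  ⊑-delete (inj₁ u) {L₀ , _} {e₀ , _} v∈e (h₀ , h₁) = ∉-delete e₀ u ∘ h₀ , ins , h₁
    where
    ins : L₀ [ u ]≔ inside ⊆ e₀
    ins {x} x∈ with x Fin.≟ u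
    ... | yes refl = v∈e
    ... | no x≢u   = ∈-update⁻ u (h₀ (∈-update⁻ u x∈ x≢u)) x≢u
  ⊑-delete (inj₂ u) {_ , L₁} {_ , e₁} v∈e (h₀ , h₁) = ∉-delete e₁ u ∘ h₁ , h₀ , ins
    where
    ins : L₁ [ u ]≔ inside ⊆ e₁
    ins {x} x∈ with x Fin.≟ u
    ... | yes refl = v∈e
    ... | no x≢u   = ∈-update⁻ u (h₁ (∈-update⁻ u x∈ x≢u)) x≢u

  -- Carries independence from one stage to the next: links are taken only at vertices of `Z`, so a
  -- link inside `Z` would come from an edge inside `Z`.
  delete-⊑ : ∀ v {e Z} → v ∈ᵥ Z → delete v e ⊑ Z → e ⊑ Z
  delete-⊑ (inj₁ u) {e₀ , _} {Z₀ , _} v∈Z (h₀ , h₁) = h , h₁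
    where
    h : e₀ ⊆ Z₀
    h {x} x∈ with x Fin.≟ u
    ... | yes refl = v∈Z
    ... | no x≢u   = h₀ ([]≔-minimal e₀ x u x≢u x∈)
  delete-⊑ (inj₂ u) {_ , e₁} {_ , Z₁} v∈Z (h₀ , h₁) = h₀ , h
    where
    h : e₁ ⊆ Z₁
    h {x} x∈ with x Fin.≟ u
    ... | yes refl = v∈Z
    ... | no x≢u   = h₁ ([]≔-minimal e₁ x u x≢u x∈)

  size-delete : ∀ v {e} → v ∈ᵥ e → suc (size (delete v e)) ≡ size e
  size-delete (inj₁ u) v∈e = cong (_+ _) (∣delete∣ v∈e)
  size-delete (inj₂ u) {e₀ , _} v∈e = trans (sym (+-suc ∣ e₀ ∣ _)) (cong (∣ e₀ ∣ +_) (∣delete∣ v∈e))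

  insert-∅-⊑ : ∀ v {e} → v ∈ᵥ e → insert v ∅ ⊑ e
  insert-∅-⊑ (inj₁ u) {e₀ , _} v∈e = h , ⊥-elim ∘ ∉⊥
    where
    h : ⊥ [ u ]≔ inside ⊆ e₀
    h {x} x∈ with x Fin.≟ u
    ... | yes refl = v∈e
    ... | no x≢u   = ⊥-elim (∉⊥ (∈-update⁻ u x∈ x≢u))
  insert-∅-⊑ (inj₂ u) {_ , e₁} v∈e = ⊥-elim ∘ ∉⊥ , h
    where
    h : ⊥ [ u ]≔ inside ⊆ e₁
    h {x} x∈ with x Fin.≟ u
    ... | yes refl = v∈e
    ... | no x≢u   = ⊥-elim (∉⊥ (∈-update⁻ u x∈ x≢u))

  count-cartesianProduct : ∀ {P : Subset n₀ → Set} {Q : Subset n₁ → Set}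
    (P? : Decidable P) (Q? : Decidable Q) xs ys →
    count (λ (e : Pair n₀ n₁) → P? (proj₁ e) ×-dec Q? (proj₂ e)) (cartesianProduct xs ys) ≡ count P? xs * count Q? ys
  count-cartesianProduct P? Q? []       ys = refl
  count-cartesianProduct {P} {Q} P? Q? (x ∷ xs) ys = begin
    count R? (map (x ,_) ys ++ cartesianProduct xs ys)
      ≡⟨ count-++ R? (map (x ,_) ys) _ ⟩
    count R? (map (x ,_) ys) + count R? (cartesianProduct xs ys)
      ≡⟨ cong₂ _+_ (count-map R? (x ,_) ys) (count-cartesianProduct P? Q? xs ys) ⟩
    count (λ y → P? x ×-dec Q? y) ys + count P? xs * count Q? ys
      ≡⟨ row ⟩
    count P? (x ∷ xs) * count Q? ys ∎
    where
    open ≡-Reasoning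
    R? : (e : Pair n₀ n₁) → Dec (P (proj₁ e) × Q (proj₂ e))
    R? e = P? (proj₁ e) ×-dec Q? (proj₂ e)
    row : count (λ y → P? x ×-dec Q? y) ys + count P? xs * count Q? ys ≡ count P? (x ∷ xs) * count Q? ys
    row with P? x
    ... | yes p = cong (_+ count P? xs * count Q? ys) (count-≗ (λ y → yes p ×-dec Q? y) Q? proj₂ (p ,_) ys)
    ... | no ¬p = cong (_+ count P? xs * count Q? ys) (count-none (λ y → no ¬p ×-dec Q? y) ys (λ _ → ¬p ∘ proj₁))

  count-⊑ : ∀ e → count (_⊑? e) (allPairs n₀ n₁) ≡ 2 ^ size e
  count-⊑ (e₀ , e₁) = begin
    count (_⊑? (e₀ , e₁)) (allPairs n₀ n₁)
      ≡⟨ count-cartesianProduct (_⊆? e₀) (_⊆? e₁) (allSubsets n₀) (allSubsets n₁) ⟩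
    count (_⊆? e₀) (allSubsets n₀) * count (_⊆? e₁) (allSubsets n₁)
      ≡⟨ cong₂ _*_ (count-⊆ e₀) (count-⊆ e₁) ⟩
    2 ^ ∣ e₀ ∣ * 2 ^ ∣ e₁ ∣
      ≡⟨ sym (^-distribˡ-+-* 2 ∣ e₀ ∣ ∣ e₁ ∣) ⟩
    2 ^ size (e₀ , e₁) ∎
    where open ≡-Reasoning

-- Query trees

module _ {n₀ n₁ : ℕ} where

  private
    V = Vertex {n₀} {n₁}
    E′ = Pair n₀ n₁

  infixl 1 _>>=_

  -- The next query depends on earlier answers only, so whatever answers alike along one path
  -- replays the whole run.
  data Tree (X : Set) : Set where
    leaf : X → Tree X
    ask  : V → (yes no : Tree X) → Tree X

  _>>=_ : ∀ {X Y} → Tree X → (X → Tree Y) → Tree Y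
  leaf x    >>= f = f x
  ask v l r >>= f = ask v (l >>= f) (r >>= f)

  module _ {X : Set} where

    result : Tree X → E′ → X
    result (leaf x)    Z = x
    result (ask v l r) Z with v ∈ᵥ? Z
    ... | yes _ = result l Z
    ... | no  _ = result r Z

    accepted rejected : Tree X → E′ → List V
    accepted (leaf x)    Z = []
    accepted (ask v l r) Z with v ∈ᵥ? Z
    ... | yes _ = v ∷ accepted l Z
    ... | no  _ = accepted r Z
    rejected (leaf x)    Z = []
    rejected (ask v l r) Z with v ∈ᵥ? Z
    ... | yes _ = rejected l Z
    ... | no  _ = v ∷ rejected r Z

    accepted-∈ : ∀ t Z {v} → v ∈ˡ accepted t Z → v ∈ᵥ Z
    accepted-∈ (ask v l r) Z v∈ with v ∈ᵥ? Z
    accepted-∈ (ask v l r) Z (here refl) | yes p = p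
    accepted-∈ (ask v l r) Z (there v∈)  | yes _ = accepted-∈ l Z v∈
    accepted-∈ (ask v l r) Z v∈          | no  _ = accepted-∈ r Z v∈

    rejected-∉ : ∀ t Z {v} → v ∈ˡ rejected t Z → v ∉ᵥ Z
    rejected-∉ (ask v l r) Z v∈ with v ∈ᵥ? Z
    rejected-∉ (ask v l r) Z v∈          | yes _ = rejected-∉ l Z v∈
    rejected-∉ (ask v l r) Z (here refl) | no ¬p = ¬p
    rejected-∉ (ask v l r) Z (there v∈)  | no _  = rejected-∉ r Z v∈

    rejected-cong : ∀ t Z Z′ → (∀ {v} → v ∈ˡ accepted t Z → v ∈ᵥ Z′) →
                    (∀ {v} → v ∈ˡ rejected t Z → v ∉ᵥ Z′) → rejected t Z′ ≡ rejected t Z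
    rejected-cong (leaf _)    Z Z′ acc rej = refl
    rejected-cong (ask v l r) Z Z′ acc rej with v ∈ᵥ? Z | v ∈ᵥ? Z′
    ... | yes _ | yes _ = rejected-cong l Z Z′ (acc ∘ there) rej
    ... | yes _ | no ¬p = contradiction (acc (here refl)) ¬p
    ... | no  _ | yes p = contradiction p (rej (here refl))
    ... | no  _ | no  _ = cong (v ∷_) (rejected-cong r Z Z′ acc (rej ∘ there))

    -- Whether the second phase takes place depends on the vertices rejected in the first, so they
    -- have to be part of the result.
    withRejected : Tree X → Tree (List V × X)
    withRejected (leaf x)    = leaf ([] , x)
    withRejected (ask v l r) =
      ask v (withRejected l) (withRejected r >>= λ (vs , x) → leaf (v ∷ vs , x))

  module _ {X Y : Set} (f : X → Tree Y) where

    result->>= : ∀ t Z → result (t >>= f) Z ≡ result (f (result t Z)) Z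
    result->>= (leaf x)    Z = refl
    result->>= (ask v l r) Z with v ∈ᵥ? Z
    ... | yes _ = result->>= l Z
    ... | no  _ = result->>= r Z

    accepted->>= : ∀ t Z → accepted (t >>= f) Z ≡ accepted t Z ++ accepted (f (result t Z)) Z
    accepted->>= (leaf x)    Z = refl
    accepted->>= (ask v l r) Z with v ∈ᵥ? Z
    ... | yes _ = cong (v ∷_) (accepted->>= l Z)
    ... | no  _ = accepted->>= r Z

    rejected->>= : ∀ t Z → rejected (t >>= f) Z ≡ rejected t Z ++ rejected (f (result t Z)) Z
    rejected->>= (leaf x)    Z = refl
    rejected->>= (ask v l r) Z with v ∈ᵥ? Z
    ... | yes _ = rejected->>= l Z
    ... | no  _ = cong (v ∷_) (rejected->>= r Z)

  module _ {X : Set} where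

    result-withRejected : ∀ (t : Tree X) Z → result (withRejected t) Z ≡ (rejected t Z , result t Z)
    result-withRejected (leaf x)    Z = refl
    result-withRejected (ask v l r) Z with v ∈ᵥ? Z
    ... | yes _ = result-withRejected l Z
    ... | no  _ = trans (result->>= _ (withRejected r) Z)
                        (cong (λ (vs , x) → v ∷ vs , x) (result-withRejected r Z))

    accepted-withRejected : ∀ (t : Tree X) Z → accepted (withRejected t) Z ≡ accepted t Z
    accepted-withRejected (leaf x)    Z = refl
    accepted-withRejected (ask v l r) Z with v ∈ᵥ? Z
    ... | yes _ = cong (v ∷_) (accepted-withRejected l Z)
    ... | no  _ = trans (accepted->>= _ (withRejected r) Z)
                    (trans (List.++-identityʳ _) (accepted-withRejected r Z))

    rejected-withRejected : ∀ (t : Tree X) Z → rejected (withRejected t) Z ≡ rejected t Z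
    rejected-withRejected (leaf x)    Z = refl
    rejected-withRejected (ask v l r) Z with v ∈ᵥ? Z
    ... | yes _ = rejected-withRejected l Z
    ... | no  _ = cong (v ∷_) (trans (rejected->>= _ (withRejected r) Z)
                    (trans (List.++-identityʳ _) (rejected-withRejected r Z)))

  -- Fingerprints

  collect : List V → E′
  collect []       = ∅
  collect (v ∷ vs) = insert v (collect vs)

  ∈-insert-self : ∀ (v : V) {e} → v ∈ᵥ insert v e
  ∈-insert-self (inj₁ u) {e₀ , _} = []≔-updates e₀ u
  ∈-insert-self (inj₂ u) {_ , e₁} = []≔-updates e₁ u

  ∈-insert-other : ∀ (v : V) {w e} → w ∈ᵥ e → w ∈ᵥ insert v e
  ∈-insert-other (inj₁ u) {inj₁ _} w∈ = ∈-insert⁺ u w∈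
  ∈-insert-other (inj₁ u) {inj₂ _} w∈ = w∈
  ∈-insert-other (inj₂ u) {inj₁ _} w∈ = w∈
  ∈-insert-other (inj₂ u) {inj₂ _} w∈ = ∈-insert⁺ u w∈

  ∈-insert⁻ : ∀ (v : V) {w e} → w ∈ᵥ insert v e → w ≡ v ⊎ w ∈ᵥ e
  ∈-insert⁻ (inj₁ u) {inj₁ x} w∈ with x Fin.≟ u
  ... | yes refl = inj₁ refl
  ... | no x≢u   = inj₂ (∈-update⁻ u w∈ x≢u)
  ∈-insert⁻ (inj₁ u) {inj₂ _} w∈ = inj₂ w∈
  ∈-insert⁻ (inj₂ u) {inj₁ _} w∈ = inj₂ w∈
  ∈-insert⁻ (inj₂ u) {inj₂ x} w∈ with x Fin.≟ u
  ... | yes refl = inj₁ refl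
  ... | no x≢u   = inj₂ (∈-update⁻ u w∈ x≢u)

  ∉∅ : ∀ (v : V) → v ∉ᵥ ∅
  ∉∅ (inj₁ _) = ∉⊥
  ∉∅ (inj₂ _) = ∉⊥

  ∈-collect⁺ : ∀ {v : V} {vs : List V} → v ∈ˡ vs → v ∈ᵥ collect vs
  ∈-collect⁺ {v} {_ ∷ vs} (here refl) = ∈-insert-self v {collect vs}
  ∈-collect⁺ {v} {w ∷ vs} (there v∈)  = ∈-insert-other w {v} {collect vs} (∈-collect⁺ v∈)

  ∈-collect⁻ : ∀ (v : V) (vs : List V) → v ∈ᵥ collect vs → v ∈ˡ vs
  ∈-collect⁻ v []       v∈ = contradiction v∈ (∉∅ v)
  ∈-collect⁻ v (w ∷ vs) v∈ with ∈-insert⁻ w {v} {collect vs} v∈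
  ... | inj₁ refl = here refl
  ... | inj₂ v∈′  = there (∈-collect⁻ v vs v∈′)

  fingerprint : ∀ {X} → Tree X → E′ → E′
  fingerprint t Z = collect (accepted t Z)

  fingerprint-⊑ : ∀ {X} (t : Tree X) Z → fingerprint t Z ⊑ Z
  fingerprint-⊑ t Z = ⇒⊑ (λ v → accepted-∈ t Z ∘ ∈-collect⁻ v (accepted t Z))

  -- A fingerprint answers every query along the path of Z in the way Z does.
  rejected-fingerprint : ∀ {X} (t : Tree X) Z → rejected t (fingerprint t Z) ≡ rejected t Z
  rejected-fingerprint t Z = rejected-cong t Z (fingerprint t Z) ∈-collect⁺
    (λ {v} v∈ v∈S → rejected-∉ t Z v∈ (⊑⇒ (fingerprint-⊑ t Z) v v∈S))

  -- Degrees and a single stage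

  degree : V → List E′ → ℕ
  degree v = count (v ∈ᵥ?_)

  codeg : E′ → List E′ → ℕ
  codeg L = count (L ⊑?_)

  hit? : ∀ (vs : List V) d → Dec (Any (_∈ᵥ d) vs)
  hit? vs d = any? (_∈ᵥ? d) vs

  pick : (f : V → ℕ) (vs : List V) → (∀ {v} → v ∈ˡ vs → f v ≡ 0)
         ⊎ (∃[ u ] u ∈ˡ vs × 0 < f u × (∀ {v} → v ∈ˡ vs → f v ≤ f u))
  pick f []       = inj₁ λ ()
  pick f (w ∷ vs) with pick f vs
  pick f (w ∷ vs) | inj₁ all0 with f w in eq
  ... | zero  = inj₁ λ { (here refl) → eq ; (there v∈) → all0 v∈ }
  ... | suc d = inj₂ (w , here refl , subst (0 <_) (sym eq) z<s ,
                  λ { (here refl) → ≤-refl ; (there v∈) → ≤-trans (≤-reflexive (all0 v∈)) z≤n })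
  pick f (w ∷ vs) | inj₂ (u , u∈ , 0<fu , max) with ≤-total (f w) (f u)
  ... | inj₁ w≤u = inj₂ (u , there u∈ , 0<fu , λ { (here refl) → w≤u ; (there v∈) → max v∈ })
  ... | inj₂ u≤w = inj₂ (w , here refl , <-≤-trans 0<fu u≤w ,
                     λ { (here refl) → ≤-refl ; (there v∈) → ≤-trans (max v∈) u≤w })

  module Stage (cands : List V) {adm : E′ → Set} (adm? : ∀ L → Dec (adm L))
               (x y : E′ → ℕ) (N b e : ℕ) where

    -- In fractions: `codeg L F` is at least `(b / N) * (x L / y L) * e`. Here `(x L / y L) * e` is
    -- the bound on codegrees in the original hypergraph, and inserting a candidate into `L` changes
    -- `x / y` by `b / N`; so the threshold is the bound on what a single link can add to
    -- `codeg L F`.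
    Saturated : List E′ → E′ → Set
    Saturated F L = adm L × b * x L * e ≤ codeg L F * (N * y L)

    saturated? : ∀ F L → Dec (Saturated F L)
    saturated? F L = adm? L ×-dec (b * x L * e ≤? codeg L F * (N * y L))

    saturated⊑? : ∀ F L d → Dec (Saturated F L × L ⊑ d)
    saturated⊑? F L d = saturated? F L ×-dec (L ⊑? d)

    Bad : List E′ → E′ → Set
    Bad F d = Any (λ L → Saturated F L × L ⊑ d) (allPairs n₀ n₁)

    bad? : ∀ F d → Dec (Bad F d)
    bad? F d = any? (λ L → saturated⊑? F L d) (allPairs n₀ n₁)

    prune : List E′ → List E′ → List E′
    prune F G = filter (¬? ∘ bad? F) G

    remove link : V → List E′ → List E′
    remove u G = filter (¬? ∘ (u ∈ᵥ?_)) G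
    link   u G = map (delete u) (filter (u ∈ᵥ?_) G)

    -- `F` collects the links, and pruning is repeated before each query because `F` may have grown.
    -- The fuel `length G` suffices: a query goes to a vertex of positive degree, and the edges at
    -- that vertex leave `G` whatever the answer. The budget counts accepted vertices only.
    loop : (fuel budget : ℕ) (G F : List E′) → Tree (List E′)
    loop zero    β       G F = leaf F
    loop (suc f) zero    G F = leaf F
    loop (suc f) (suc β) G F with pick (λ v → degree v (prune F G)) cands
    ... | inj₁ _       = leaf F
    ... | inj₂ (u , _) = ask u
      (loop f β (remove u (prune F G)) (link u (prune F G) ++ F))
      (loop f (suc β) (remove u (prune F G)) F)

    -- The path of `Z` through `loop` with the fuel removed, so that each estimate is an induction
    -- on the path. The product in `stop` covers both ways to end, a spent budget and vanishing
    -- degrees.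
    data Run (Z : E′) : ℕ → (G F : List E′) → List V → (G′ F′ : List E′) → Set where
      stop : ∀ {β G F} → (∀ {v} → v ∈ˡ cands → β * degree v (prune F G) ≡ 0) →
             Run Z β G F [] (prune F G) F
      take : ∀ {β G F u vs G′ F′} → u ∈ˡ cands → u ∈ᵥ Z →
             (∀ {v} → v ∈ˡ cands → degree v (prune F G) ≤ degree u (prune F G)) →
             Run Z β (remove u (prune F G)) (link u (prune F G) ++ F) vs G′ F′ →
             Run Z (suc β) G F vs G′ F′
      skip : ∀ {β G F u vs G′ F′} → u ∈ˡ cands →
             Run Z β (remove u (prune F G)) F vs G′ F′ →
             Run Z β G F (u ∷ vs) G′ F′

    length-remove : ∀ u G → length G ≡ degree u G + length (remove u G)
    length-remove u G = length-split (u ∈ᵥ?_) G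

    private
      fuel-enough : ∀ {f u F G} → length G ≤ suc f → 0 < degree u (prune F G) →
                    length (remove u (prune F G)) ≤ f
      fuel-enough {f} {u} {F} {G} G≤ 0<d = s≤s⁻¹ (begin
        suc (length (remove u (prune F G)))                      ≤⟨ +-monoˡ-≤ _ 0<d ⟩
        degree u (prune F G) + length (remove u (prune F G))     ≡⟨ sym (length-remove u (prune F G)) ⟩
        length (prune F G)                                       ≤⟨ List.length-filter (¬? ∘ bad? F) G ⟩
        length G                                                 ≤⟨ G≤ ⟩
        suc f                                                    ∎)
        where open ≤-Reasoning

    loop-run : ∀ Z f β G F → length G ≤ f →
      ∃[ G′ ] Run Z β G F (rejected (loop f β G F) Z) G′ (result (loop f β G F) Z)
    loop-run Z zero    β       [] F _ = _ , stop (λ _ → *-zeroʳ β)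
    loop-run Z (suc f) zero    G  F _ = _ , stop (λ _ → refl)
    loop-run Z (suc f) (suc β) G  F G≤ with pick (λ v → degree v (prune F G)) cands
    ... | inj₁ all0 = _ , stop (λ v∈ → trans (cong (suc β *_) (all0 v∈)) (*-zeroʳ (suc β)))
    ... | inj₂ (u , u∈ , 0<d , max) with u ∈ᵥ? Z
    ...   | yes u∈Z = let (G′ , r) = loop-run Z f β _ _ (fuel-enough {u = u} {F} {G} G≤ 0<d) in
                      G′ , take u∈ u∈Z max r
    ...   | no  _   = let (G′ , r) = loop-run Z f (suc β) _ _ (fuel-enough {u = u} {F} {G} G≤ 0<d) in
                      G′ , skip u∈ r

    loop-accepted : ∀ Z f β G F → length (accepted (loop f β G F) Z) ≤ β
    loop-accepted Z zero    β       G F = z≤n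
    loop-accepted Z (suc f) zero    G F = z≤n
    loop-accepted Z (suc f) (suc β) G F with pick (λ v → degree v (prune F G)) cands
    ... | inj₁ _ = z≤n
    ... | inj₂ (u , _) with u ∈ᵥ? Z
    ...   | yes _ = s≤s (loop-accepted Z f β _ _)
    ...   | no  _ = loop-accepted Z f (suc β) _ _

    loop-accepted-∈ : ∀ Z f β G F {v} → v ∈ˡ accepted (loop f β G F) Z → v ∈ˡ cands
    loop-accepted-∈ Z (suc f) (suc β) G F v∈ with pick (λ v → degree v (prune F G)) cands
    ... | inj₂ (u , u∈ , _) with u ∈ᵥ? Z
    loop-accepted-∈ Z (suc f) (suc β) G F (here refl) | inj₂ (u , u∈ , _) | yes _ = u∈
    loop-accepted-∈ Z (suc f) (suc β) G F (there v∈)  | inj₂ (u , u∈ , _) | yes _ = loop-accepted-∈ Z f β _ _ v∈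
    loop-accepted-∈ Z (suc f) (suc β) G F v∈          | inj₂ (u , u∈ , _) | no _  = loop-accepted-∈ Z f (suc β) _ _ v∈

    module _ {Z : E′} where

      run-rejected : ∀ {β G F vs G′ F′} → Run Z β G F vs G′ F′ → ∀ {v} → v ∈ˡ vs → v ∈ˡ cands
      run-rejected (take _ _ _ r) v∈          = run-rejected r v∈
      run-rejected (skip u∈ r)    (here refl) = u∈
      run-rejected (skip u∈ r)    (there v∈)  = run-rejected r v∈

      run-subset : ∀ {β G F vs G′ F′} → Run Z β G F vs G′ F′ → ∀ {d} → d ∈ˡ G′ → d ∈ˡ G
      run-subset {F = F} (stop _) d∈ = proj₁ (∈-filter⁻ (¬? ∘ bad? F) d∈)
      run-subset {F = F} (take {u = u} _ _ _ r) d∈ =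
        proj₁ (∈-filter⁻ (¬? ∘ bad? F) (proj₁ (∈-filter⁻ (¬? ∘ (u ∈ᵥ?_)) (run-subset r d∈))))
      run-subset {F = F} (skip {u = u} _ r) d∈ =
        proj₁ (∈-filter⁻ (¬? ∘ bad? F) (proj₁ (∈-filter⁻ (¬? ∘ (u ∈ᵥ?_)) (run-subset r d∈))))

      count-remove-prune : ∀ {P : E′ → Set} (P? : Decidable P) u F G →
        count P? (remove u (prune F G)) ≤ count P? G
      count-remove-prune P? u F G = ≤-trans
        (count-filter-≤ P? (¬? ∘ (u ∈ᵥ?_)) (prune F G)) (count-filter-≤ P? (¬? ∘ bad? F) G)

      run-degree : ∀ {β G F vs G′ F′} v → Run Z β G F vs G′ F′ → degree v G′ ≤ degree v (prune F G)
      run-degree v (stop _) = ≤-refl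
      run-degree {G = G} {F} v (take {u = u} _ _ _ r) = ≤-trans (run-degree v r) (≤-trans
        (count-filter-≤ (v ∈ᵥ?_) (¬? ∘ bad? (link u (prune F G) ++ F)) (remove u (prune F G)))
        (count-filter-≤ (v ∈ᵥ?_) (¬? ∘ (u ∈ᵥ?_)) (prune F G)))
      run-degree {G = G} {F} v (skip {u = u} _ r) = ≤-trans (run-degree v r) (≤-trans
        (count-filter-≤ (v ∈ᵥ?_) (¬? ∘ bad? F) (remove u (prune F G)))
        (count-filter-≤ (v ∈ᵥ?_) (¬? ∘ (u ∈ᵥ?_)) (prune F G)))

      length-link : ∀ u G → length (link u G) ≡ degree u G
      length-link u G = List.length-map (delete u) (filter (u ∈ᵥ?_) G)

      run-codeg-mono : ∀ {β G F vs G′ F′} L → Run Z β G F vs G′ F′ → codeg L F ≤ codeg L F′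
      run-codeg-mono L (stop _) = ≤-refl
      run-codeg-mono {G = G} {F} L (take {u = u} _ _ _ r) = ≤-trans
        (≤-trans (m≤n+m _ (codeg L (link u (prune F G))))
          (≤-reflexive (sym (count-++ (L ⊑?_) (link u (prune F G)) F))))
        (run-codeg-mono L r)
      run-codeg-mono L (skip _ r) = run-codeg-mono L r

      bad-mono : ∀ {β G F vs G′ F′} → Run Z β G F vs G′ F′ → ∀ {d} → Bad F d → Bad F′ d
      bad-mono r bad with L , L∈ , (a , sat) , L⊑d ← find bad =
        lose L∈ ((a , ≤-trans sat (*-monoˡ-≤ _ (run-codeg-mono L r))) , L⊑d)

      -- Maximality of the accepted vertices: each contributes at least as
      -- many links as any vertex has edges left at the end.
      run-budget : ∀ {β G F vs G′ F′ v} → v ∈ˡ cands → Run Z β G F vs G′ F′ →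
                   length F + β * degree v G′ ≤ length F′
      run-budget {F = F} v∈ (stop z) = ≤-reflexive (trans (cong (length F +_) (z v∈)) (+-identityʳ (length F)))
      run-budget {suc β} {G} {F} {G′ = G′} {F′} {v} v∈ r₀@(take {u = u} _ _ max r) = begin
        length F + (degree v G′ + β * degree v G′)
          ≡⟨ sym (+-assoc (length F) _ _) ⟩
        length F + degree v G′ + β * degree v G′
          ≤⟨ +-monoˡ-≤ _ (+-monoʳ-≤ (length F) (≤-trans (run-degree v r₀) (max v∈))) ⟩
        length F + degree u (prune F G) + β * degree v G′
          ≡⟨ cong (_+ β * degree v G′) (trans (+-comm (length F) _)
               (trans (cong (_+ length F) (sym (length-link u (prune F G))))
                 (sym (List.length-++ (link u (prune F G)))))) ⟩
        length (link u (prune F G) ++ F) + β * degree v G′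
          ≤⟨ run-budget v∈ r ⟩
        length F′ ∎
        where open ≤-Reasoning
      run-budget v∈ (skip _ r) = run-budget v∈ r

      -- The pruned edges all satisfy `P`, so pruning lowers both counts by the same number. The sum
      -- form avoids subtraction; `run-cover` adds a count to both sides in order to apply it and
      -- cancels the count at the end.
      prune-count : ∀ {P : E′ → Set} (P? : Decidable P) F G → (∀ {d} → Bad F d → P d) →
        length G + count P? (prune F G) ≡ length (prune F G) + count P? G
      prune-count P? F G bad⇒ = begin
        length G + count P? (prune F G)
          ≡⟨ cong (_+ count P? (prune F G)) (trans (length-split (bad? F) G) (+-comm (count (bad? F) G) _)) ⟩
        length (prune F G) + count (bad? F) G + count P? (prune F G)
          ≡⟨ +-assoc (length (prune F G)) _ _ ⟩
        length (prune F G) + (count (bad? F) G + count P? (prune F G))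
          ≡⟨ cong (λ c → length (prune F G) + (c + count P? (prune F G))) (sym (count-all P? (filter (bad? F) G)
               (λ d∈ → bad⇒ (proj₂ (∈-filter⁻ (bad? F) {xs = G} d∈))))) ⟩
        length (prune F G) + (count P? (filter (bad? F) G) + count P? (prune F G))
          ≡⟨ cong (length (prune F G) +_) (sym (count-split (bad? F) P? G)) ⟩
        length (prune F G) + count P? G ∎
        where open ≡-Reasoning

      -- Every edge is hit by a rejected vertex, contains a saturated pair,
      -- gave rise to a link, or is left over.
      run-cover : ∀ {β G F vs G′ F′} → Run Z β G F vs G′ F′ →
        length G + length F ≤ count (hit? vs) G + count (bad? F′) G + (length F′ + length G′)
      run-cover {G = G} {F} (stop _) = begin
        length G + length F
          ≡⟨ cong (_+ length F) (length-split (bad? F) G) ⟩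
        count (bad? F) G + length (prune F G) + length F
          ≡⟨ trans (+-assoc (count (bad? F) G) _ _) (cong (count (bad? F) G +_) (+-comm (length (prune F G)) _)) ⟩
        count (bad? F) G + (length F + length (prune F G))
          ≤⟨ +-monoˡ-≤ _ (m≤n+m _ (count (hit? []) G)) ⟩
        count (hit? []) G + count (bad? F) G + (length F + length (prune F G)) ∎
        where open ≤-Reasoning
      run-cover {G = G} {F} {vs} {G′} {F′} r₀@(take {u = u} _ _ _ r) =
        +-cancelˡ-≤ (count (bad? F′) P) _ _ (begin
          count (bad? F′) P + (length G + length F)
            ≡⟨ arrange₁ (count (bad? F′) P) (length G) (length F) ⟩
          length G + count (bad? F′) P + length F
            ≡⟨ cong (_+ length F) (prune-count (bad? F′) F G (bad-mono r₀)) ⟩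
          length P + count (bad? F′) G + length F
            ≡⟨ cong (λ l → l + count (bad? F′) G + length F) (length-remove u P) ⟩
          degree u P + length (remove u P) + count (bad? F′) G + length F
            ≡⟨ arrange₂ (degree u P) (length (remove u P)) (count (bad? F′) G) (length F) ⟩
          length (remove u P) + (degree u P + length F) + count (bad? F′) G
            ≡⟨ cong (λ l → length (remove u P) + l + count (bad? F′) G)
                 (trans (cong (_+ length F) (sym (length-link u P))) (sym (List.length-++ (link u P)))) ⟩
          length (remove u P) + length (link u P ++ F) + count (bad? F′) G
            ≤⟨ +-monoˡ-≤ _ (run-cover r) ⟩
          count (hit? vs) (remove u P) + count (bad? F′) (remove u P) + (length F′ + length G′) + count (bad? F′) G
            ≤⟨ +-monoˡ-≤ _ (+-monoˡ-≤ _ (+-mono-≤ (count-remove-prune (hit? vs) u F G)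
                 (count-filter-≤ (bad? F′) (¬? ∘ (u ∈ᵥ?_)) P))) ⟩
          count (hit? vs) G + count (bad? F′) P + (length F′ + length G′) + count (bad? F′) G
            ≡⟨ arrange₃ (count (hit? vs) G) (count (bad? F′) P) (length F′ + length G′) (count (bad? F′) G) ⟩
          count (bad? F′) P + (count (hit? vs) G + count (bad? F′) G + (length F′ + length G′)) ∎)
        where
        open ≤-Reasoning
        P = prune F G
        arrange₁ : ∀ a b c → a + (b + c) ≡ b + a + c
        arrange₁ = solve-∀
        arrange₂ : ∀ a b c d → a + b + c + d ≡ b + (a + d) + c
        arrange₂ = solve-∀
        arrange₃ : ∀ a b c d → a + b + c + d ≡ b + (a + d + c)
        arrange₃ = solve-∀
      run-cover {G = G} {F} {.(u ∷ vs)} {G′} {F′} r₀@(skip {u = u} {vs} _ r) =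
        +-cancelˡ-≤ (count (bad? F′) P) _ _ (begin
          count (bad? F′) P + (length G + length F)
            ≡⟨ arrange₁ (count (bad? F′) P) (length G) (length F) ⟩
          length G + count (bad? F′) P + length F
            ≡⟨ cong (_+ length F) (prune-count (bad? F′) F G (bad-mono r₀)) ⟩
          length P + count (bad? F′) G + length F
            ≡⟨ cong (λ l → l + count (bad? F′) G + length F) (length-remove u P) ⟩
          degree u P + length (remove u P) + count (bad? F′) G + length F
            ≡⟨ arrange₂ (degree u P) (length (remove u P)) (count (bad? F′) G) (length F) ⟩
          length (remove u P) + length F + (degree u P + count (bad? F′) G)
            ≤⟨ +-monoˡ-≤ _ (run-cover r) ⟩
          count (hit? vs) (remove u P) + count (bad? F′) (remove u P) + (length F′ + length G′) + (degree u P + count (bad? F′) G)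
            ≤⟨ +-monoˡ-≤ _ (+-monoˡ-≤ (length F′ + length G′) (+-monoʳ-≤ (count (hit? vs) (remove u P)) (count-filter-≤ (bad? F′) (¬? ∘ (u ∈ᵥ?_)) P))) ⟩
          count (hit? vs) (remove u P) + count (bad? F′) P + (length F′ + length G′) + (degree u P + count (bad? F′) G)
            ≡⟨ arrange₃ (count (hit? vs) (remove u P)) (count (bad? F′) P) (length F′ + length G′) (degree u P) (count (bad? F′) G) ⟩
          count (bad? F′) P + (degree u P + count (hit? vs) (remove u P) + count (bad? F′) G + (length F′ + length G′))
            ≤⟨ +-monoʳ-≤ (count (bad? F′) P) (+-monoˡ-≤ _ (+-monoˡ-≤ _ hits)) ⟩
          count (bad? F′) P + (count (hit? (u ∷ vs)) G + count (bad? F′) G + (length F′ + length G′)) ∎)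
        where
        open ≤-Reasoning
        P = prune F G
        arrange₁ : ∀ a b c → a + (b + c) ≡ b + a + c
        arrange₁ = solve-∀
        arrange₂ : ∀ a b c d → a + b + c + d ≡ b + d + (a + c)
        arrange₂ = solve-∀
        arrange₃ : ∀ a b c d e → a + b + c + (d + e) ≡ b + (d + a + e + c)
        arrange₃ = solve-∀
        -- The edges at `u` and the edges that avoid `u` partition `P`, so none is counted twice,
        -- although `vs` may meet edges at `u` as well.
        hits : degree u P + count (hit? vs) (remove u P) ≤ count (hit? (u ∷ vs)) G
        hits = begin
          degree u P + count (hit? vs) (remove u P)
            ≤⟨ +-mono-≤ (≤-reflexive (sym (count-all (hit? (u ∷ vs)) (filter (u ∈ᵥ?_) P)
                 (λ d∈ → here (proj₂ (∈-filter⁻ (u ∈ᵥ?_) {xs = P} d∈))))))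
                 (count-mono (hit? vs) (hit? (u ∷ vs)) (remove u P) (λ _ → there)) ⟩
          count (hit? (u ∷ vs)) (filter (u ∈ᵥ?_) P) + count (hit? (u ∷ vs)) (remove u P)
            ≡⟨ sym (count-split (u ∈ᵥ?_) (hit? (u ∷ vs)) P) ⟩
          count (hit? (u ∷ vs)) P
            ≤⟨ count-filter-≤ (hit? (u ∷ vs)) (¬? ∘ bad? F) G ⟩
          count (hit? (u ∷ vs)) G ∎

      run-edges : ∀ {β G F vs G′ F′} → Run Z β G F vs G′ F′ → ∀ {d′} → d′ ∈ˡ F′ → d′ ∈ˡ F
        ⊎ (∃[ u ] ∃[ d ] u ∈ˡ cands × u ∈ᵥ Z × d ∈ˡ G × u ∈ᵥ d × d′ ≡ delete u d)
      run-edges (stop _) d′∈ = inj₁ d′∈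
      run-edges {G = G} {F} (take {u = u} u∈ u∈Z _ r) d′∈ with run-edges r d′∈
      ... | inj₂ (w , d , w∈ , w∈Z , d∈ , w∈d , eq) = inj₂ (w , d , w∈ , w∈Z ,
              proj₁ (∈-filter⁻ (¬? ∘ bad? F) (proj₁ (∈-filter⁻ (¬? ∘ (u ∈ᵥ?_)) d∈))) , w∈d , eq)
      ... | inj₁ d′∈′ with ∈-++⁻ (link u (prune F G)) d′∈′
      ...   | inj₂ d′∈F = inj₁ d′∈F
      ...   | inj₁ d′∈link with d , d∈ , eq ← ∈-map⁻ (delete u) d′∈link
                           with d∈P , u∈d ← ∈-filter⁻ (u ∈ᵥ?_) {xs = prune F G} d∈ =
              inj₂ (u , d , u∈ , u∈Z , proj₁ (∈-filter⁻ (¬? ∘ bad? F) d∈P) , u∈d , eq)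
      run-edges {G = G} {F} (skip {u = u} u∈ r) d′∈ with run-edges r d′∈
      ... | inj₁ d′∈F = inj₁ d′∈F
      ... | inj₂ (w , d , w∈ , w∈Z , d∈ , w∈d , eq) = inj₂ (w , d , w∈ , w∈Z ,
              proj₁ (∈-filter⁻ (¬? ∘ bad? F) (proj₁ (∈-filter⁻ (¬? ∘ (u ∈ᵥ?_)) d∈))) , w∈d , eq)

      module _ {L : E′} (aL : adm L) where

        codeg-link≤ : ∀ u G → codeg L (link u G) ≤ codeg (insert u L) G
        codeg-link≤ u G = begin
          codeg L (link u G)
            ≡⟨ count-map (L ⊑?_) (delete u) (filter (u ∈ᵥ?_) G) ⟩
          count (λ d → L ⊑? delete u d) (filter (u ∈ᵥ?_) G)
            ≤⟨ count-mono _ (insert u L ⊑?_) (filter (u ∈ᵥ?_) G) (λ d∈ L⊑ →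
                 proj₂ (⊑-delete u (proj₂ (∈-filter⁻ (u ∈ᵥ?_) {xs = G} d∈)) L⊑)) ⟩
          codeg (insert u L) (filter (u ∈ᵥ?_) G)
            ≤⟨ count-filter-≤ (insert u L ⊑?_) (u ∈ᵥ?_) G ⟩
          codeg (insert u L) G ∎
          where open ≤-Reasoning

        -- While `L` is unsaturated, its codegree in `F` is below the threshold, and one link adds
        -- at most another threshold, hence the factor 2. Once `L` is saturated, pruning has removed
        -- every edge that contains it, and no link contains it any more.
        run-codeg : ∀ {β G F vs G′ F′} → Run Z β G F vs G′ F′ →
          (∀ {u} → u ∈ˡ cands → u ∉ᵥ L → codeg (insert u L) G * (N * y L) ≤ b * x L * e) →
          codeg L F * (N * y L) ≤ 2 * (b * x L * e) → codeg L F′ * (N * y L) ≤ 2 * (b * x L * e)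
        run-codeg (stop _) _ F≤ = F≤
        run-codeg {G = G} {F} (take {u = u} u∈ _ _ r) G≤ F≤ = run-codeg r
          (λ {w} w∈ w∉L → ≤-trans (*-monoˡ-≤ (N * y L) (count-remove-prune (insert w L ⊑?_) u F G)) (G≤ w∈ w∉L))
          (≤-trans (≤-reflexive (cong (_* (N * y L)) (count-++ (L ⊑?_) (link u P) F))) step)
          where
          open ≤-Reasoning
          P = prune F G
          link-free : (∀ {d} → d ∈ˡ P → u ∈ᵥ d → ¬ (L ⊑ delete u d)) → codeg L (link u P) ≡ 0
          link-free none = trans (count-map (L ⊑?_) (delete u) (filter (u ∈ᵥ?_) P))
            (count-none (λ d → L ⊑? delete u d) (filter (u ∈ᵥ?_) P)
              (λ d∈ → let (d∈P , u∈d) = ∈-filter⁻ (u ∈ᵥ?_) {xs = P} d∈ in none d∈P u∈d))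
          free-step : codeg L (link u P) ≡ 0 → (codeg L (link u P) + codeg L F) * (N * y L) ≤ 2 * (b * x L * e)
          free-step eq = ≤-trans (≤-reflexive (cong (λ c → (c + codeg L F) * (N * y L)) eq)) F≤
          ⊑-delete⇒⊑ : ∀ {d} → L ⊑ delete u d → u ∈ᵥ d → L ⊑ d
          ⊑-delete⇒⊑ L⊑ u∈d = let (_ , ins) = ⊑-delete u u∈d L⊑ in
            ⇒⊑ (λ v v∈L → ⊑⇒ ins v (∈-insert-other u {v} v∈L))
          step : (codeg L (link u P) + codeg L F) * (N * y L) ≤ 2 * (b * x L * e)
          step with saturated? F L
          ... | yes sat = free-step (link-free (λ {d} d∈P u∈d L⊑ →
                  proj₂ (∈-filter⁻ (¬? ∘ bad? F) {xs = G} d∈P)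
                    (lose (allPairs-complete L) (sat , ⊑-delete⇒⊑ L⊑ u∈d))))
          ... | no ¬sat with u ∈ᵥ? L
          -- Links at `u` no longer contain `u`, so they cannot contain `L`.
          ...   | yes u∈L = free-step (link-free (λ d∈P u∈d L⊑ → proj₁ (⊑-delete u u∈d L⊑) u∈L))
          ...   | no  u∉L = begin
            (codeg L (link u P) + codeg L F) * (N * y L)
              ≡⟨ *-distribʳ-+ (N * y L) (codeg L (link u P)) _ ⟩
            codeg L (link u P) * (N * y L) + codeg L F * (N * y L)
              ≤⟨ +-mono-≤
                   (≤-trans (*-monoˡ-≤ (N * y L) (≤-trans (codeg-link≤ u P)
                     (count-filter-≤ (insert u L ⊑?_) (¬? ∘ bad? F) G))) (G≤ u∈ u∉L))
                   (<⇒≤ (≰⇒> (λ h → ¬sat (aL , h)))) ⟩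
            b * x L * e + b * x L * e
              ≡⟨ cong (b * x L * e +_) (sym (+-identityʳ _)) ⟩
            2 * (b * x L * e) ∎
        run-codeg {G = G} {F} (skip {u = u} _ r) G≤ F≤ = run-codeg r
          (λ {w} w∈ w∉L → ≤-trans (*-monoˡ-≤ (N * y L) (count-remove-prune (insert w L ⊑?_) u F G)) (G≤ w∈ w∉L)) F≤

-- Estimates for one stage

module _ {n₀ n₁ : ℕ} where

  private
    V = Vertex {n₀} {n₁}
    E′ = Pair n₀ n₁

  count-hit : ∀ (vs : List V) (G : List E′) c d → (∀ {v} → v ∈ˡ vs → degree v G * c ≤ d) →
              count (hit? vs) G * c ≤ length vs * d
  count-hit vs G c d deg≤ = begin
    count (hit? vs) G * c   ≤⟨ *-monoˡ-≤ c (union-bound _∈ᵥ?_ vs G) ⟩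
    sum-of (λ v → degree v G) vs * c       ≡⟨ *-comm _ c ⟩
    c * sum-of (λ v → degree v G) vs       ≡⟨ sym (sum-of-*ˡ c (λ v → degree v G) vs) ⟩
    sum-of (λ v → c * degree v G) vs       ≤⟨ sum-of-mono _ _ vs (λ v∈ → ≤-trans (≤-reflexive (*-comm c _)) (deg≤ v∈)) ⟩
    sum-of (λ _ → d) vs                    ≡⟨ sum-of-const d vs ⟩
    length vs * d                          ∎
    where open ≤-Reasoning

  module StageBounds
    (cands : List V) {adm : E′ → Set} (adm? : ∀ L → Dec (adm L)) (x y : E′ → ℕ) (N b : ℕ)
    (G : List E′) (Z : E′) (k : ℕ) (0<b : 0 < b) (b≤N : b ≤ N)
    (y>0 : ∀ L → 0 < y L) (∅-not-adm : ¬ adm ∅)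
    (codeg≤ : ∀ L → adm L → codeg L G * y L ≤ x L * length G)
    (shift : ∀ {u L} → u ∈ˡ cands → u ∉ᵥ L → adm L →
             adm (insert u L) × y (insert u L) ≡ N * y L × x (insert u L) ≡ b * x L)
    (size≤ : ∀ {d} → d ∈ˡ G → size d ≤ suc k)
    (hs : List V) (hs⊆ : ∀ {v} → v ∈ˡ hs → v ∈ˡ cands) (∣hs∣≤ : length hs ≤ N)
    (hs-hit : ∀ {d} → d ∈ˡ G → Any (_∈ᵥ d) hs) where

    open Stage cands adm? x y N b (length G)

    private
      t  = loop (length G) b G []
      F  = result t Z
      vs = rejected t Z
      G′ = proj₁ (loop-run Z (length G) b G [] ≤-refl)
      r : Run Z b G [] vs G′ F
      r = proj₂ (loop-run Z (length G) b G [] ≤-refl)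

      instance
        N≢0 : NonZero N
        N≢0 = >-nonZero (<-≤-trans 0<b b≤N)

    stage-codeg : ∀ L → adm L → codeg L F * (N * y L) ≤ 2 * (b * x L * length G)
    stage-codeg L aL = run-codeg aL r (λ {u} u∈ u∉L →
        let (aL′ , y≡ , x≡) = shift u∈ u∉L aL in
        subst₂ (λ s t → codeg (insert u L) G * s ≤ t * length G) y≡ x≡ (codeg≤ (insert u L) aL′))
      z≤n

    stage-size : ∀ {d} → d ∈ˡ F → size d ≤ k
    stage-size d∈ with run-edges r d∈
    ... | inj₂ (u , d , _ , _ , d∈G , u∈d , refl) = s≤s⁻¹ (≤-trans (≤-reflexive (size-delete u u∈d)) (size≤ d∈G))

    -- By `run-budget` every candidate has at most `length F / b` edges left, and the at most `N`
    -- vertices of `hs` meet all edges.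
    leftover≤ : b * length G′ ≤ N * length F
    leftover≤ = begin
      b * length G′                                ≡⟨ *-comm b _ ⟩
      length G′ * b                                ≡⟨ cong (_* b) (sym (count-all (hit? hs) G′ (λ d∈ → hs-hit (run-subset r d∈)))) ⟩
      count (hit? hs) G′ * b        ≤⟨ count-hit hs G′ b (length F) (λ {v} v∈ →
                                                        ≤-trans (≤-reflexive (*-comm _ b)) (run-budget (hs⊆ v∈) r)) ⟩
      length hs * length F                         ≤⟨ *-monoˡ-≤ (length F) ∣hs∣≤ ⟩
      N * length F                                 ∎
      where open ≤-Reasoning

    private
      adm⊑? : ∀ L d → Dec (adm L × L ⊑ d)
      adm⊑? L d = adm? L ×-dec (L ⊑? d)

      adm-sum : ℕ
      adm-sum = sum-of (λ L → count (adm⊑? L) F) (allPairs n₀ n₁)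

      -- An edge of size at most `k` contains at most `2 ^ k` pairs, and `∅` is one that is not
      -- admissible. The spared `length F` pays for one of the two further terms `length F` in
      -- `stage-length`.
      adm-sum≤ : adm-sum + length F ≤ 2 ^ k * length F
      adm-sum≤ = begin
        adm-sum + length F
          ≡⟨ cong₂ _+_ (double-count adm⊑? (allPairs n₀ n₁) F) (sym (sum-of-1 F)) ⟩
        sum-of (λ d → count (λ L → adm⊑? L d) (allPairs n₀ n₁)) F + sum-of (λ _ → 1) F
          ≡⟨ sym (sum-of-+ _ _ F) ⟩
        sum-of (λ d → count (λ L → adm⊑? L d) (allPairs n₀ n₁) + 1) F
          ≤⟨ sum-of-mono _ _ F (λ {d} d∈ → begin
               count (λ L → adm⊑? L d) (allPairs n₀ n₁) + 1   ≡⟨ +-comm _ 1 ⟩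
               suc (count (λ L → adm⊑? L d) (allPairs n₀ n₁)) ≤⟨ count-mono-< (λ L → adm⊑? L d) (_⊑? d) proj₂
                                                                   (allPairs-complete ∅) (∅-not-adm ∘ proj₁)
                                                                   (⇒⊑ (λ v v∈ → contradiction v∈ (∉∅ v))) ⟩
               count (_⊑? d) (allPairs n₀ n₁)                 ≡⟨ count-⊑ d ⟩
               2 ^ size d                                     ≤⟨ ^-monoʳ-≤ 2 (stage-size d∈) ⟩
               2 ^ k                                          ∎) ⟩
        sum-of (λ _ → 2 ^ k) F
          ≡⟨ trans (sum-of-const (2 ^ k) F) (*-comm (length F) _) ⟩
        2 ^ k * length F ∎
        where open ≤-Reasoning

      -- The codegree bound for `G` and the saturation threshold for `F` differ by exactly `b / N`,
      -- so the edges of `G` lost to a saturated `L` are charged to the edges of `F` that contain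
      -- `L`.
      saturated≤ : ∀ L → b * count (saturated⊑? F L) G ≤ N * count (adm⊑? L) F
      saturated≤ L with saturated? F L
      ... | no ¬sat = ≤-trans (≤-reflexive (trans
              (cong (b *_) (count-none (λ d → no ¬sat ×-dec (L ⊑? d)) G (λ _ → ¬sat ∘ proj₁))) (*-zeroʳ b))) z≤n
      ... | yes (aL , sat) = *-cancelʳ-≤ _ _ (y L) {{>-nonZero (y>0 L)}} (begin
        b * count (λ d → yes (aL , sat) ×-dec (L ⊑? d)) G * y L
          ≤⟨ *-monoˡ-≤ (y L) (*-monoʳ-≤ b (count-mono (λ d → yes (aL , sat) ×-dec (L ⊑? d)) (L ⊑?_) G (λ _ → proj₂))) ⟩
        b * codeg L G * y L
          ≡⟨ *-assoc b _ _ ⟩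
        b * (codeg L G * y L)
          ≤⟨ *-monoʳ-≤ b (codeg≤ L aL) ⟩
        b * (x L * length G)
          ≡⟨ sym (*-assoc b _ _) ⟩
        b * x L * length G
          ≤⟨ sat ⟩
        codeg L F * (N * y L)
          ≤⟨ *-monoˡ-≤ (N * y L) (count-mono (L ⊑?_) (adm⊑? L) F (λ _ → aL ,_)) ⟩
        count (adm⊑? L) F * (N * y L)
          ≡⟨ trans (sym (*-assoc (count (adm⊑? L) F) N _)) (cong (_* y L) (*-comm (count (adm⊑? L) F) N)) ⟩
        N * count (adm⊑? L) F * y L ∎)
        where open ≤-Reasoning

    bad≤ : b * count (bad? F) G ≤ N * adm-sum
    bad≤ = begin
      b * count (bad? F) G
        ≤⟨ *-monoʳ-≤ b (union-bound (saturated⊑? F) (allPairs n₀ n₁) G) ⟩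
      b * sum-of (λ L → count (saturated⊑? F L) G) (allPairs n₀ n₁)
        ≡⟨ sym (sum-of-*ˡ b (λ L → count (saturated⊑? F L) G) (allPairs n₀ n₁)) ⟩
      sum-of (λ L → b * count (saturated⊑? F L) G) (allPairs n₀ n₁)
        ≤⟨ sum-of-mono _ _ (allPairs n₀ n₁) (λ {L} _ → saturated≤ L) ⟩
      sum-of (λ L → N * count (adm⊑? L) F) (allPairs n₀ n₁)
        ≡⟨ sum-of-*ˡ N (λ L → count (adm⊑? L) F) (allPairs n₀ n₁) ⟩
      N * adm-sum ∎
      where open ≤-Reasoning

    module _ (few : 2 * count (hit? vs) G ≤ length G) where

      -- Rejected vertices meet at most half of `G`. The other half is covered by saturated pairs,
      -- links and leftovers, which cost `adm-sum`, `length F` and `length F` in units of `N / b`.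
      -- Doubling the sum, at most `2 * 2 ^ k * length F`, gives the exponent `2 + k`.
      stage-length : b * length G ≤ N * (2 ^ (2 + k) * length F)
      stage-length = +-cancelˡ-≤ (b * length G) _ _ (begin
        b * length G + b * length G
          ≡⟨ arrange₁ b (length G) ⟩
        2 * (b * (length G + 0))
          ≤⟨ *-monoʳ-≤ 2 (*-monoʳ-≤ b (run-cover r)) ⟩
        2 * (b * (H + C + (length F + length G′)))
          ≡⟨ arrange₂ b H C (length F) (length G′) ⟩
        b * (2 * H) + 2 * (b * C + b * length F + b * length G′)
          ≤⟨ +-mono-≤ (*-monoʳ-≤ b few) (*-monoʳ-≤ 2 (+-mono-≤ (+-mono-≤ bad≤ (*-monoˡ-≤ (length F) b≤N)) leftover≤)) ⟩
        b * length G + 2 * (N * adm-sum + N * length F + N * length F)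
          ≡⟨ cong (b * length G +_) (arrange₃ N adm-sum (length F)) ⟩
        b * length G + N * (2 * (adm-sum + length F + length F))
          ≤⟨ +-monoʳ-≤ (b * length G) (*-monoʳ-≤ N (*-monoʳ-≤ 2 (+-mono-≤ adm-sum≤ (m≤n*m (length F) (2 ^ k) {{m^n≢0 2 k}})))) ⟩
        b * length G + N * (2 * (2 ^ k * length F + 2 ^ k * length F))
          ≡⟨ cong (λ c → b * length G + N * c) (arrange₄ (2 ^ k) (length F)) ⟩
        b * length G + N * (2 ^ (2 + k) * length F) ∎)
        where
        open ≤-Reasoning
        H = count (hit? vs) G
        C = count (bad? F) G
        arrange₁ : ∀ b g → b * g + b * g ≡ 2 * (b * (g + 0))
        arrange₁ = solve-∀
        arrange₂ : ∀ b h c f g → 2 * (b * (h + c + (f + g))) ≡ b * (2 * h) + 2 * (b * c + b * f + b * g)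
        arrange₂ = solve-∀
        arrange₃ : ∀ n s f → 2 * (n * s + n * f + n * f) ≡ n * (2 * (s + f + f))
        arrange₃ = solve-∀
        arrange₄ : ∀ p f → 2 * (p * f + p * f) ≡ 2 * (2 * p) * f
        arrange₄ = solve-∀

      -- One factor 2 comes from the overshoot in `stage-codeg`, the others from `stage-length`; the
      -- scale `b / N` cancels.
      stage-ratio : ∀ L → adm L → codeg L F * y L ≤ 2 ^ (3 + k) * x L * length F
      stage-ratio L aL = *-cancelˡ-≤ N (begin
        N * (codeg L F * y L)
          ≡⟨ arrange₁ N (codeg L F) (y L) ⟩
        codeg L F * (N * y L)
          ≤⟨ stage-codeg L aL ⟩
        2 * (b * x L * length G)
          ≡⟨ arrange₂ b (x L) (length G) ⟩
        2 * x L * (b * length G)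
          ≤⟨ *-monoʳ-≤ (2 * x L) stage-length ⟩
        2 * x L * (N * (2 ^ (2 + k) * length F))
          ≡⟨ arrange₃ N (x L) (2 ^ (2 + k)) (length F) ⟩
        N * (2 ^ (3 + k) * x L * length F) ∎)
        where
        open ≤-Reasoning
        arrange₁ : ∀ n c y → n * (c * y) ≡ c * (n * y)
        arrange₁ = solve-∀
        arrange₂ : ∀ b x g → 2 * (b * x * g) ≡ 2 * x * (b * g)
        arrange₂ = solve-∀
        arrange₃ : ∀ n x p f → 2 * x * (n * (p * f)) ≡ n * (2 * p * x * f)
        arrange₃ = solve-∀

      stage-nonempty : 0 < length G → 0 < length F
      stage-nonempty 0<G = n≢0⇒n>0 λ F≡0 → <⇒≱ (*-mono-< 0<b 0<G)
        (≤-trans stage-length (≤-reflexive (trans (cong (λ f → N * (2 ^ (2 + k) * f)) F≡0)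
          (trans (cong (N *_) (*-zeroʳ (2 ^ (2 + k)))) (*-zeroʳ N)))))

-- Iterating the stages

-- Σ_{1 ≤ j ≤ k} (j + 2), the exponent of the total loss of stages k, …, 1
loss : ℕ → ℕ
loss zero    = 0
loss (suc k) = 3 + k + loss k

module Weights (b m n₁ q : ℕ) where

  -- The hypothesis on codegrees reads Δ ≤ R · X · e(H) / Y.
  X Y : ℕ → ℕ → ℕ
  X ℓ₀ ℓ₁ = b ^ (ℓ₀ + ℓ₁ ∸ 1) * m ^ 𝟙[0< ℓ₀ ]
  Y ℓ₀ ℓ₁ = m ^ ℓ₀ * n₁ ^ ℓ₁ * q ^ 𝟙[0< ℓ₀ ]

  module _ .{{_ : NonZero b}} .{{_ : NonZero m}} where

    X>0 : ∀ ℓ₀ ℓ₁ → 0 < X ℓ₀ ℓ₁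
    X>0 ℓ₀ ℓ₁ = *-mono-≤ (m^n>0 b (ℓ₀ + ℓ₁ ∸ 1)) (m^n>0 m 𝟙[0< ℓ₀ ])

  module _ .{{_ : NonZero m}} .{{_ : NonZero n₁}} .{{_ : NonZero q}} where

    Y>0 : ∀ ℓ₀ ℓ₁ → 0 < Y ℓ₀ ℓ₁
    Y>0 ℓ₀ ℓ₁ = *-mono-≤ (*-mono-≤ (m^n>0 m ℓ₀) (m^n>0 n₁ ℓ₁)) (m^n>0 q 𝟙[0< ℓ₀ ])

module Containers {n₀ n₁ : ℕ} (b m q P Q K : ℕ) (0<b : 0 < b) (0<q : 0 < q) (0<Q : 0 < Q)
                  (b≤m : b ≤ m) (b≤n₁ : b ≤ n₁) where

  private
    V = Vertex {n₀} {n₁}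
    E′ = Pair n₀ n₁

    instance
      q≢0 : NonZero q
      q≢0 = >-nonZero 0<q
      m≢0 : NonZero m
      m≢0 = >-nonZero (<-≤-trans 0<b b≤m)
      n₁≢0 : NonZero n₁
      n₁≢0 = >-nonZero (<-≤-trans 0<b b≤n₁)

  open Weights b m n₁ q

  x : ℕ → E′ → ℕ
  x z (L₀ , L₁) = 2 ^ z * (P * X ∣ L₀ ∣ ∣ L₁ ∣)

  y : E′ → ℕ
  y (L₀ , L₁) = Y ∣ L₀ ∣ ∣ L₁ ∣ * Q

  y>0 : ∀ L → 0 < y L
  y>0 (L₀ , L₁) = *-mono-≤ (Y>0 ∣ L₀ ∣ ∣ L₁ ∣) 0<Q

  -- (k , z , G): the edges of G have size at most k, and codegrees of G are
  -- bounded as in the hypothesis, with e(G) for e(H) and 2 ^ z * P / Q for R.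
  State : Set
  State = ℕ × ℕ × List E′

  module Phase (cands : List V) {adm : E′ → Set} (adm? : ∀ L → Dec (adm L)) (N : ℕ) where

    stage : ℕ → List E′ → Tree (List E′)
    stage z G = Stage.loop cands adm? (x z) y N b (length G) (length G) b G []

    phase : ℕ → State → Tree State
    phase zero    s               = leaf s
    -- A default: under `Invariant` the size bound equals `j + c`, so it is positive while stages
    -- remain.
    phase (suc j) s@(zero  , _)   = leaf s
    phase (suc j) (suc k , z , G) = stage z G >>= λ F → phase j (k , 3 + k + z , F)

    phase-accepted : ∀ j s Z → length (accepted (phase j s) Z) ≤ j * b
    phase-accepted zero    s               Z = z≤n
    phase-accepted (suc j) (zero  , _)     Z = z≤n
    phase-accepted (suc j) (suc k , z , G) Z = begin
      length (accepted (stage z G >>= rest) Z)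
        ≡⟨ cong length (accepted->>= rest (stage z G) Z) ⟩
      length (accepted (stage z G) Z ++ accepted (rest F) Z)
        ≡⟨ List.length-++ (accepted (stage z G) Z) ⟩
      length (accepted (stage z G) Z) + length (accepted (rest F) Z)
        ≤⟨ +-mono-≤ (Stage.loop-accepted cands adm? (x z) y N b (length G) Z (length G) b G [])
                    (phase-accepted j (k , 3 + k + z , F) Z) ⟩
      b + j * b ∎
      where
      open ≤-Reasoning
      rest : List E′ → Tree State
      rest F = phase j (k , 3 + k + z , F)
      F = result (stage z G) Z

    phase-accepted-∈ : ∀ j s Z {v} → v ∈ˡ accepted (phase j s) Z → v ∈ˡ cands
    phase-accepted-∈ (suc j) (suc k , z , G) Z v∈
      with ∈-++⁻ (accepted (stage z G) Z) (subst (_ ∈ˡ_) (accepted->>= _ (stage z G) Z) v∈)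
    ... | inj₁ v∈₁ = Stage.loop-accepted-∈ cands adm? (x z) y N b (length G) Z (length G) b G [] v∈₁
    ... | inj₂ v∈₂ = phase-accepted-∈ j _ Z v∈₂

    -- `j` stages of this phase remain, and `c` is what they leave of the size bound. The inequality
    -- `loss≤` guarantees `z + 1 ≤ K` at the start of every stage. The 3 on its right is `loss 1`:
    -- the loss in a stage from size bound 1 to 0 is never paid for, since no rejected vertices are
    -- counted afterwards.
    record Invariant (Z : E′) (Ok : ℕ → E′ → Set) (c j k z : ℕ) (G : List E′) : Set where
      field
        stages      : k ≡ j + c
        loss≤       : z + 1 + loss k ≤ K + 3
        codeg≤      : ∀ L → adm L → codeg L G * y L ≤ x z L * length G
        size≤       : ∀ {d} → d ∈ˡ G → size d ≤ k
        nonempty    : 0 < length G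
        independent : ∀ {d} → d ∈ˡ G → ¬ (d ⊑ Z)
        ok          : ∀ {d} → d ∈ˡ G → Ok j d

    module Analysis
      (Z : E′) (T c : ℕ) (0<T : 0 < T) (0<c : 0 < c) (b≤N : b ≤ N) (∅-not-adm : ¬ adm ∅)
      (shift : ∀ z {u L} → u ∈ˡ cands → u ∉ᵥ L → adm L →
               adm (insert u L) × y (insert u L) ≡ N * y L × x z (insert u L) ≡ b * x z L)
      (singleton : ∀ z {v} → v ∈ˡ cands →
               adm (insert v ∅) × y (insert v ∅) ≡ c * (T * Q) × x z (insert v ∅) ≡ c * (2 ^ z * P))
      (hs : List V) (hs⊆ : ∀ {v} → v ∈ˡ hs → v ∈ˡ cands) (∣hs∣≤ : length hs ≤ N)
      (Ok : ℕ → E′ → Set)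
      (Ok-delete : ∀ {j u d} → u ∈ˡ cands → u ∈ᵥ d → Ok (suc j) d → Ok j (delete u d))
      (Ok-hit : ∀ {j d} → Ok (suc j) d → ¬ (d ⊑ Z) → Any (_∈ᵥ d) hs)
      (As : List V) (As⊆ : ∀ {v} → v ∈ˡ As → v ∈ˡ cands) (As-few : length As * (2 ^ K * P) < T * Q) where

      -- A singleton's codegree is a degree, at most `2 ^ z * P / (T * Q)` times `length G` once the
      -- common factor `c` is cancelled. `As-few` bounds the number of rejected vertices, and
      -- `z + 1 ≤ K` leaves a factor 2 to spare.
      few-hit : ∀ {c′ j k z G} → Invariant Z Ok c′ (suc j) k z G → ∀ vs →
                (∀ {v} → v ∈ˡ vs → v ∈ˡ As) → 2 * count (hit? vs) G ≤ length G
      few-hit {c′} {j} {suc k} {z} {G} I vs vs⊆ = *-cancelʳ-≤ _ _ (T * Q) {{TQ≢0}} (begin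
        2 * count (hit? vs) G * (T * Q)
          ≤⟨ *-monoˡ-≤ (T * Q) (*-monoʳ-≤ 2 (count-mono (hit? vs) (hit? As) G (λ _ → Any-⊆))) ⟩
        2 * count (hit? As) G * (T * Q)
          ≡⟨ *-assoc 2 (count (hit? As) G) (T * Q) ⟩
        2 * (count (hit? As) G * (T * Q))
          ≤⟨ *-monoʳ-≤ 2 (count-hit As G (T * Q) (2 ^ z * P * length G) degree≤) ⟩
        2 * (length As * (2 ^ z * P * length G))
          ≡⟨ arrange (length As) (2 ^ z) P (length G) ⟩
        length As * (2 ^ suc z * P) * length G
          ≤⟨ *-monoˡ-≤ (length G) (*-monoʳ-≤ (length As) (*-monoˡ-≤ P (^-monoʳ-≤ 2 z<K))) ⟩
        length As * (2 ^ K * P) * length G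
          ≤⟨ *-monoˡ-≤ (length G) (<⇒≤ As-few) ⟩
        T * Q * length G
          ≡⟨ *-comm (T * Q) (length G) ⟩
        length G * (T * Q) ∎)
        where
        open ≤-Reasoning
        open Invariant I
        TQ≢0 : NonZero (T * Q)
        TQ≢0 = >-nonZero (*-mono-≤ 0<T 0<Q)
        Any-⊆ : ∀ {d} → Any (_∈ᵥ d) vs → Any (_∈ᵥ d) As
        Any-⊆ h = let (v , v∈ , v∈d) = find h in lose (vs⊆ v∈) v∈d
        arrange : ∀ a p q g → 2 * (a * (p * q * g)) ≡ a * (2 * p * q) * g
        arrange = solve-∀
        z<K : suc z ≤ K
        z<K = +-cancelʳ-≤ 3 _ _ (begin
          suc z + 3              ≡⟨ cong (_+ 3) (+-comm 1 z) ⟩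
          z + 1 + 3              ≤⟨ +-monoʳ-≤ (z + 1) (m≤m+n 3 (k + loss k)) ⟩
          z + 1 + (3 + (k + loss k)) ≡⟨ cong (z + 1 +_) (sym (+-assoc 3 k (loss k))) ⟩
          z + 1 + loss (suc k)   ≤⟨ loss≤ ⟩
          K + 3                  ∎)
        degree≤ : ∀ {v} → v ∈ˡ As → degree v G * (T * Q) ≤ 2 ^ z * P * length G
        degree≤ {v} v∈ with a , y≡ , x≡ ← singleton z (As⊆ v∈) = *-cancelˡ-≤ c {{>-nonZero 0<c}} (begin
          c * (degree v G * (T * Q))
            ≡⟨ x∙yz≈y∙xz *-commutativeSemigroup c (degree v G) (T * Q) ⟩
          degree v G * (c * (T * Q))
            ≤⟨ *-monoˡ-≤ (c * (T * Q)) (count-mono (v ∈ᵥ?_) (insert v ∅ ⊑?_) G (λ _ → insert-∅-⊑ v)) ⟩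
          codeg (insert v ∅) G * (c * (T * Q))
            ≡⟨ cong (codeg (insert v ∅) G *_) (sym y≡) ⟩
          codeg (insert v ∅) G * y (insert v ∅)
            ≤⟨ codeg≤ (insert v ∅) a ⟩
          x z (insert v ∅) * length G
            ≡⟨ trans (cong (_* length G) x≡) (*-assoc c (2 ^ z * P) (length G)) ⟩
          c * (2 ^ z * P * length G) ∎)

      stage-invariant : ∀ {c′ j k z G} → Invariant Z Ok c′ (suc j) (suc k) z G →
        (∀ {v} → v ∈ˡ rejected (stage z G) Z → v ∈ˡ As) →
        Invariant Z Ok c′ j k (3 + k + z) (result (stage z G) Z)
      stage-invariant {c′} {j} {k} {z} {G} I vs⊆ = record
        { stages      = suc-injective stages
        ; loss≤       = ≤-trans (≤-reflexive (arrange k z (loss k))) loss≤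
        ; codeg≤      = λ L a → ≤-trans (stage-ratio few L a)
                          (≤-reflexive (cong (_* length (result (stage z G) Z)) (factor L)))
        ; size≤       = stage-size
        ; nonempty    = stage-nonempty few nonempty
        ; independent = λ d∈ d⊑ → case-edge d∈ (λ u u∈ u∈Z d∈G u∈d → λ { refl → independent d∈G (delete-⊑ u u∈Z d⊑) })
        ; ok          = λ d∈ → case-edge d∈ (λ u u∈ u∈Z d∈G u∈d → λ { refl → Ok-delete u∈ u∈d (ok d∈G) })
        }
        where
        open Invariant I
        open StageBounds cands adm? (x z) y N b G Z k 0<b b≤N y>0 ∅-not-adm codeg≤ (shift z) size≤
               hs hs⊆ ∣hs∣≤ (λ d∈ → Ok-hit (ok d∈) (independent d∈))
        open Stage cands adm? (x z) y N b (length G) using (loop-run; run-edges)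
        few = few-hit I (rejected (stage z G) Z) vs⊆
        arrange : ∀ k z l → 3 + k + z + 1 + l ≡ z + 1 + (3 + k + l)
        arrange = solve-∀
        factor : ∀ L → 2 ^ (3 + k) * x z L ≡ x (3 + k + z) L
        factor (L₀ , L₁) = trans (sym (*-assoc (2 ^ (3 + k)) (2 ^ z) _))
          (cong (_* (P * X ∣ L₀ ∣ ∣ L₁ ∣)) (sym (^-distribˡ-+-* 2 (3 + k) z)))
        case-edge : ∀ {A : Set} {d′} → d′ ∈ˡ result (stage z G) Z →
          (∀ u {d} → u ∈ˡ cands → u ∈ᵥ Z → d ∈ˡ G → u ∈ᵥ d → d′ ≡ delete u d → A) → A
        case-edge d′∈ f with run-edges (proj₂ (loop-run Z (length G) b G [] ≤-refl)) d′∈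
        ... | inj₂ (u , d , u∈ , u∈Z , d∈G , u∈d , eq) = f u u∈ u∈Z d∈G u∈d eq

      phase-invariant : ∀ {c′} j {k z G} → Invariant Z Ok c′ j k z G →
        (∀ {v} → v ∈ˡ rejected (phase j (k , z , G)) Z → v ∈ˡ As) →
        let (k′ , z′ , G′) = result (phase j (k , z , G)) Z in Invariant Z Ok c′ 0 k′ z′ G′
      phase-invariant zero    I _ = I
      phase-invariant (suc j) {zero} I _ with () ← Invariant.stages I
      phase-invariant {c′} (suc j) {suc k} {z} {G} I vs⊆ =
        subst (λ s → Invariant Z Ok c′ 0 (proj₁ s) (proj₁ (proj₂ s)) (proj₂ (proj₂ s)))
          (sym (result->>= (λ F → phase j (k , 3 + k + z , F)) (stage z G) Z))
          (phase-invariant j (stage-invariant I (λ v∈ → vs⊆ (rej (∈-++⁺ˡ v∈))))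
            (λ v∈ → vs⊆ (rej (∈-++⁺ʳ (rejected (stage z G) Z) v∈))))
        where
        rej : ∀ {v} → v ∈ˡ rejected (stage z G) Z ++ rejected (phase j (k , 3 + k + z , result (stage z G) Z)) Z →
              v ∈ˡ rejected (phase (suc j) (suc k , z , G)) Z
        rej = subst (_ ∈ˡ_) (sym (rejected->>= _ (stage z G) Z))

    stage-rejected-∈ : ∀ Z z G {v} → v ∈ˡ rejected (stage z G) Z → v ∈ˡ cands
    stage-rejected-∈ Z z G = run-rejected (proj₂ (loop-run Z (length G) b G [] ≤-refl))
      where open Stage cands adm? (x z) y N b (length G)

    phase-rejected-∈ : ∀ j s Z {v} → v ∈ˡ rejected (phase j s) Z → v ∈ˡ cands
    phase-rejected-∈ (suc j) (suc k , z , G) Z v∈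
      with ∈-++⁻ (rejected (stage z G) Z) (subst (_ ∈ˡ_) (rejected->>= _ (stage z G) Z) v∈)
    ... | inj₁ v∈₁ = stage-rejected-∈ Z z G v∈₁
    ... | inj₂ v∈₂ = phase-rejected-∈ j _ Z v∈₂

  -- The phases in `V₁` and in `V₀`

  cands₀ cands₁ : List V
  cands₀ = map inj₁ (allFin n₀)
  cands₁ = map inj₂ (allFin n₁)

  ∈-cands₀⁻ : ∀ {v} → v ∈ˡ cands₀ → ∃[ u ] v ≡ inj₁ u
  ∈-cands₀⁻ v∈ = let (u , _ , eq) = ∈-map⁻ inj₁ v∈ in u , eq

  ∈-cands₁⁻ : ∀ {v} → v ∈ˡ cands₁ → ∃[ u ] v ≡ inj₂ u
  ∈-cands₁⁻ v∈ = let (u , _ , eq) = ∈-map⁻ inj₂ v∈ in u , eq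

  map-inj₁⊆cands₀ : ∀ us {v} → v ∈ˡ map inj₁ us → v ∈ˡ cands₀
  map-inj₁⊆cands₀ us v∈ with u , _ , refl ← ∈-map⁻ inj₁ v∈ = ∈-map⁺ inj₁ (∈-allFin u)

  map-inj₂⊆cands₁ : ∀ us {v} → v ∈ˡ map inj₂ us → v ∈ˡ cands₁
  map-inj₂⊆cands₁ us v∈ with u , _ , refl ← ∈-map⁻ inj₂ v∈ = ∈-map⁺ inj₂ (∈-allFin u)

  -- Vertices of `V₁` add nothing to `S₀`, so the bound on `S₀` counts only the stages of the second
  -- phase.
  collect-++-proj₁ : ∀ {us} vs → (∀ {v} → v ∈ˡ us → v ∈ˡ cands₁) →
                     proj₁ (collect (us ++ vs)) ≡ proj₁ (collect vs)
  collect-++-proj₁ {[]}     vs _ = refl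
  collect-++-proj₁ {v ∷ us} vs h with u , refl ← ∈-cands₁⁻ (h (here refl)) = collect-++-proj₁ vs (h ∘ there)

  ∣collect-proj₁∣ : ∀ (vs : List V) → ∣ proj₁ (collect vs) ∣ ≤ length vs
  ∣collect-proj₁∣ []            = ≤-reflexive (∣⊥∣≡0 n₀)
  ∣collect-proj₁∣ (inj₁ u ∷ vs) = ≤-trans (∣insert∣≤ (proj₁ (collect vs)) u) (s≤s (∣collect-proj₁∣ vs))
  ∣collect-proj₁∣ (inj₂ u ∷ vs) = m≤n⇒m≤1+n (∣collect-proj₁∣ vs)

  ∣collect-++-proj₂∣ : ∀ us {vs} → (∀ {v} → v ∈ˡ vs → v ∈ˡ cands₀) →
                       ∣ proj₂ (collect (us ++ vs)) ∣ ≤ length us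
  ∣collect-++-proj₂∣ []            {[]}     _ = ≤-reflexive (∣⊥∣≡0 n₁)
  ∣collect-++-proj₂∣ []            {v ∷ vs} h with u , refl ← ∈-cands₀⁻ (h (here refl)) =
    ∣collect-++-proj₂∣ [] {vs} (h ∘ there)
  ∣collect-++-proj₂∣ (inj₁ u ∷ us) h = m≤n⇒m≤1+n (∣collect-++-proj₂∣ us h)
  ∣collect-++-proj₂∣ (inj₂ u ∷ us) {vs} h =
    ≤-trans (∣insert∣≤ (proj₂ (collect (us ++ vs))) u) (s≤s (∣collect-++-proj₂∣ us h))

  -- The second phase ignores pairs that miss `V₀`: inserting a first vertex of `V₀` into such a
  -- pair would bring in the factor `m / q`, and the weights would not scale by `b / m`.
  adm₀ adm₁ : E′ → Set
  adm₀ L = 0 < ∣ proj₁ L ∣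
  adm₁ L = 0 < size L

  module Phase₀ = Phase cands₀ {adm₀} (λ L → 0 <? ∣ proj₁ L ∣) m
  module Phase₁ = Phase cands₁ {adm₁} (λ L → 0 <? size L) n₁

  private
    scale-x : ∀ b p c a d → p * (c * (b * a * d)) ≡ b * (p * (c * (a * d)))
    scale-x = solve-∀

    X-suc₁ : ∀ ℓ₀ ℓ₁ → 0 < ℓ₀ + ℓ₁ → X ℓ₀ (suc ℓ₁) ≡ b * b ^ (ℓ₀ + ℓ₁ ∸ 1) * m ^ 𝟙[0< ℓ₀ ]
    X-suc₁ ℓ₀ ℓ₁ 0<ℓ = cong (_* m ^ 𝟙[0< ℓ₀ ]) (cong (b ^_)
      (trans (cong (_∸ 1) (+-suc ℓ₀ ℓ₁)) (sym (m+[n∸m]≡n 0<ℓ))))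

  -- Admissibility matters through the truncated exponent `ℓ₀ + ℓ₁ ∸ 1` of `b`, which grows with
  -- `ℓ₁` only if `ℓ₀ + ℓ₁` is positive.
  shift₁ : ∀ z {u L} → u ∈ˡ cands₁ → u ∉ᵥ L → adm₁ L →
           adm₁ (insert u L) × y (insert u L) ≡ n₁ * y L × x z (insert u L) ≡ b * x z L
  shift₁ z {L = L₀ , L₁} u∈ u∉ a with u , refl ← ∈-cands₁⁻ u∈ rewrite ∣insert∣ L₁ u u∉ =
    <-≤-trans a (+-monoʳ-≤ ∣ L₀ ∣ (n≤1+n _)) ,
    arrange (m ^ ∣ L₀ ∣) n₁ (n₁ ^ ∣ L₁ ∣) (q ^ 𝟙[0< ∣ L₀ ∣ ]) Q ,
    trans (cong (λ t → 2 ^ z * (P * t)) (X-suc₁ ∣ L₀ ∣ ∣ L₁ ∣ a))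
      (scale-x b (2 ^ z) P (b ^ (∣ L₀ ∣ + ∣ L₁ ∣ ∸ 1)) (m ^ 𝟙[0< ∣ L₀ ∣ ]))
    where
    arrange : ∀ a n c d e → a * (n * c) * d * e ≡ n * (a * c * d * e)
    arrange = solve-∀

  shift₀ : ∀ z {u L} → u ∈ˡ cands₀ → u ∉ᵥ L → adm₀ L →
           adm₀ (insert u L) × y (insert u L) ≡ m * y L × x z (insert u L) ≡ b * x z L
  shift₀ z {L = L₀ , L₁} u∈ u∉ a with u , refl ← ∈-cands₀⁻ u∈ rewrite ∣insert∣ L₀ u u∉ with ∣ L₀ ∣
  ... | suc ℓ = z<s , arrange m (m * m ^ ℓ) (n₁ ^ ∣ L₁ ∣) (q ^ 1) Q ,
                scale-x b (2 ^ z) P (b ^ (ℓ + ∣ L₁ ∣)) (m ^ 1)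
    where
    arrange : ∀ n a c d e → n * a * c * d * e ≡ n * (a * c * d * e)
    arrange = solve-∀

  singleton₁ : ∀ z {v} → v ∈ˡ cands₁ →
    adm₁ (insert v ∅) × y (insert v ∅) ≡ 1 * (n₁ * Q) × x z (insert v ∅) ≡ 1 * (2 ^ z * P)
  singleton₁ z v∈ with u , refl ← ∈-cands₁⁻ v∈
    rewrite ∣insert∣ ⊥ u ∉⊥ | ∣⊥∣≡0 n₀ | ∣⊥∣≡0 n₁ = z<s , arrange₁ n₁ Q , arrange₂ (2 ^ z) P
    where
    arrange₁ : ∀ n q → 1 * (n * 1) * 1 * q ≡ 1 * (n * q)
    arrange₁ = solve-∀
    arrange₂ : ∀ t p → t * (p * (1 * 1)) ≡ 1 * (t * p)
    arrange₂ = solve-∀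

  -- The factor `m` from `m / q` is matched by the `m` in the denominator, so `q` takes the place
  -- that `n₁` has in the first phase. This is why the size of `A` is compared with `q`.
  singleton₀ : ∀ z {v} → v ∈ˡ cands₀ →
    adm₀ (insert v ∅) × y (insert v ∅) ≡ m * (q * Q) × x z (insert v ∅) ≡ m * (2 ^ z * P)
  singleton₀ z v∈ with u , refl ← ∈-cands₀⁻ v∈
    rewrite ∣insert∣ ⊥ u ∉⊥ | ∣⊥∣≡0 n₀ | ∣⊥∣≡0 n₁ = z<s , arrange₁ m q Q , arrange₂ (2 ^ z) P m
    where
    arrange₁ : ∀ m q r → m * 1 * 1 * (q * 1) * r ≡ m * (q * r)
    arrange₁ = solve-∀
    arrange₂ : ∀ t p m → t * (p * (1 * (m * 1))) ≡ m * (t * p)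
    arrange₂ = solve-∀

  -- The complete algorithm

  module Main (r₀ i k z : ℕ) (G₀ : List E′) where

    Large₀ Large₁ : List V → Set
    Large₀ vs = q * Q ≤ 2 ^ K * P * ∣ proj₁ (collect vs) ∣
    Large₁ vs = n₁ * Q ≤ 2 ^ K * P * ∣ proj₂ (collect vs) ∣

    large₀? : ∀ vs → Dec (Large₀ vs)
    large₀? vs = q * Q ≤? 2 ^ K * P * ∣ proj₁ (collect vs) ∣
    large₁? : ∀ vs → Dec (Large₁ vs)
    large₁? vs = n₁ * Q ≤? 2 ^ K * P * ∣ proj₂ (collect vs) ∣

    tree₁ : Tree State
    tree₁ = Phase₁.phase i (k , z , G₀)

    -- Stopping in the first case ensures that `S₀` is nonempty only if the second phase was
    -- started, and then `A` has to be large.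
    continue : List V × State → Tree State
    continue (vs , s) with large₁? vs
    ... | yes _ = leaf s
    ... | no  _ = Phase₀.phase r₀ s

    tree : Tree State
    tree = withRejected tree₁ >>= continue

    Ok₀ Ok₁ : ℕ → E′ → Set
    Ok₀ j d = ∣ proj₂ d ∣ ≡ 0 × ∣ proj₁ d ∣ ≤ j
    Ok₁ j d = ∣ proj₂ d ∣ ≡ j × ∣ proj₁ d ∣ ≤ r₀

    module _ (Z : E′) where

      s₁ : State
      s₁ = result tree₁ Z

      vs₁ vs₀ us₁ us₀ : List V
      vs₁ = rejected tree₁ Z
      us₁ = accepted tree₁ Z
      vs₀ = rejected (continue (vs₁ , s₁)) Z
      us₀ = accepted (continue (vs₁ , s₁)) Z

      rejected-tree : rejected tree Z ≡ vs₁ ++ vs₀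
      rejected-tree = trans (rejected->>= continue (withRejected tree₁) Z)
        (cong₂ _++_ (rejected-withRejected tree₁ Z) (cong (λ s → rejected (continue s) Z) (result-withRejected tree₁ Z)))

      accepted-tree : accepted tree Z ≡ us₁ ++ us₀
      accepted-tree = trans (accepted->>= continue (withRejected tree₁) Z)
        (cong₂ _++_ (accepted-withRejected tree₁ Z) (cong (λ s → accepted (continue s) Z) (result-withRejected tree₁ Z)))

      us₁-∈ : ∀ {v} → v ∈ˡ us₁ → v ∈ˡ cands₁
      us₁-∈ = Phase₁.phase-accepted-∈ i (k , z , G₀) Z

      us₀-∈ : ∀ {v} → v ∈ˡ us₀ → v ∈ˡ cands₀
      us₀-∈ v∈ with large₁? vs₁
      ... | no _ = Phase₀.phase-accepted-∈ r₀ s₁ Z v∈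

      us₀-length : length us₀ ≤ r₀ * b
      us₀-length with large₁? vs₁
      ... | yes _ = z≤n
      ... | no  _ = Phase₀.phase-accepted r₀ s₁ Z

      fingerprint-bound₀ : ∣ proj₁ (fingerprint tree Z) ∣ ≤ r₀ * b
      fingerprint-bound₀ = begin
        ∣ proj₁ (collect (accepted tree Z)) ∣  ≡⟨ cong (λ us → ∣ proj₁ (collect us) ∣) accepted-tree ⟩
        ∣ proj₁ (collect (us₁ ++ us₀)) ∣       ≡⟨ cong ∣_∣ (collect-++-proj₁ us₀ us₁-∈) ⟩
        ∣ proj₁ (collect us₀) ∣                ≤⟨ ∣collect-proj₁∣ us₀ ⟩
        length us₀                             ≤⟨ us₀-length ⟩
        r₀ * b                                 ∎
        where open ≤-Reasoning

      fingerprint-bound₁ : ∣ proj₂ (fingerprint tree Z) ∣ ≤ i * b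
      fingerprint-bound₁ = begin
        ∣ proj₂ (collect (accepted tree Z)) ∣  ≡⟨ cong (λ us → ∣ proj₂ (collect us) ∣) accepted-tree ⟩
        ∣ proj₂ (collect (us₁ ++ us₀)) ∣       ≤⟨ ∣collect-++-proj₂∣ us₁ us₀-∈ ⟩
        length us₁                             ≤⟨ Phase₁.phase-accepted i (k , z , G₀) Z ⟩
        i * b                                  ∎
        where open ≤-Reasoning

      module _ (i+r₀≤k : i + r₀ ≤ k) (loss≤ : z + 1 + loss k ≤ K + 3)
               (codeg≤ : ∀ L → 0 < size L → codeg L G₀ * y L ≤ x z L * length G₀)
               (size≤ : ∀ {d} → d ∈ˡ G₀ → size d ≤ k) (nonempty : 0 < length G₀)
               (ok : ∀ {d} → d ∈ˡ G₀ → Ok₁ i d)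
               (independent : ∀ {d} → d ∈ˡ G₀ → ¬ (d ⊑ Z)) (∣∁Z∣≤m : ∣ ∁ (proj₁ Z) ∣ ≤ m) where

        invariant₁ : ¬ Large₁ vs₁ → Phase₁.Invariant Z Ok₁ (k ∸ i) 0 (proj₁ s₁) (proj₁ (proj₂ s₁)) (proj₂ (proj₂ s₁))
        invariant₁ ¬large = phase-invariant i (record
          { stages = sym (m+[n∸m]≡n (≤-trans (m≤m+n i r₀) i+r₀≤k)) ; loss≤ = loss≤ ; codeg≤ = codeg≤
          ; size≤ = size≤ ; nonempty = nonempty ; independent = independent ; ok = ok })
          As-complete
          where
          As : List V
          -- Different stages may reject the same vertex; going through the set removes repetitions,
          -- so the length is the cardinality tested by `Large₁`.
          As = map inj₂ (elements (proj₂ (collect vs₁)))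
          As-complete : ∀ {v} → v ∈ˡ vs₁ → v ∈ˡ As
          As-complete v∈ with u , refl ← ∈-cands₁⁻ (Phase₁.phase-rejected-∈ i (k , z , G₀) Z v∈) =
            ∈-map⁺ inj₂ (∈-elements (∈-collect⁺ v∈))
          As-few : length As * (2 ^ K * P) < n₁ * Q
          As-few = ≤-<-trans (≤-reflexive (trans (*-comm (length As) _) (cong (2 ^ K * P *_)
            (trans (List.length-map inj₂ (elements (proj₂ (collect vs₁)))) (length-elements (proj₂ (collect vs₁)))))))
            (≰⇒> ¬large)
          delete-ok : ∀ {j u d} → u ∈ˡ cands₁ → u ∈ᵥ d → Ok₁ (suc j) d → Ok₁ j (delete u d)
          delete-ok u∈ u∈d (eq , d₀≤) with u , refl ← ∈-cands₁⁻ u∈ = suc-injective (trans (∣delete∣ u∈d) eq) , d₀≤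
          hit-ok : ∀ {j d} → Ok₁ (suc j) d → ¬ (d ⊑ Z) → Any (_∈ᵥ d) cands₁
          hit-ok {d = d} (eq , _) _ with u , u∈ ← ∣p∣>0⇒∃ (proj₂ d) (subst (0 <_) (sym eq) z<s) =
            lose (∈-map⁺ inj₂ (∈-allFin u)) u∈
          open Phase₁.Analysis Z n₁ 1 (<-≤-trans 0<b b≤n₁) z<s b≤n₁
            (λ h → <⇒≢ h (sym (cong₂ _+_ (∣⊥∣≡0 n₀) (∣⊥∣≡0 n₁)))) shift₁ singleton₁ cands₁ id
            (≤-reflexive (trans (List.length-map inj₂ (allFin n₁)) (List.length-tabulate id)))
            Ok₁ delete-ok hit-ok As
            (map-inj₂⊆cands₁ (elements (proj₂ (collect vs₁)))) As-few

        rejected-large : ¬ Large₁ vs₁ → Large₀ (vs₁ ++ vs₀)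
        rejected-large ¬large₁ with large₀? (vs₁ ++ vs₀)
        ... | yes s₀ = s₀
        ... | no ¬s₀ = contradiction (phase-invariant r₀ {proj₁ s₁} {proj₁ (proj₂ s₁)} {proj₂ (proj₂ s₁)} (record
          { stages = trans (Phase₁.Invariant.stages I) (sym (m+[n∸m]≡n (m+n≤o⇒m≤o∸n r₀ (subst (_≤ k) (+-comm i r₀) i+r₀≤k))))
          ; loss≤ = Phase₁.Invariant.loss≤ I
          ; codeg≤ = λ L a → Phase₁.Invariant.codeg≤ I L (<-≤-trans a (m≤m+n _ _))
          ; size≤ = Phase₁.Invariant.size≤ I ; nonempty = Phase₁.Invariant.nonempty I
          ; independent = Phase₁.Invariant.independent I ; ok = Phase₁.Invariant.ok I }) As-complete) no-invariant
          where
          I = invariant₁ ¬large₁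
          A : Subset n₀
          A = proj₁ (collect (vs₁ ++ vs₀))
          As : List V
          As = map inj₁ (elements A)
          vs₀′ : rejected (Phase₀.phase r₀ s₁) Z ≡ vs₀
          vs₀′ with large₁? vs₁
          ... | yes s = contradiction s ¬large₁
          ... | no _  = refl
          As-complete : ∀ {v} → v ∈ˡ rejected (Phase₀.phase r₀ s₁) Z → v ∈ˡ As
          As-complete v∈ with u , refl ← ∈-cands₀⁻ (Phase₀.phase-rejected-∈ r₀ s₁ Z v∈) =
            ∈-map⁺ inj₁ (∈-elements (∈-collect⁺ {vs = vs₁ ++ vs₀} (∈-++⁺ʳ vs₁ (subst (_ ∈ˡ_) vs₀′ v∈))))
          As-few : length As * (2 ^ K * P) < q * Q
          As-few = ≤-<-trans (≤-reflexive (trans (*-comm (length As) _) (cong (2 ^ K * P *_)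
            (trans (List.length-map inj₁ (elements A)) (length-elements A))))) (≰⇒> ¬s₀)
          delete-ok : ∀ {j u d} → u ∈ˡ cands₀ → u ∈ᵥ d → Ok₀ (suc j) d → Ok₀ j (delete u d)
          delete-ok u∈ u∈d (eq , d₀≤) with u , refl ← ∈-cands₀⁻ u∈ =
            eq , s≤s⁻¹ (≤-trans (≤-reflexive (∣delete∣ u∈d)) d₀≤)
          hs : List V
          hs = map inj₁ (elements (∁ (proj₁ Z)))
          -- With no vertex in `V₁`, an edge outside `Z` has a vertex in the complement of
          -- `proj₁ Z`, that is, in `I`.
          hit-ok : ∀ {j d} → Ok₀ j d → ¬ (d ⊑ Z) → Any (_∈ᵥ d) hs
          hit-ok {d = d} (eq , _) ¬d⊑Z with any? (_∈ᵥ? d) hs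
          ... | yes h = h
          ... | no ¬h = ⊥-elim (¬d⊑Z
            ( (λ {u} u∈ → decidable-stable (u ∈? proj₁ Z) (λ u∉ →
                ¬h (lose (∈-map⁺ inj₁ (∈-elements (x∉p⇒x∈∁p u∉))) u∈)))
            , (λ u∈ → contradiction u∈ (∣p∣≡0⇒∉ eq)) ))
          no-invariant : ∀ {c k z G} → ¬ Phase₀.Invariant Z Ok₀ c 0 k z G
          no-invariant {G = []}    J = n≮0 (Phase₀.Invariant.nonempty J)
          no-invariant {G = d ∷ G} J with eq , d₀≤0 ← Phase₀.Invariant.ok J (here refl) =
            Phase₀.Invariant.independent J (here refl)
              ((λ u∈ → contradiction u∈ (∣p∣≡0⇒∉ (n≤0⇒n≡0 d₀≤0))) , (λ u∈ → contradiction u∈ (∣p∣≡0⇒∉ eq)))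
          open Phase₀.Analysis Z q m 0<q (<-≤-trans 0<b b≤m) b≤m
            (λ h → <⇒≢ h (sym (∣⊥∣≡0 n₀))) shift₀ singleton₀ hs
            (map-inj₁⊆cands₀ (elements (∁ (proj₁ Z))))
            (≤-trans (≤-reflexive (trans (List.length-map inj₁ (elements (∁ (proj₁ Z)))) (length-elements (∁ (proj₁ Z))))) ∣∁Z∣≤m)
            Ok₀ delete-ok hit-ok As
            (map-inj₁⊆cands₀ (elements A)) As-few

        container : Large₀ (rejected tree Z) ⊎ Large₁ (rejected tree Z) × ∣ proj₁ (fingerprint tree Z) ∣ ≡ 0
        container = subst₂ (λ vs us → Large₀ vs ⊎ Large₁ vs × ∣ proj₁ (collect us) ∣ ≡ 0)
          (sym rejected-tree) (sym accepted-tree) dichotomy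
          where
          dichotomy : Large₀ (vs₁ ++ vs₀) ⊎ Large₁ (vs₁ ++ vs₀) × ∣ proj₁ (collect (us₁ ++ us₀)) ∣ ≡ 0
          dichotomy with large₁? vs₁ in eq
          ... | yes s = inj₂ (subst Large₁ (sym (List.++-identityʳ vs₁)) s ,
                          trans (cong ∣_∣ (collect-++-proj₁ [] us₁-∈)) (∣⊥∣≡0 n₀))
          ... | no ¬s = inj₁ (subst (λ vs → Large₀ (vs₁ ++ vs)) (vs₀-no eq) (rejected-large ¬s))
            where
            vs₀-no : ∀ {¬s} → large₁? vs₁ ≡ no ¬s → vs₀ ≡ rejected (Phase₀.phase r₀ s₁) Z
            vs₀-no eq rewrite eq = refl

-- Real numbers

÷-* : ∀ a b c d .{{_ : NonZero b}} .{{_ : NonZero d}} → (a ÷ b) ℚ.* (c ÷ d) ≡ (a * c) ÷ (b * d)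
÷-* a (suc b) c (suc d) = ℚ.toℚᵘ-injective (begin-equality
  toℚᵘ ((a ÷ suc b) ℚ.* (c ÷ suc d))
    ≃⟨ ℚ.toℚᵘ-homo-* (a ÷ suc b) (c ÷ suc d) ⟩
  toℚᵘ (a ÷ suc b) ℚᵘ.* toℚᵘ (c ÷ suc d)
    ≃⟨ ℚᵘ.*-cong (ℚ.toℚᵘ-fromℚᵘ (mkℚᵘ (ℤ.+ a) b)) (ℚ.toℚᵘ-fromℚᵘ (mkℚᵘ (ℤ.+ c) d)) ⟩
  mkℚᵘ (ℤ.+ a) b ℚᵘ.* mkℚᵘ (ℤ.+ c) d
    ≡⟨ cong (λ t → t ℚᵘ./ (suc b * suc d)) (sym (ℤ.pos-* a c)) ⟩
  mkℚᵘ (ℤ.+ (a * c)) (d + b * suc d)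
    ≃⟨ ℚᵘ.≃-sym (ℚ.toℚᵘ-fromℚᵘ (mkℚᵘ (ℤ.+ (a * c)) (d + b * suc d))) ⟩
  toℚᵘ ((a * c) ÷ (suc b * suc d)) ∎)
  where open ℚᵘ.≤-Reasoning

÷-≤ : ∀ a b c d .{{_ : NonZero b}} .{{_ : NonZero d}} → a * d ≤ c * b → a ÷ b ℚ.≤ c ÷ d
÷-≤ a (suc b) c (suc d) ad≤cb = ℚ.toℚᵘ-cancel-≤ (begin
  toℚᵘ (a ÷ suc b)  ≃⟨ ℚ.toℚᵘ-fromℚᵘ (mkℚᵘ (ℤ.+ a) b) ⟩
  mkℚᵘ (ℤ.+ a) b          ≤⟨ *≤* (subst₂ ℤ._≤_ (ℤ.pos-* a (suc d)) (ℤ.pos-* c (suc b)) (ℤ.+≤+ ad≤cb)) ⟩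
  mkℚᵘ (ℤ.+ c) d          ≃⟨ ℚᵘ.≃-sym (ℚ.toℚᵘ-fromℚᵘ (mkℚᵘ (ℤ.+ c) d)) ⟩
  toℚᵘ (c ÷ suc d)  ∎)
  where open ℚᵘ.≤-Reasoning

÷1-+ : ∀ a b → (a ÷ 1) ℚ.+ (b ÷ 1) ≡ (a + b) ÷ 1
÷1-+ a b = ℚ.toℚᵘ-injective (begin-equality
  toℚᵘ ((a ÷ 1) ℚ.+ (b ÷ 1))        ≃⟨ ℚ.toℚᵘ-homo-+ (a ÷ 1) (b ÷ 1) ⟩
  toℚᵘ (a ÷ 1) ℚᵘ.+ toℚᵘ (b ÷ 1)    ≃⟨ ℚᵘ.+-cong (ℚ.toℚᵘ-fromℚᵘ (mkℚᵘ (ℤ.+ a) 0)) (ℚ.toℚᵘ-fromℚᵘ (mkℚᵘ (ℤ.+ b) 0)) ⟩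
  mkℚᵘ (ℤ.+ a) 0 ℚᵘ.+ mkℚᵘ (ℤ.+ b) 0    ≡⟨ cong₂ (λ s t → (s ℤ.+ t) ℚᵘ./ 1) (ℤ.*-identityʳ (ℤ.+ a)) (ℤ.*-identityʳ (ℤ.+ b)) ⟩
  mkℚᵘ (ℤ.+ (a + b)) 0                ≃⟨ ℚᵘ.≃-sym (ℚ.toℚᵘ-fromℚᵘ (mkℚᵘ (ℤ.+ (a + b)) 0)) ⟩
  toℚᵘ ((a + b) ÷ 1)                ∎)
  where open ℚᵘ.≤-Reasoning

÷-pos : ∀ a b .{{_ : NonZero a}} .{{_ : NonZero b}} → 0ℚ ℚ.< a ÷ b
÷-pos (suc a) (suc b) = ℚ.positive⁻¹ (suc a ÷ suc b) {{ℚ.normalize-pos (suc a) (suc b)}}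

÷-nonNeg : ∀ a b → 0ℚ ℚ.≤ a ÷ suc b
÷-nonNeg a b = ℚ.nonNegative⁻¹ (a ÷ suc b) {{ℚ.normalize-nonNeg a (suc b)}}

module _ (R : ℝ) (R>0 : 0ᴿ <ᴿ R) where

  private
    c₀ = proj₁ R>0
    0<c₀ = proj₁ (proj₂ R>0)
    N₀ = proj₁ (proj₂ (proj₂ R>0))
    t : ℕ → ℚ
    t i = seq R (N₀ + i)
    c₀≤t : ∀ i → c₀ ℚ.≤ t i
    c₀≤t i = subst (ℚ._≤ t i) (ℚ.+-identityˡ c₀) (proj₂ (proj₂ (proj₂ R>0)) (N₀ + i) (m≤m+n N₀ i))
    0<t : ∀ i → 0ℚ ℚ.< t i
    0<t i = ℚ.<-≤-trans 0<c₀ (c₀≤t i)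

  inv-inverse : ∀ i → seq (inv R R>0) i ℚ.* t i ≡ 1ℚ
  inv-inverse i = ℚ.*-inverseˡ (t i) {{ℚ.>-nonZero (0<t i)}}

  inv-pos : ∀ i → 0ℚ ℚ.< seq (inv R R>0) i
  inv-pos i = ℚ.positive⁻¹ (seq (inv R R>0) i) {{ℚ.1/pos⇒pos (t i) {{ℚ.positive (0<t i)}}}}

  -- Multiply `w * c ≤ M * a ≤ M * R * c` by the inverse of `R` and cancel `c`. Since `inv` drops
  -- the first `N₀` terms of `R`, its `i`-th term is matched with `t i`.
  inv-bound : ∀ {a c w M} → fromℚ a ≤ᴿ R *ᴿ fromℚ c → 0ℚ ℚ.< c → 0ℚ ℚ.≤ M →
    w ℚ.* c ℚ.≤ M ℚ.* a → ∀ ε → 0ℚ ℚ.< ε →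
    ∃[ N ] (∀ i → N ≤ i → seq (inv R R>0) i ℚ.* w ℚ.≤ M ℚ.+ ε)
  inv-bound {a} {c} {w} {M} a≤Rc 0<c 0≤M wc≤Ma ε 0<ε = proj₁ near , λ i N≤i → bound i (proj₂ near (N₀ + i) (≤-trans N≤i (m≤n+m i N₀)))
    where
    -- `M` may be 0, and a positive divisor is needed for `η`.
    M+1 : ℚ
    M+1 = M ℚ.+ 1ℚ
    0<M+1 : 0ℚ ℚ.< M+1
    0<M+1 = ℚ.+-mono-≤-< 0≤M (ℚ.positive⁻¹ 1ℚ)
    instance
      _ = ℚ.>-nonZero 0<M+1
      _ = ℚ.positive 0<M+1
      _ = ℚ.positive 0<c
      _ = ℚ.positive 0<ε
      _ = ℚ.positive 0<c₀
      _ = ℚ.nonNegative 0≤M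
    cc₀ε : ℚ
    cc₀ε = c ℚ.* c₀ ℚ.* ε
    instance
      cc₀-pos : ℚ.Positive (c ℚ.* c₀)
      cc₀-pos = ℚ.pos*pos⇒pos c c₀
      cc₀ε-pos : ℚ.Positive cc₀ε
      cc₀ε-pos = ℚ.pos*pos⇒pos (c ℚ.* c₀) ε
      inv-M+1-pos : ℚ.Positive (ℚ.1/ M+1)
      inv-M+1-pos = ℚ.1/pos⇒pos M+1
    -- The error `M * η` has to be at most `ε * t i * c`; the lower bound `c₀` of `t i` makes the
    -- choice independent of `i`.
    η : ℚ
    η = (ℚ.1/ M+1) ℚ.* cc₀ε
    0<η : 0ℚ ℚ.< η
    0<η = ℚ.positive⁻¹ η {{ℚ.pos*pos⇒pos (ℚ.1/ M+1) cc₀ε}}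
    Mη≤ : M ℚ.* η ℚ.≤ cc₀ε
    Mη≤ = ℚ.≤-trans
      (ℚ.*-monoʳ-≤-nonNeg η {{ℚ.nonNegative (ℚ.<⇒≤ 0<η)}}
        (subst (ℚ._≤ M+1) (ℚ.+-identityʳ M) (ℚ.+-monoʳ-≤ M (ℚ.<⇒≤ (ℚ.positive⁻¹ 1ℚ)))))
      (ℚ.≤-reflexive (trans (sym (ℚ.*-assoc M+1 (ℚ.1/ M+1) cc₀ε))
        (trans (cong (ℚ._* cc₀ε) (ℚ.*-inverseʳ M+1)) (ℚ.*-identityˡ cc₀ε))))
    near = a≤Rc η 0<η
    open +-*-Solver using (solve; _:+_; _:*_; _:=_)
    bound : ∀ i → a ℚ.≤ t i ℚ.* c ℚ.+ η → seq (inv R R>0) i ℚ.* w ℚ.≤ M ℚ.+ ε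
    bound i a≤ = begin
      s ℚ.* w                          ≤⟨ ℚ.*-monoˡ-≤-nonNeg s {{ℚ.nonNegative (ℚ.<⇒≤ (inv-pos i))}} w≤ ⟩
      s ℚ.* ((M ℚ.+ ε) ℚ.* t i)        ≡⟨ solve 3 (λ s t m → s :* (m :* t) := (s :* t) :* m) refl s (t i) (M ℚ.+ ε) ⟩
      (s ℚ.* t i) ℚ.* (M ℚ.+ ε)        ≡⟨ cong (ℚ._* (M ℚ.+ ε)) (inv-inverse i) ⟩
      1ℚ ℚ.* (M ℚ.+ ε)                 ≡⟨ ℚ.*-identityˡ (M ℚ.+ ε) ⟩
      M ℚ.+ ε                          ∎
      where
      open ℚ.≤-Reasoning
      s = seq (inv R R>0) i
      w≤ : w ℚ.≤ (M ℚ.+ ε) ℚ.* t i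
      w≤ = ℚ.*-cancelʳ-≤-pos c (begin
        w ℚ.* c                                    ≤⟨ wc≤Ma ⟩
        M ℚ.* a                                    ≤⟨ ℚ.*-monoˡ-≤-nonNeg M a≤ ⟩
        M ℚ.* (t i ℚ.* c ℚ.+ η)                    ≡⟨ ℚ.*-distribˡ-+ M (t i ℚ.* c) η ⟩
        M ℚ.* (t i ℚ.* c) ℚ.+ M ℚ.* η              ≤⟨ ℚ.+-monoʳ-≤ (M ℚ.* (t i ℚ.* c)) (ℚ.≤-trans Mη≤
                                                       (ℚ.*-monoʳ-≤-nonNeg ε {{ℚ.pos⇒nonNeg ε}}
                                                         (ℚ.*-monoˡ-≤-nonNeg c {{ℚ.pos⇒nonNeg c}} (c₀≤t i)))) ⟩
        M ℚ.* (t i ℚ.* c) ℚ.+ c ℚ.* t i ℚ.* ε      ≡⟨ solve 4 (λ m t c e → m :* (t :* c) :+ c :* t :* e := (m :+ e) :* t :* c)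
                                                       refl M (t i) c ε ⟩
        (M ℚ.+ ε) ℚ.* t i ℚ.* c                    ∎)

module _ (R : ℝ) (R>0 : 0ᴿ <ᴿ R) (K a X Y : ℕ) (0<X : 0 < X) (0<Y : 0 < Y)
         (a≤ : fromℕ a ≤ᴿ R *ᴿ fromℚ (X ÷ Y)) where

  private
    κ : ℚ
    κ = 1 ÷ (2 ^ K)
    s : ℕ → ℚ
    s = seq (inv R R>0)
    instance
      X≢0 : NonZero X
      X≢0 = >-nonZero 0<X
      Y≢0 : NonZero Y
      Y≢0 = >-nonZero 0<Y
      2^K≢0 : NonZero (2 ^ K)
      2^K≢0 = m^n≢0 2 K
    open +-*-Solver using (solve; _:+_; _:*_; _:-_; _:=_; con)
    rotate : ∀ k s t → k *ℚ s *ℚ t ≡ s *ℚ (k *ℚ t)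
    rotate = solve 3 (λ k s t → k :* s :* t := s :* (k :* t)) refl
    add-cancel : ∀ d c e → d ≡ d ℚ.+ c ℚ.+ e ℚ.- (c ℚ.+ e)
    add-cancel = solve 3 (λ d c e → d := d :+ c :+ e :- (c :+ e)) refl
    factor-out : ∀ t e w → t ℚ.+ e ℚ.- w *ℚ t ≡ (1ℚ ℚ.- w) *ℚ t ℚ.+ e
    factor-out = solve 3 (λ t e w → t :+ e :- w :* t := (con 1ℚ :- w) :* t :+ e) refl

  -- With `P = a * Y` and `Q = X`, the assumption is the integer test for largeness,
  -- `T * Q ≤ 2 ^ K * P * c`, and `a≤` says that `R` is at least `P / Q`. So passing the test with
  -- `P / Q` implies the inequality with `R`.
  δ-term-bound : ∀ T c → T * X ≤ 2 ^ K * (a * Y) * c → ∀ ε → 0ℚ ℚ.< ε →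
    ∃[ N ] (∀ i → N ≤ i → κ *ℚ s i *ℚ (T ÷ 1) ℚ.≤ (c ÷ 1) ℚ.+ ε)
  δ-term-bound T c TX≤ ε 0<ε =
    let (N , near) = inv-bound R R>0 {a ÷ 1} {X ÷ Y} {κ *ℚ (T ÷ 1)} {c ÷ 1} a≤ (÷-pos X Y) (÷-nonNeg c 0) wc≤ ε 0<ε in
    N , λ i N≤i → ℚ.≤-trans (ℚ.≤-reflexive (rotate κ (s i) (T ÷ 1))) (near i N≤i)
    where
    open ≤-Reasoning
    arrange₁ : ∀ t x → 1 * t * x * (1 * 1) ≡ t * x
    arrange₁ = solve-∀
    arrange₂ : ∀ p a y c → p * (a * y) * c ≡ c * a * (p * 1 * y)
    arrange₂ = solve-∀
    wc≤ : κ *ℚ (T ÷ 1) *ℚ (X ÷ Y) ℚ.≤ (c ÷ 1) *ℚ (a ÷ 1)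
    wc≤ = subst₂ ℚ._≤_
      (sym (trans (cong (_*ℚ (X ÷ Y)) (÷-* 1 (2 ^ K) T 1))
        (÷-* (1 * T) (2 ^ K * 1) X Y {{m*n≢0 (2 ^ K) 1}})))
      (sym (÷-* c 1 a 1))
      (÷-≤ (1 * T * X) (2 ^ K * 1 * Y) (c * a) (1 * 1) {{m*n≢0 (2 ^ K * 1) Y {{m*n≢0 (2 ^ K) 1}}}} (begin
        1 * T * X * (1 * 1)      ≡⟨ arrange₁ T X ⟩
        T * X                    ≤⟨ TX≤ ⟩
        2 ^ K * (a * Y) * c      ≡⟨ arrange₂ (2 ^ K) a Y c ⟩
        c * a * (2 ^ K * 1 * Y)  ∎))

  δ-lower : ∀ T c → T * X ≤ 2 ^ K * (a * Y) * c → (fromℚ κ *ᴿ inv R R>0) *ᴿ fromℕ T ≤ᴿ fromℕ c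
  δ-lower T c TX≤ ε 0<ε = δ-term-bound T c TX≤ ε 0<ε

  complement-bound : ∀ {d c t e w} → d ℚ.+ c ≡ t → w *ℚ t ℚ.≤ c ℚ.+ e → d ℚ.≤ (1ℚ ℚ.- w) *ℚ t ℚ.+ e
  complement-bound {d} {c} {t} {e} {w} d+c≡t wt≤ = begin
    d                                 ≡⟨ add-cancel d c e ⟩
    d ℚ.+ c ℚ.+ e ℚ.- (c ℚ.+ e)       ≤⟨ ℚ.+-monoʳ-≤ (d ℚ.+ c ℚ.+ e) (ℚ.neg-antimono-≤ wt≤) ⟩
    d ℚ.+ c ℚ.+ e ℚ.- w *ℚ t          ≡⟨ cong (λ u → u ℚ.+ e ℚ.- w *ℚ t) d+c≡t ⟩
    t ℚ.+ e ℚ.- w *ℚ t                ≡⟨ factor-out t e w ⟩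
    (1ℚ ℚ.- w) *ℚ t ℚ.+ e             ∎
    where open ℚ.≤-Reasoning

  δ-upper : ∀ T c d → T * X ≤ 2 ^ K * (a * Y) * c → d + c ≡ T →
            fromℕ d ≤ᴿ (1ᴿ -ᴿ (fromℚ κ *ᴿ inv R R>0)) *ᴿ fromℕ T
  δ-upper T c d TX≤ d+c≡T ε 0<ε =
    let (N , near) = δ-term-bound T c TX≤ ε 0<ε in
    N , λ i N≤i → complement-bound {d ÷ 1} {c ÷ 1} {T ÷ 1} {ε} {κ *ℚ s i}
      (trans (÷1-+ d c) (cong (_÷ 1) d+c≡T)) (near i N≤i)

-- Choosing the parameters

-- Ratios are compared by cross-multiplication; positive denominators make this transitive.
maximal-ratio : ∀ {A : Set} (num den : A → ℕ) → (∀ a → 0 < den a) → ∀ xs → 0 < length xs →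
  ∃[ a ] a ∈ˡ xs × (∀ {x} → x ∈ˡ xs → num x * den a ≤ num a * den x)
maximal-ratio num den den>0 (x ∷ [])          _ = x , here refl , λ { (here refl) → ≤-refl }
maximal-ratio num den den>0 (x ∷ xs@(_ ∷ _)) _ with a , a∈ , max ← maximal-ratio num den den>0 xs z<s
  with ≤-total (num x * den a) (num a * den x)
... | inj₁ x≤a = a , there a∈ , λ { (here refl) → x≤a ; (there w∈) → max w∈ }
... | inj₂ a≤x = x , here refl , λ { (here refl) → ≤-refl ; (there {_} w∈) → ratio-trans (max w∈) a≤x }
  where
  ratio-trans : ∀ {w} → num w * den a ≤ num a * den w → num a * den x ≤ num x * den a →
                num w * den x ≤ num x * den w
  ratio-trans {w} w≤a a≤x = *-cancelʳ-≤ _ _ (den a) {{>-nonZero (den>0 a)}} (begin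
    num w * den x * den a   ≡⟨ arrange (num w) (den x) (den a) ⟩
    num w * den a * den x   ≤⟨ *-monoˡ-≤ (den x) w≤a ⟩
    num a * den w * den x   ≡⟨ arrange (num a) (den w) (den x) ⟩
    num a * den x * den w   ≤⟨ *-monoˡ-≤ (den w) a≤x ⟩
    num x * den a * den w   ≡⟨ arrange (num x) (den a) (den w) ⟩
    num x * den w * den a   ∎)
    where
    open ≤-Reasoning
    arrange : ∀ a b c → a * b * c ≡ a * c * b
    arrange = solve-∀

-- Either the top level holds at least half of the list, or the lower levels do. Halving once for
-- each level but the last gives `2 ^ j` for `j + 1` levels.
pigeonhole : ∀ {A : Set} (level : A → ℕ) c j xs →
  (∀ {x} → x ∈ˡ xs → c ≤ level x × level x ≤ c + j) →
  ∃[ i ] i ≤ c + j × length xs ≤ 2 ^ j * count (λ x → level x ≟ i) xs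
pigeonhole level c zero xs between = c , m≤m+n c 0 , ≤-reflexive (sym (trans (*-identityˡ _)
  (count-all (λ x → level x ≟ c) xs (λ x∈ → let (c≤ , ≤c) = between x∈ in
    ≤-antisym (≤-trans ≤c (≤-reflexive (+-identityʳ c))) c≤))))
pigeonhole {A} level c (suc j) xs between = split (2 * count top? xs ≥? length xs)
  where
  open ≤-Reasoning
  top? : ∀ x → Dec (level x ≡ c + suc j)
  top? x = level x ≟ c + suc j
  rest : List A
  rest = filter (¬? ∘ top?) xs
  below : ∀ {x} → x ∈ˡ rest → c ≤ level x × level x ≤ c + j
  below x∈ with x∈xs , ≢top ← ∈-filter⁻ (¬? ∘ top?) {xs = xs} x∈ with c≤ , ≤top ← between x∈xs =
    c≤ , s≤s⁻¹ (≤-trans (≤∧≢⇒< ≤top ≢top) (≤-reflexive (+-suc c j)))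
  split : Dec (2 * count top? xs ≥ length xs) →
          ∃[ i ] i ≤ c + suc j × length xs ≤ 2 ^ suc j * count (λ x → level x ≟ i) xs
  split (yes half) = c + suc j , ≤-refl , ≤-trans half (*-monoˡ-≤ _ (^-monoʳ-≤ 2 {1} {suc j} (s≤s z≤n)))
  split (no ¬half) with i , i≤ , rest≤ ← pigeonhole level c j rest below =
    i , ≤-trans i≤ (+-monoʳ-≤ c (n≤1+n j)) , (begin
      length xs                                          ≤⟨ most ⟩
      2 * length rest                                    ≤⟨ *-monoʳ-≤ 2 rest≤ ⟩
      2 * (2 ^ j * count (λ x → level x ≟ i) rest)       ≤⟨ *-monoʳ-≤ 2 (*-monoʳ-≤ (2 ^ j)
                                                              (count-filter-≤ (λ x → level x ≟ i) (¬? ∘ top?) xs)) ⟩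
      2 * (2 ^ j * count (λ x → level x ≟ i) xs)         ≡⟨ sym (*-assoc 2 (2 ^ j) _) ⟩
      2 ^ suc j * count (λ x → level x ≟ i) xs           ∎)
    where
    most : length xs ≤ 2 * length rest
    most = +-cancelˡ-≤ (length xs) _ _ (begin
      length xs + length xs                   ≡⟨ cong (length xs +_) (sym (+-identityʳ _)) ⟩
      2 * length xs                           ≡⟨ cong (2 *_) (length-split top? xs) ⟩
      2 * (count top? xs + length rest)       ≡⟨ *-distribˡ-+ 2 (count top? xs) _ ⟩
      2 * count top? xs + 2 * length rest     ≤⟨ +-monoˡ-≤ _ (<⇒≤ (≰⇒> ¬half)) ⟩
      length xs + 2 * length rest             ∎)

-- From `r = 2` on, the right side grows at least as fast as the left. This fails below, where the
-- slack shrinks until equality holds at 2, so 0, 1 and 2 are all checked directly.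
loss-bound : ∀ r → r + loss r ≤ (r + 1) * r + 3
loss-bound 0 = z≤n
loss-bound 1 = s≤s (s≤s (s≤s (s≤s z≤n)))
loss-bound (suc (suc r)) = go r
  where
  open ≤-Reasoning
  arrange₁ : ∀ r l → suc (2 + r) + (3 + (2 + r) + l) ≡ 2 + r + l + (r + 6)
  arrange₁ = solve-∀
  arrange₂ : ∀ r → (2 + r + 1) * (2 + r) + 3 + (r + 6) + r ≡ (3 + r + 1) * (3 + r) + 3
  arrange₂ = solve-∀
  go : ∀ r → 2 + r + loss (2 + r) ≤ (2 + r + 1) * (2 + r) + 3
  go zero    = ≤-refl
  go (suc r) = begin
    suc (2 + r) + (3 + (2 + r) + loss (2 + r))    ≡⟨ arrange₁ r (loss (2 + r)) ⟩
    2 + r + loss (2 + r) + (r + 6)                ≤⟨ +-monoˡ-≤ (r + 6) (go r) ⟩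
    (2 + r + 1) * (2 + r) + 3 + (r + 6)           ≤⟨ m≤m+n _ r ⟩
    (2 + r + 1) * (2 + r) + 3 + (r + 6) + r       ≡⟨ arrange₂ r ⟩
    (3 + r + 1) * (3 + r) + 3                     ∎

∣p∣≡0⇒≡⊥ : ∀ {n} {p : Subset n} → ∣ p ∣ ≡ 0 → p ≡ ⊥
∣p∣≡0⇒≡⊥ {p = []}          _  = refl
∣p∣≡0⇒≡⊥ {p = outside ∷ _} eq = cong (outside ∷_) (∣p∣≡0⇒≡⊥ eq)

module _ {r₀ r₁ n₀ n₁ : ℕ} (H : Hypergraph r₀ r₁ n₀ n₁) where

  ∈-edges⁻ : ∀ {d} → d ∈ˡ edges H → d ∈ᶠ E H
  ∈-edges⁻ = proj₂ ∘ ∈-filter⁻ (λ e → T? (E H e)) {xs = allPairs n₀ n₁}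

  codegree≤Δ : ∀ L → codegree H L ≤ Δ H ∣ proj₁ L ∣ ∣ proj₂ L ∣
  codegree≤Δ L = v≤max⁺ 0 _ (inj₂ (Any-map ≤-reflexive (∈-map⁺ (codegree H)
    (∈-filter⁺ _ (allPairs-complete L) (refl , refl)))))

  -- The hypothesis says nothing about pairs with more than `r₀` or `r₁` vertices, whereas the
  -- stages need a bound for every nonempty pair.
  codegree≡0 : ∀ L → ¬ (∣ proj₁ L ∣ ≤ r₀ × ∣ proj₂ L ∣ ≤ r₁) → codegree H L ≡ 0
  codegree≡0 L large = count-none (L ⊑?_) (edges H) (λ {d} d∈ (L₀⊆ , L₁⊆) →
    let (d₀≤ , d₁≤) = E-bound H (proj₁ d) (proj₂ d) (∈-edges⁻ d∈) in
    large (≤-trans (p⊆q⇒∣p∣≤∣q∣ L₀⊆) d₀≤ , ≤-trans (p⊆q⇒∣p∣≤∣q∣ L₁⊆) d₁≤))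

  #e>0 : NonEmpty H → 0 < #e H
  #e>0 (d , d∈) = ∈-length (∈-filter⁺ (λ e → T? (E H e)) (allPairs-complete d) d∈)

  -- There are `r₁ + 1` possible levels, which costs `2 ^ r₁`, and this is affordable when `r₀` is
  -- positive. When `r₀ = 0`, level 0 could contain only the empty edge, so its exclusion leaves
  -- `r₁` levels and saves the missing factor.
  dense-level : ¬ (r₀ ≡ 0 × r₁ ≡ 0) → ¬ (∅ ∈ᶠ E H) →
    ∃[ i ] i ≤ r₁ × #e H ≤ 2 ^ (r₀ + r₁ ∸ 1) * count (λ d → ∣ proj₂ d ∣ ≟ i) (edges H)
  dense-level r≢0 ∅∉ = go r₀ r₁ refl refl
    where
    bounds : ∀ {d} → d ∈ˡ edges H → ∣ proj₁ d ∣ ≤ r₀ × ∣ proj₂ d ∣ ≤ r₁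
    bounds d∈ = E-bound H _ _ (∈-edges⁻ d∈)
    Result = ∃[ i ] i ≤ r₁ × #e H ≤ 2 ^ (r₀ + r₁ ∸ 1) * count (λ d → ∣ proj₂ d ∣ ≟ i) (edges H)
    go : ∀ s₀ s₁ → r₀ ≡ s₀ → r₁ ≡ s₁ → Result
    go zero    zero     r₀≡ r₁≡ = contradiction (r₀≡ , r₁≡) r≢0
    go zero    (suc s₁) refl refl = pigeonhole (λ d → ∣ proj₂ d ∣) 1 s₁ (edges H) (λ {d} d∈ →
      n≢0⇒n>0 (λ d₁≡0 → ∅∉ (subst (_∈ᶠ E H) (cong₂ _,_ (∣p∣≡0⇒≡⊥ (n≤0⇒n≡0 (proj₁ (bounds d∈)))) (∣p∣≡0⇒≡⊥ d₁≡0)) (∈-edges⁻ d∈))) ,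
      proj₂ (bounds d∈))
    go (suc s₀) _       refl refl
      with i , i≤ , #≤ ← pigeonhole (λ d → ∣ proj₂ d ∣) 0 r₁ (edges H) (λ d∈ → z≤n , proj₂ (bounds d∈)) =
      i , i≤ , ≤-trans #≤ (*-monoˡ-≤ _ (^-monoʳ-≤ 2 (m≤n+m r₁ s₀)))

  module _ (b m q : ℕ) (0<b : 0 < b) (0<m : 0 < m) (0<n₁ : 0 < n₁) (0<q : 0 < q) where

    open Weights b m n₁ q

    private
      instance
        b≢0 : NonZero b
        b≢0 = >-nonZero 0<b
        m≢0 : NonZero m
        m≢0 = >-nonZero 0<m
        n₁≢0 : NonZero n₁
        n₁≢0 = >-nonZero 0<n₁
        q≢0 : NonZero q
        q≢0 = >-nonZero 0<q

    -- The pair found here attains the least constant with which all codegree hypotheses hold. Only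
    -- its own hypothesis is then needed to compare that constant with `R`.
    extremal-ratio : ¬ (r₀ ≡ 0 × r₁ ≡ 0) → 0 < #e H →
      ∃[ ℓ₀ ] ∃[ ℓ₁ ] ℓ₀ ≤ r₀ × ℓ₁ ≤ r₁ × ¬ (ℓ₀ ≡ 0 × ℓ₁ ≡ 0)
      × (∀ k₀ k₁ → k₀ ≤ r₀ → k₁ ≤ r₁ → 0 < k₀ + k₁ →
         Δ H k₀ k₁ * Y k₀ k₁ * (X ℓ₀ ℓ₁ * #e H) ≤ Δ H ℓ₀ ℓ₁ * Y ℓ₀ ℓ₁ * (X k₀ k₁ * #e H))
    extremal-ratio r≢0 0<e = unpack (maximal-ratio
        (λ (ℓ₀ , ℓ₁) → Δ H ℓ₀ ℓ₁ * Y ℓ₀ ℓ₁) (λ (ℓ₀ , ℓ₁) → X ℓ₀ ℓ₁ * #e H)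
        (λ (ℓ₀ , ℓ₁) → *-mono-≤ (X>0 ℓ₀ ℓ₁) 0<e) ℓs (∈-length (∈-ℓs ≤-refl ≤-refl (n≢0⇒n>0 r₀+r₁≢0))))
      where
      positive? : ∀ (ℓ : ℕ × ℕ) → Dec (0 < proj₁ ℓ + proj₂ ℓ)
      positive? ℓ = 0 <? proj₁ ℓ + proj₂ ℓ
      ℓs : List (ℕ × ℕ)
      ℓs = filter positive? (cartesianProduct (upTo (suc r₀)) (upTo (suc r₁)))
      ∈-ℓs : ∀ {k₀ k₁} → k₀ ≤ r₀ → k₁ ≤ r₁ → 0 < k₀ + k₁ → (k₀ , k₁) ∈ˡ ℓs
      ∈-ℓs k₀≤ k₁≤ 0< = ∈-filter⁺ positive? (∈-cartesianProduct⁺ (∈-upTo⁺ (s≤s k₀≤)) (∈-upTo⁺ (s≤s k₁≤))) 0<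
      r₀+r₁≢0 : r₀ + r₁ ≢ 0
      r₀+r₁≢0 eq = r≢0 (m+n≡0⇒m≡0 r₀ eq , m+n≡0⇒n≡0 r₀ eq)
      unpack : ∃[ a ] a ∈ˡ ℓs × (∀ {x} → x ∈ˡ ℓs → _) → _
      unpack ((ℓ₀ , ℓ₁) , ℓ∈ , max) =
        let (ℓ∈′ , 0<ℓ) = ∈-filter⁻ positive? {xs = cartesianProduct (upTo (suc r₀)) (upTo (suc r₁))} ℓ∈
            (ℓ₀∈ , ℓ₁∈) = ∈-cartesianProduct⁻ (upTo (suc r₀)) (upTo (suc r₁)) ℓ∈′
        in ℓ₀ , ℓ₁ , s≤s⁻¹ (∈-upTo⁻ ℓ₀∈) , s≤s⁻¹ (∈-upTo⁻ ℓ₁∈) ,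
           (λ (ℓ₀≡0 , ℓ₁≡0) → <⇒≢ 0<ℓ (sym (cong₂ _+_ ℓ₀≡0 ℓ₁≡0))) ,
           λ k₀ k₁ k₀≤ k₁≤ 0<k → max (∈-ℓs k₀≤ k₁≤ 0<k)

    -- Brings the hypothesis into the form of one fraction of natural numbers, the `Q` and `Y` of
    -- the integer tests.
    weight-÷ : ∀ ℓ₀ ℓ₁ e →
      (b ^ (ℓ₀ + ℓ₁ ∸ 1)) ÷ (m ^ ℓ₀ * n₁ ^ ℓ₁) *ℚ (e ÷ 1) *ℚ (m ÷ q) ^ℚ 𝟙[0< ℓ₀ ] ≡ (X ℓ₀ ℓ₁ * e) ÷ Y ℓ₀ ℓ₁
    weight-÷ ℓ₀ ℓ₁ e = begin
      B ÷ D *ℚ (e ÷ 1) *ℚ (m ÷ q) ^ℚ 𝟙[0< ℓ₀ ]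
        ≡⟨ cong₂ _*ℚ_ (÷-* B D e 1 {{D≢0}}) (power 𝟙[0< ℓ₀ ]) ⟩
      (B * e) ÷ (D * 1) *ℚ ((m ^ 𝟙[0< ℓ₀ ]) ÷ (q ^ 𝟙[0< ℓ₀ ]))
        ≡⟨ ÷-* (B * e) (D * 1) (m ^ 𝟙[0< ℓ₀ ]) (q ^ 𝟙[0< ℓ₀ ]) {{m*n≢0 D 1 {{D≢0}}}} {{m^n≢0 q 𝟙[0< ℓ₀ ]}} ⟩
      (B * e * m ^ 𝟙[0< ℓ₀ ]) ÷ (D * 1 * q ^ 𝟙[0< ℓ₀ ])
        ≡⟨ cong₂ _÷_ (arrange B e (m ^ 𝟙[0< ℓ₀ ])) (cong (_* q ^ 𝟙[0< ℓ₀ ]) (*-identityʳ D)) ⟩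
      (X ℓ₀ ℓ₁ * e) ÷ Y ℓ₀ ℓ₁ ∎
      where
      open ≡-Reasoning
      B = b ^ (ℓ₀ + ℓ₁ ∸ 1)
      D = m ^ ℓ₀ * n₁ ^ ℓ₁
      D≢0 : NonZero D
      D≢0 = m*n≢0 (m ^ ℓ₀) (n₁ ^ ℓ₁) {{m^n≢0 m ℓ₀}} {{m^n≢0 n₁ ℓ₁}}
      arrange : ∀ a b c → a * b * c ≡ a * c * b
      arrange = solve-∀
      power : ∀ j → (m ÷ q) ^ℚ j ≡ (m ^ j) ÷ (q ^ j)
      power zero    = refl
      power (suc j) = trans (cong (m ÷ q *ℚ_) (power j)) (÷-* m q (m ^ j) (q ^ j) {{it}} {{m^n≢0 q j}})

-- Assembling the containers

oracle : ∀ {n₀ n₁} → Pair n₀ n₁ → Pair n₀ n₁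
oracle (I , J) = ∁ I , J

record Algorithm {r₀ r₁ n₀ n₁ : ℕ} (H : Hypergraph r₀ r₁ n₀ n₁) (b m q M Q : ℕ) : Set where
  field
    fp rej : Pair n₀ n₁ → Pair n₀ n₁
    fp-⊑   : ∀ Z → fp Z ⊑ Z
    rej-∉  : ∀ Z v → v ∈ᵥ rej Z → v ∉ᵥ Z
    rej-fp : ∀ Z → rej (fp Z) ≡ rej Z
    ∣fp∣≤  : ∀ Z → ∣ proj₁ (fp Z) ∣ ≤ r₀ * b × ∣ proj₂ (fp Z) ∣ ≤ r₁ * b
    large  : ∀ {W} → 𝓕≤ H m W → q * Q ≤ M * ∣ proj₁ (rej (oracle W)) ∣
             ⊎ (n₁ * Q ≤ M * ∣ proj₂ (rej (oracle W)) ∣ × ∣ proj₁ (fp (oracle W)) ∣ ≡ 0)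

module _ {r₀ r₁ n₀ n₁ : ℕ} (H : Hypergraph r₀ r₁ n₀ n₁) (b m q P Q : ℕ)
         (0<b : 0 < b) (0<q : 0 < q) (0<Q : 0 < Q) (b≤m : b ≤ m) (b≤n₁ : b ≤ n₁) (0<r : 0 < r₀ + r₁)
         (0<e : 0 < #e H) where

  open Weights b m n₁ q

  private
    r K : ℕ
    r = r₀ + r₁
    K = (r + 1) * r

  module _ (Δ-ratio : ∀ k₀ k₁ → k₀ ≤ r₀ → k₁ ≤ r₁ → 0 < k₀ + k₁ → Δ H k₀ k₁ * Y k₀ k₁ * Q ≤ P * (X k₀ k₁ * #e H))
           (i : ℕ) (i≤r₁ : i ≤ r₁)
           (e≤ : #e H ≤ 2 ^ (r ∸ 1) * count (λ (d : Pair n₀ n₁) → ∣ proj₂ d ∣ ≟ i) (edges H)) where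

    private
      on-level? : ∀ (d : Pair n₀ n₁) → Dec (∣ proj₂ d ∣ ≡ i)
      on-level? d = ∣ proj₂ d ∣ ≟ i
      G : List (Pair n₀ n₁)
      G = filter on-level? (edges H)

    open Containers {n₀} b m q P Q K 0<b 0<q 0<Q b≤m b≤n₁
    open Main r₀ i r (r ∸ 1) G

    ∈-G⁻ : ∀ {d} → d ∈ˡ G → d ∈ᶠ E H × ∣ proj₂ d ∣ ≡ i
    ∈-G⁻ d∈ = let (d∈es , eq) = ∈-filter⁻ on-level? {xs = edges H} d∈ in ∈-edges⁻ H d∈es , eq

    -- Restricting to one level lowers codegrees, while `length G` falls short of `#e H` by at most
    -- `2 ^ (r ∸ 1)`; this is the initial value of `z`.
    G-codeg : ∀ L → 0 < size L → codeg L G * y L ≤ x (r ∸ 1) L * length G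
    G-codeg L 0<L with (∣ proj₁ L ∣ ≤? r₀) ×-dec (∣ proj₂ L ∣ ≤? r₁)
    ... | no large = ≤-trans (≤-reflexive (cong (_* y L) (n≤0⇒n≡0
            (≤-trans (count-filter-≤ (L ⊑?_) on-level? (edges H)) (≤-reflexive (codegree≡0 H L large)))))) z≤n
    ... | yes (L₀≤ , L₁≤) = begin
      codeg L G * (YL * Q)                 ≤⟨ *-monoˡ-≤ (YL * Q) (≤-trans (count-filter-≤ (L ⊑?_) on-level? (edges H)) (codegree≤Δ H L)) ⟩
      ΔL * (YL * Q)                        ≡⟨ sym (*-assoc ΔL YL Q) ⟩
      ΔL * YL * Q                          ≤⟨ Δ-ratio (∣ proj₁ L ∣) (∣ proj₂ L ∣) L₀≤ L₁≤ 0<L ⟩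
      P * (XL * #e H)                      ≤⟨ *-monoʳ-≤ P (*-monoʳ-≤ XL e≤) ⟩
      P * (XL * (2 ^ (r ∸ 1) * length G))  ≡⟨ arrange P XL (2 ^ (r ∸ 1)) (length G) ⟩
      2 ^ (r ∸ 1) * (P * XL) * length G    ∎
      where
      open ≤-Reasoning
      ΔL = Δ H ∣ proj₁ L ∣ ∣ proj₂ L ∣
      XL = X ∣ proj₁ L ∣ ∣ proj₂ L ∣
      YL = Y ∣ proj₁ L ∣ ∣ proj₂ L ∣
      arrange : ∀ p x t g → p * (x * (t * g)) ≡ t * (p * x) * g
      arrange = solve-∀

    G-nonempty : 0 < length G
    G-nonempty = n≢0⇒n>0 (λ eq → <⇒≱ 0<e (≤-trans e≤ (≤-reflexive
      (trans (cong (2 ^ (r ∸ 1) *_) eq) (*-zeroʳ (2 ^ (r ∸ 1)))))))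

    total-loss : r ∸ 1 + 1 + loss r ≤ K + 3
    total-loss = ≤-trans (≤-reflexive (cong (_+ loss r) (m∸n+n≡m 0<r))) (loss-bound r)

    algorithm : Algorithm H b m q (2 ^ K * P) Q
    algorithm = record
      { fp     = fingerprint tree
      ; rej    = λ Z → collect (rejected tree Z)
      ; fp-⊑   = fingerprint-⊑ tree
      ; rej-∉  = λ Z v → rejected-∉ tree Z ∘ ∈-collect⁻ v (rejected tree Z)
      ; rej-fp = λ Z → cong collect (rejected-fingerprint tree Z)
      ; ∣fp∣≤  = λ Z → fingerprint-bound₀ Z , ≤-trans (fingerprint-bound₁ Z) (*-monoˡ-≤ b i≤r₁)
      ; large  = λ {W} (indep , I≤m) → container (oracle W)
          (≤-trans (≤-reflexive (+-comm i r₀)) (+-monoʳ-≤ r₀ i≤r₁)) total-loss G-codeg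
          (λ {d} d∈ → let (d₀≤ , d₁≤) = E-bound H (proj₁ d) (proj₂ d) (proj₁ (∈-G⁻ d∈)) in +-mono-≤ d₀≤ d₁≤)
          G-nonempty
          (λ {d} d∈ → proj₂ (∈-G⁻ d∈) , proj₁ (E-bound H (proj₁ d) (proj₂ d) (proj₁ (∈-G⁻ d∈))))
          (λ {d} d∈ → indep d (proj₁ (∈-G⁻ d∈)))
          (≤-trans (p⊆q⇒∣p∣≤∣q∣ {q = proj₁ W} (x∉∁p⇒x∈p ∘ x∈∁p⇒x∉p)) I≤m)
      }

HasContainers : ∀ {r₀ r₁ n₀ n₁} → Hypergraph r₀ r₁ n₀ n₁ → (b m q : ℕ) → ℝ → Set
HasContainers {r₀} {r₁} {n₀} {n₁} H b m q δ =
    Σ[ 𝓢 ∈ Family n₀ n₁ ]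
    Σ[ f ∈ ([ s ∈ Pair n₀ n₁ ∣ s ∈ᶠ 𝓢 ] → Pair n₀ n₁) ]
    Σ[ g ∈ ([ W ∈ Pair n₀ n₁ ∣ 𝓕≤ H m W ] → [ s ∈ Pair n₀ n₁ ∣ s ∈ᶠ 𝓢 ]) ]
      Bounded (r₀ * b) (r₁ * b) 𝓢
      × ((W : [ W ∈ Pair n₀ n₁ ∣ 𝓕≤ H m W ]) →
               let (I , J) = value W
                   (A , B) = f (g W)
               in A ⊆ I × J ⊆ B)
      × ((s : [ s ∈ Pair n₀ n₁ ∣ s ∈ᶠ 𝓢 ]) →
               let (A , B) = f s
               in (δ *ᴿ fromℕ q ≤ᴿ fromℕ ∣ A ∣)
                  ⊎ (fromℕ ∣ B ∣ ≤ᴿ (1ᴿ -ᴿ δ) *ᴿ fromℕ n₁))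
      × ((W : [ W ∈ Pair n₀ n₁ ∣ 𝓕≤ H m W ]) →
               let (I , J)   = value W
                   (S₀ , S₁) = value (g W)
                   (A , B)   = f (g W)
               in S₀ ⊆ ∁ I × S₁ ⊆ J × (0 < ∣ S₀ ∣ → δ *ᴿ fromℕ q ≤ᴿ fromℕ ∣ A ∣))
module Assembly {r₀ r₁ n₀ n₁ : ℕ} (H : Hypergraph r₀ r₁ n₀ n₁) (b m q M Q : ℕ)
  (alg : Algorithm H b m q M Q) (δ : ℝ)
  (lower : ∀ c → q * Q ≤ M * c → δ *ᴿ fromℕ q ≤ᴿ fromℕ c)
  (upper : ∀ c d → n₁ * Q ≤ M * c → d + c ≡ n₁ → fromℕ d ≤ᴿ (1ᴿ -ᴿ δ) *ᴿ fromℕ n₁) where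

  open Algorithm alg

  -- 𝓢 is cut out by decidable conditions on natural numbers that imply
  -- property (ii), instead of being the image of g.
  Large₀ Large₁ In𝓢 : Pair n₀ n₁ → Set
  Large₀ A = q * Q ≤ M * ∣ proj₁ A ∣
  Large₁ A = n₁ * Q ≤ M * ∣ proj₂ A ∣
  In𝓢 s = (∣ proj₁ s ∣ ≤ r₀ * b × ∣ proj₂ s ∣ ≤ r₁ * b) × (Large₀ (rej s) ⊎ Large₁ (rej s))

  large₀? : ∀ A → Dec (Large₀ A)
  large₀? A = q * Q ≤? M * ∣ proj₁ A ∣

  in𝓢? : ∀ s → Dec (In𝓢 s)
  in𝓢? s = ((∣ proj₁ s ∣ ≤? r₀ * b) ×-dec (∣ proj₂ s ∣ ≤? r₁ * b))
           ×-dec (large₀? (rej s) ⊎-dec (n₁ * Q ≤? M * ∣ proj₂ (rej s) ∣))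

  𝓢 : Family n₀ n₁
  𝓢 s = ⌊ in𝓢? s ⌋

  f : [ s ∈ Pair n₀ n₁ ∣ s ∈ᶠ 𝓢 ] → Pair n₀ n₁
  f s = proj₁ (rej (value s)) , ∁ (proj₂ (rej (value s)))

  fp∈𝓢 : ∀ {W} → 𝓕≤ H m W → In𝓢 (fp (oracle W))
  fp∈𝓢 {W} p = ∣fp∣≤ (oracle W) ,
    subst (λ A → Large₀ A ⊎ Large₁ A) (sym (rej-fp (oracle W))) ([ inj₁ , inj₂ ∘ proj₁ ]′ (large {W} p))

  g : [ W ∈ Pair n₀ n₁ ∣ 𝓕≤ H m W ] → [ s ∈ Pair n₀ n₁ ∣ s ∈ᶠ 𝓢 ]
  g (W ,ᵣ [ p ]) = fp (oracle W) ,ᵣ [ fromWitness {a? = in𝓢? (fp (oracle W))} (fp∈𝓢 p) ]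

  bounded : Bounded (r₀ * b) (r₁ * b) 𝓢
  bounded s₀ s₁ s∈ = proj₁ (toWitness {a? = in𝓢? (s₀ , s₁)} s∈)

  rej-g : ∀ W v → v ∈ᵥ rej (fp (oracle W)) → v ∉ᵥ oracle W
  rej-g W v v∈ = rej-∉ (oracle W) v (subst (v ∈ᵥ_) (rej-fp (oracle W)) v∈)

  contained : ∀ W → proj₁ (f (g W)) ⊆ proj₁ (value W) × proj₂ (value W) ⊆ proj₂ (f (g W))
  contained W =
    (λ {u} u∈A → x∉∁p⇒x∈p (rej-g (value W) (inj₁ u) u∈A)) ,
    (λ {u} u∈J → x∉p⇒x∈∁p (λ u∈ → rej-g (value W) (inj₂ u) u∈ u∈J))

  -- Membership in `𝓢` is an irrelevant proof, but choosing a side of the disjunction is relevant.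
  -- Decidability of `In𝓢` recovers the choice.
  small : ∀ s → (δ *ᴿ fromℕ q ≤ᴿ fromℕ ∣ proj₁ (f s) ∣) ⊎ (fromℕ ∣ proj₂ (f s) ∣ ≤ᴿ (1ᴿ -ᴿ δ) *ᴿ fromℕ n₁)
  small (s ,ᵣ [ s∈ ]) with proj₂ (recompute (in𝓢? s) (toWitness {a? = in𝓢? s} s∈))
  ... | inj₁ l₀ = inj₁ (lower ∣ proj₁ (rej s) ∣ l₀)
  ... | inj₂ l₁ = inj₂ (upper ∣ B ∣ ∣ ∁ B ∣ l₁ (trans (cong (_+ ∣ B ∣) (∣∁p∣≡n∸∣p∣ B)) (m∸n+n≡m (∣p∣≤n B))))
    where B = proj₂ (rej s)

  fingerprints : ∀ W → proj₁ (value (g W)) ⊆ ∁ (proj₁ (value W)) × proj₂ (value (g W)) ⊆ proj₂ (value W)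
                 × (0 < ∣ proj₁ (value (g W)) ∣ → δ *ᴿ fromℕ q ≤ᴿ fromℕ ∣ proj₁ (f (g W)) ∣)
  fingerprints (W ,ᵣ [ p ]) = proj₁ (fp-⊑ Z) , proj₂ (fp-⊑ Z) , λ 0<S →
    -- The proof of independence is irrelevant too, so only the decidable inequality derived from it
    -- is recomputed, before passing to real numbers.
    lower ∣ proj₁ (rej (fp Z)) ∣ (subst Large₀ (sym (rej-fp Z)) (recompute (large₀? (rej Z))
      ([ id , (λ (_ , S≡0) → contradiction (sym S≡0) (<⇒≢ 0<S)) ]′ (large {W} p))))
    where Z = oracle W

  hasContainers : HasContainers H b m q δ
  hasContainers = 𝓢 , f , g , bounded , contained , small , fingerprints

module _ {r₀ r₁ n₀ n₁ : ℕ} (H : Hypergraph r₀ r₁ n₀ n₁) (b m q : ℕ) where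

  -- Every pair violates the empty edge, so there is nothing to cover and the empty family serves.
  -- With the empty edge excluded, `dense-level` applies.
  hasContainers-violated : ∅ ∈ᶠ E H → ∀ δ → HasContainers H b m q δ
  hasContainers-violated ∅∈ δ =
    (λ _ → false) , (λ _ → ∅) , (λ { (W ,ᵣ [ p ]) → ∅ ,ᵣ [ none {W} p ] }) ,
    (λ _ _ ()) ,
    (λ { (W ,ᵣ [ p ]) → ⊥-elim-irr (none {W} p) }) ,
    (λ { (_ ,ᵣ [ p ]) → ⊥-elim-irr p }) ,
    (λ { (W ,ᵣ [ p ]) → ⊥-elim-irr (none {W} p) })
    where
    none : ∀ {W} → ¬ 𝓕≤ H m W
    none (indep , _) = indep ∅ ∅∈ (⊥-elim ∘ ∉⊥ , ⊥-elim ∘ ∉⊥)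

  module _ (r≢0 : ¬ (r₀ ≡ 0 × r₁ ≡ 0)) (ne : NonEmpty H) (∅∉ : ¬ (∅ ∈ᶠ E H))
           (0<b : 0 < b) (0<m : 0 < m) (0<q : 0 < q) (b≤m : b ≤ m) (b≤n₁ : b ≤ n₁) where

    open Weights b m n₁ q

    private
      0<n₁ : 0 < n₁
      0<n₁ = <-≤-trans 0<b b≤n₁
      0<e : 0 < #e H
      0<e = #e>0 H ne
      K : ℕ
      K = (r₀ + r₁ + 1) * (r₀ + r₁)

    hasContainers-extremal : (R : ℝ) (R>0 : 0ᴿ <ᴿ R) → ∀ ℓ₀ ℓ₁ →
      fromℕ (Δ H ℓ₀ ℓ₁) ≤ᴿ R *ᴿ fromℚ ((X ℓ₀ ℓ₁ * #e H) ÷ Y ℓ₀ ℓ₁) →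
      (∀ k₀ k₁ → k₀ ≤ r₀ → k₁ ≤ r₁ → 0 < k₀ + k₁ →
       Δ H k₀ k₁ * Y k₀ k₁ * (X ℓ₀ ℓ₁ * #e H) ≤ Δ H ℓ₀ ℓ₁ * Y ℓ₀ ℓ₁ * (X k₀ k₁ * #e H)) →
      HasContainers H b m q (fromℚ (1 ÷ (2 ^ K)) *ᴿ inv R R>0)
    hasContainers-extremal R R>0 ℓ₀ ℓ₁ R-bound Δ-ratio =
      let (i , i≤r₁ , e≤) = dense-level H r≢0 ∅∉ in
      Assembly.hasContainers H b m q (2 ^ K * (Δ H ℓ₀ ℓ₁ * Y ℓ₀ ℓ₁)) (X ℓ₀ ℓ₁ * #e H)
        (algorithm H b m q (Δ H ℓ₀ ℓ₁ * Y ℓ₀ ℓ₁) (X ℓ₀ ℓ₁ * #e H) 0<b 0<q 0<Q b≤m b≤n₁ 0<r 0<e Δ-ratio i i≤r₁ e≤)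
        (fromℚ (1 ÷ (2 ^ K)) *ᴿ inv R R>0)
        (δ-lower R R>0 K (Δ H ℓ₀ ℓ₁) (X ℓ₀ ℓ₁ * #e H) (Y ℓ₀ ℓ₁) 0<Q 0<Y R-bound q)
        (δ-upper R R>0 K (Δ H ℓ₀ ℓ₁) (X ℓ₀ ℓ₁ * #e H) (Y ℓ₀ ℓ₁) 0<Q 0<Y R-bound n₁)
      where
      0<Q : 0 < X ℓ₀ ℓ₁ * #e H
      0<Q = *-mono-≤ (X>0 {{>-nonZero 0<b}} {{>-nonZero 0<m}} ℓ₀ ℓ₁) 0<e
      0<Y : 0 < Y ℓ₀ ℓ₁
      0<Y = Y>0 {{>-nonZero 0<m}} {{>-nonZero 0<n₁}} {{>-nonZero 0<q}} ℓ₀ ℓ₁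
      0<r : 0 < r₀ + r₁
      0<r = n≢0⇒n>0 (λ eq → r≢0 (m+n≡0⇒m≡0 r₀ eq , m+n≡0⇒n≡0 r₀ eq))

theorem2p1 :
    (r₀ r₁ : ℕ) → ¬ (r₀ ≡ 0 × r₁ ≡ 0) →
    (R : ℝ) (R>0 : 0ᴿ <ᴿ R) →
    (n₀ n₁ : ℕ) (H : Hypergraph r₀ r₁ n₀ n₁) → NonEmpty H →
    (b m q : ℕ) → 0 < b → 0 < m → 0 < q → b ≤ m ⊓ n₁ →
    (∀ ℓ₀ ℓ₁ → ℓ₀ ≤ r₀ → ℓ₁ ≤ r₁ → ¬ (ℓ₀ ≡ 0 × ℓ₁ ≡ 0) →
      fromℕ (Δ H ℓ₀ ℓ₁) ≤ᴿ
        R *ᴿ fromℚ ((b ^ (ℓ₀ + ℓ₁ ∸ 1)) ÷ (m ^ ℓ₀ * n₁ ^ ℓ₁) *ℚ (#e H ÷ 1) *ℚ (m ÷ q) ^ℚ 𝟙[0< ℓ₀ ])) →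
    let δ = fromℚ (1 ÷ (2 ^ ((r₀ + r₁ + 1) * (r₀ + r₁)))) *ᴿ inv R R>0 in
    Σ[ 𝓢 ∈ Family n₀ n₁ ]
    Σ[ f ∈ ([ s ∈ Pair n₀ n₁ ∣ s ∈ᶠ 𝓢 ] → Pair n₀ n₁) ]
    Σ[ g ∈ ([ W ∈ Pair n₀ n₁ ∣ 𝓕≤ H m W ] → [ s ∈ Pair n₀ n₁ ∣ s ∈ᶠ 𝓢 ]) ]
      Bounded (r₀ * b) (r₁ * b) 𝓢
      × ((W : [ W ∈ Pair n₀ n₁ ∣ 𝓕≤ H m W ]) →
               let (I , J) = value W
                   (A , B) = f (g W)
               in A ⊆ I × J ⊆ B)
      × ((s : [ s ∈ Pair n₀ n₁ ∣ s ∈ᶠ 𝓢 ]) →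
               let (A , B) = f s
               in (δ *ᴿ fromℕ q ≤ᴿ fromℕ ∣ A ∣)
                  ⊎ (fromℕ ∣ B ∣ ≤ᴿ (1ᴿ -ᴿ δ) *ᴿ fromℕ n₁))
      × ((W : [ W ∈ Pair n₀ n₁ ∣ 𝓕≤ H m W ]) →
               let (I , J)   = value W
                   (S₀ , S₁) = value (g W)
                   (A , B)   = f (g W)
               in S₀ ⊆ ∁ I × S₁ ⊆ J × (0 < ∣ S₀ ∣ → δ *ᴿ fromℕ q ≤ᴿ fromℕ ∣ A ∣))
theorem2p1 r₀ r₁ r≢0 R R>0 n₀ n₁ H ne b m q 0<b 0<m 0<q b≤ hyp = by-cases (T? (E H ∅))
  where
  b≤n₁ : b ≤ n₁
  b≤n₁ = ≤-trans b≤ (m⊓n≤n m n₁)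
  0<n₁ : 0 < n₁
  0<n₁ = <-≤-trans 0<b b≤n₁
  by-cases : Dec (∅ ∈ᶠ E H) →
    HasContainers H b m q (fromℚ (1 ÷ (2 ^ ((r₀ + r₁ + 1) * (r₀ + r₁)))) *ᴿ inv R R>0)
  by-cases (yes ∅∈) = hasContainers-violated H b m q ∅∈ (fromℚ (1 ÷ (2 ^ ((r₀ + r₁ + 1) * (r₀ + r₁)))) *ᴿ inv R R>0)
  by-cases (no ∅∉) =
    let (ℓ₀ , ℓ₁ , ℓ₀≤ , ℓ₁≤ , ℓ≢0 , Δ-ratio) = extremal-ratio H b m q 0<b 0<m 0<n₁ 0<q r≢0 (#e>0 H ne) in
    hasContainers-extremal H b m q r≢0 ne ∅∉ 0<b 0<m 0<q (≤-trans b≤ (m⊓n≤m m n₁)) b≤n₁ R R>0 ℓ₀ ℓ₁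
      (subst (λ c → fromℕ (Δ H ℓ₀ ℓ₁) ≤ᴿ R *ᴿ fromℚ c)
        (weight-÷ H b m q 0<b 0<m 0<n₁ 0<q ℓ₀ ℓ₁ (#e H)) (hyp ℓ₀ ℓ₁ ℓ₀≤ ℓ₁≤ ℓ≢0))
      Δ-ratio
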